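{- Let $p$ be a prime and let $n,K\ge 1$ be integers with $\gcd(n,p)=1$. Put $L=p^{K-1}$, $\widetilde G=\mathbb{Z}_n\times\mathbb{Z}_{p^K}$ and $G=\mathbb{Z}_n\times\mathbb{Z}_L$. Let $P,Q\subset\widetilde G$ satisfy $P\oplus Q=\widetilde G$ and $Q(1,\zeta_p)=0$, where $\zeta_p$ is a primitive $p$-th root of unity. For $0\le r,q\le p-1$ let $$E_r=\{(h,j)\in G:(h,r+pj)\in P\},\qquad C_q=\{(h,j)\in G:(h,q+pj)\in Q\}.$$ Then for each integer $\eta$ the element $$F_\eta(x,y)=\sum_{r=0}^{p-1}y^{\eta r}E_r(x,y)\in \mathbb{Z}[x,y]/(x^n-1,\,y^L-1)$$ is the mask of a subset $D_\eta\subset G$, and $$D_\eta\oplus C_q=G\qquad(0\le q<p).$$ The translated slices $E_r+(0,\eta r)$, $0\le r<p$, are therefore pairwise disjoint subsets of $G$. Moreover, $$D_\eta(x,1)=P(x,1),\qquad Q(x,1)=\sum_{q=0}^{p-1}C_q(x,1)$$ in $\mathbb{Z}[x]/(x^n-1)$. These conclusions include the case $K=1$.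
   Context: $\mathbb{Z}_m=\mathbb{Z}/m\mathbb{Z}$. For subsets $X,Y$ of a finite abelian group $H$, $X\oplus Y=H$ means every element of $H$ has a unique representation $u+v$ with $u\in X$, $v\in Y$. The mask of a subset $E\subset\mathbb{Z}_n\times\mathbb{Z}_m$ is $E(x,t)=\sum_{(h,k)\in E}x^ht^k$, with $h,k$ replaced by their standard representatives in $\{0,\ldots,n-1\}$ and $\{0,\ldots,m-1\}$; it is also regarded as an element of the ring $\mathbb{Z}[x,t]/(x^n-1,t^m-1)$. For subsets of $G$ the second variable is written $y$, and masks are regarded in $\mathbb{Z}[x,y]/(x^n-1,y^L-1)$, in which $y$ is invertible, so $y^{\eta r}$ makes sense for every integer $\eta$. In the definitions of $E_r,C_q$, the second coordinate $k\in\mathbb{Z}_{p^K}$ is written as $r+pj$ with $0\le r<p$ and $j\in\mathbb{Z}_L$. -}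

module Defs where

open import Level using (Level; 0ℓ; _⊔_)
open import Algebra.Bundles using (RawRing; CommutativeRing)
open import Algebra.Apartness.Bundles using (HeytingField; HeytingCommutativeRing)
import Algebra.Definitions.RawSemiring as RawSemiringDefs
open import Data.Bool.Base using (Bool; T; if_then_else_)
open import Data.Fin.Base using (Fin; toℕ; fromℕ<)
open import Data.Fin.Properties using (nonZeroIndex)
open import Data.Integer.Base as ℤ using (ℤ; +_; -[1+_])
open import Data.Integer.DivMod using (_%ℕ_; n%ℕd<d)
open import Data.List.Base using (List; []; _∷_; map)
open import Data.Nat.Base as ℕ using (ℕ; zero; suc; NonZero; _∸_; _<_)
open import Data.Nat.DivMod using (_mod_)
open import Data.Nat.Properties using (m^n≢0)
open import Data.Product using (∃; ∃!; _×_; _,_)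
open import Data.Vec.Functional using (Vector) renaming ([] to []ᵛ; _∷_ to _∷ᵛ_)
open import Relation.Binary.PropositionalEquality using (_≡_)
open import Relation.Nullary.Negation using (¬_)
open import Relation.Unary using (Pred)

private
  variable
    a c ℓ ℓ₁ ℓ₂ : Level
    A : Set a
    n m : ℕ

-- ℤ_m is Fin m; toℕ gives the standard representative.

infixl 6 _+ₘ_ _⊞_

_+ₘ_ : Fin m → Fin m → Fin m
_+ₘ_ {m} i j = (toℕ i ℕ.+ toℕ j) mod m
  where instance _ = nonZeroIndex i

residue : ∀ m .{{_ : NonZero m}} → ℤ → Fin m
residue m z = fromℕ< (n%ℕd<d z m)

ℤ²[_,_] : ℕ → ℕ → Set
ℤ²[ n , m ] = Fin n × Fin m

_⊞_ : ℤ²[ n , m ] → ℤ²[ n , m ] → ℤ²[ n , m ]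
(h , k) ⊞ (h′ , k′) = h +ₘ h′ , k +ₘ k′

Subset : Set a → Set a
Subset A = A → Bool

infix 4 _∈_

_∈_ : A → Subset A → Set
u ∈ X = T (X u)

-- X ⊕ Y = ℤ_n × ℤ_m: unique representation of every element.
Tiles : Subset ℤ²[ n , m ] → Subset ℤ²[ n , m ] → Set
Tiles {n} {m} X Y = (g : ℤ²[ n , m ]) →
  ∃! {A = ℤ²[ n , m ] × ℤ²[ n , m ]} _≡_
    λ (u , v) → u ∈ X × v ∈ Y × u ⊞ v ≡ g

-- The translate X + (0 , z).
shift : ℤ → Subset ℤ²[ n , m ] → Pred ℤ²[ n , m ] 0ℓ
shift {m = m} z X (h , k) =
  ∃ λ j → (h , j) ∈ X × k ≡ j +ₘ residue m {{nonZeroIndex j}} z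

-- { (h , j) : (h , r + p j) ∈ X }, where L = p ^ (K ∸ 1).  For K ≥ 1 the
-- number r + p j is already less than p ^ K, so `mod` does not change it.
slice : ∀ {n} p K → Subset ℤ²[ n , p ℕ.^ K ] →
        Fin p → Subset ℤ²[ n , p ℕ.^ (K ∸ 1) ]
slice p K X r (h , j) = X (h , (toℕ r ℕ.+ p ℕ.* toℕ j) mod (p ℕ.^ K))
  where instance _ = m^n≢0 p K {{nonZeroIndex r}}

-- Polynomials are coefficient lists, constant term first, compared
-- coefficientwise, so trailing zeros are irrelevant.
module _ (R : RawRing c ℓ) where
  private module R = RawRing R

  coeff : List R.Carrier → ℕ → R.Carrier
  coeff []      _       = R.0#
  coeff (a ∷ _) zero    = a
  coeff (_ ∷ f) (suc i) = coeff f i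

  addPoly : List R.Carrier → List R.Carrier → List R.Carrier
  addPoly []      g       = g
  addPoly (a ∷ f) []      = a ∷ f
  addPoly (a ∷ f) (b ∷ g) = (a R.+ b) ∷ addPoly f g

  mulPoly : List R.Carrier → List R.Carrier → List R.Carrier
  mulPoly []      g = []
  mulPoly (a ∷ f) g = addPoly (map (a R.*_) g) (R.0# ∷ mulPoly f g)

  Polynomial : RawRing c ℓ
  Polynomial = record
    { Carrier = List R.Carrier
    ; _≈_     = λ f g → ∀ i → coeff f i R.≈ coeff g i
    ; _+_     = addPoly
    ; _*_     = mulPoly
    ; -_      = map R.-_
    ; 0#      = []
    ; 1#      = R.1# ∷ []
    }

  constant : R.Carrier → List R.Carrier
  constant a = a ∷ []

  variable-X : List R.Carrier
  variable-X = R.0# ∷ R.1# ∷ []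

-- The quotient of R by the ideal generated by the entries of g: the same
-- operations, with equality replaced by congruence modulo the ideal.
module _ (R : RawRing c ℓ) where
  open RawRing R
  open RawSemiringDefs rawSemiring using (sum)

  Quotient : ∀ {k} → Vector Carrier k → RawRing c (c ⊔ ℓ)
  Quotient {k} g = record
    { Carrier = Carrier
    ; _≈_     = λ a b → ∃ λ (t : Vector Carrier k) → a ≈ b + sum (λ i → t i * g i)
    ; _+_     = _+_
    ; _*_     = _*_
    ; -_      = -_
    ; 0#      = 0#
    ; 1#      = 1#
    }

powerMinusOne : (R : RawRing c ℓ) → RawRing.Carrier R → ℕ → RawRing.Carrier R
powerMinusOne R u k = u ^ k + - 1#
  where
  open RawRing R
  open RawSemiringDefs rawSemiring using (_^_)

ℤ[x] : RawRing 0ℓ 0ℓ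
ℤ[x] = Polynomial ℤ.+-*-rawRing

ℤ[x,y] : RawRing 0ℓ 0ℓ
ℤ[x,y] = Polynomial ℤ[x]

x₁ : RawRing.Carrier ℤ[x]
x₁ = variable-X ℤ.+-*-rawRing

x₂ y₂ : RawRing.Carrier ℤ[x,y]
x₂ = constant ℤ[x] x₁
y₂ = variable-X ℤ[x]

ℤ[x]/⟨_⟩ : ℕ → RawRing 0ℓ 0ℓ
ℤ[x]/⟨ n ⟩ = Quotient ℤ[x] (powerMinusOne ℤ[x] x₁ n ∷ᵛ []ᵛ)

ℤ[x,y]/⟨_,_⟩ : ℕ → ℕ → RawRing 0ℓ 0ℓ
ℤ[x,y]/⟨ n , L ⟩ =
  Quotient ℤ[x,y]
    (powerMinusOne ℤ[x,y] x₂ n ∷ᵛ powerMinusOne ℤ[x,y] y₂ L ∷ᵛ []ᵛ)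

-- E(u,v) = Σ u^h v^k over (h,k) ∈ E, evaluated at elements u, v of R.
-- Taking for u, v the generators of ℤ[x,y]/(xⁿ - 1, yᴸ - 1) gives the mask
-- itself as an element of that ring.
mask : (R : RawRing c ℓ) → Subset ℤ²[ n , m ] →
       RawRing.Carrier R → RawRing.Carrier R → RawRing.Carrier R
mask R E u v =
  sum λ h → sum λ k → if E (h , k) then u ^ toℕ h * v ^ toℕ k else 0#
  where
  open RawRing R
  open RawSemiringDefs rawSemiring using (_^_; sum)

maskᴳ : Subset ℤ²[ n , m ] → RawRing.Carrier ℤ[x,y]/⟨ n , m ⟩
maskᴳ {n} {m} E = mask ℤ[x,y]/⟨ n , m ⟩ E x₂ y₂

mask₁ : Subset ℤ²[ n , m ] → RawRing.Carrier ℤ[x]/⟨ n ⟩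
mask₁ {n} E = mask ℤ[x]/⟨ n ⟩ E x₁ (RawRing.1# ℤ[x]/⟨ n ⟩)

-- Integer powers of y in ℤ[x,y]/(xⁿ - 1, yᴸ - 1), L ≥ 1, where the inverse
-- of y is y ^ (L - 1).
y^ : ∀ n L → ℤ → RawRing.Carrier ℤ[x,y]/⟨ n , L ⟩
y^ n L = λ where
    (+ k)    → y₂ ^ k
    -[1+ k ] → (y₂ ^ (L ∸ 1)) ^ suc k
  where
  open RawSemiringDefs (RawRing.rawSemiring ℤ[x,y]/⟨ n , L ⟩) using (_^_)

twistedSum : ∀ {n L p} → ℤ → (Fin p → Subset ℤ²[ n , L ]) →
             RawRing.Carrier ℤ[x,y]/⟨ n , L ⟩
twistedSum {n} {L} η E = sum λ r → y^ n L (η ℤ.* + toℕ r) * maskᴳ (E r)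
  where
  open RawRing ℤ[x,y]/⟨ n , L ⟩
  open RawSemiringDefs rawSemiring using (sum)

sumMask₁ : ∀ {n L p} → (Fin p → Subset ℤ²[ n , L ]) →
           RawRing.Carrier ℤ[x]/⟨ n ⟩
sumMask₁ {n} C = sum λ q → mask₁ (C q)
  where open RawSemiringDefs (RawRing.rawSemiring ℤ[x]/⟨ n ⟩) using (sum)

-- The standard library has no ℂ, so roots of unity are taken in an arbitrary
-- field of characteristic zero.
module _ (𝔽 : HeytingField c ℓ₁ ℓ₂) where
  open HeytingField 𝔽 using (Carrier; _≈_; 0#; 1#; heytingCommutativeRing)

  fieldRing : RawRing c ℓ₁
  fieldRing = CommutativeRing.rawRing
    (HeytingCommutativeRing.commutativeRing heytingCommutativeRing)

  open RawSemiringDefs (RawRing.rawSemiring fieldRing)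
    using (_^_) renaming (_×_ to _·_)

  CharacteristicZero : Set ℓ₁
  CharacteristicZero = ∀ k → 0 < k → ¬ k · 1# ≈ 0#

  IsPrimitiveRoot : ℕ → Carrier → Set ℓ₁
  IsPrimitiveRoot m ζ = ζ ^ m ≈ 1# × (∀ k → 0 < k → k < m → ¬ ζ ^ k ≈ 1#)

  VanishesAt : Subset ℤ²[ n , m ] → Carrier → Set ℓ₁
  VanishesAt E ζ = mask fieldRing E 1# ζ ≈ 0#

{-# OPTIONS --safe #-}

-- Write N = p^K and let μ_h be the multiset of pairs (k , l) of second
-- coordinates of those a ∈ P, b ∈ Q whose first coordinates add up to h.
--
-- By Tijdeman's theorem P may be dilated by any integer prime to |P|, in
-- particular by c in the second coordinate alone when p ∤ c; hence c k + l is
-- uniform mod N on μ_h for all such c.  Using the slopes c ≡ 1 (mod p), the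
-- number of (k , l) in μ_h with k ≡ r, l ≡ q (mod p) and k + l ≡ t (mod N) does
-- not depend on t ≡ r + q (mod p).  So the product E_r C_q in ℤ[G] is
-- V_{rq}(x) · (1 + y + ⋯ + y^(L-1)), whence D_η C_q = U_q(x) · (1 + y + ⋯)
-- with U_q = Σ_r V_{rq}, and the claim is that all coefficients of U_q are 1.
--
-- The slopes c ≢ 0 (mod p) make the sum of V over each line of 𝔽_p² that is
-- neither a row nor a column equal to 1, so U_q + R_r = 1 + p V_{rq}, with
-- R_r = Σ_q V_{rq}.  When Q is equidistributed mod p, the product (U_q - 1) R_r
-- vanishes in ℤ[ℤ_n]; modulo p it is -(U_q - 1)², and 𝔽_p[ℤ_n] is reduced
-- because p ∤ n.  Thus U_q ≡ 1 (mod p), so every coefficient is positive, and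
-- they are 1 because Σ_q U_q = p.
--
-- Equidistribution: summing over ℤ_n, the relations factor as
-- (|U_q| - n) (|R_r| - n) = 0.  If |U_q| ≠ n for some q, then the numbers |Q_q|
-- are proportional to integers w_q of sum n with Σ w_q ζ^q = 0.  Raising this to
-- the p-th power gives a linear relation with matrix ≡ n I (mod p) among the
-- powers of ζ, which is impossible in characteristic zero.

module Submission where

open import Algebra.Apartness.Bundles using (HeytingField; HeytingCommutativeRing)
open import Algebra.Bundles using (RawRing; CommutativeRing)
import Algebra.Definitions.RawSemiring as RawSemiringDefs
import Algebra.Properties.CommutativeMonoid.Mult as MonoidMult
import Algebra.Properties.CommutativeMonoid.Sum as MonoidSum
import Algebra.Properties.CommutativeSemigroup as CommutativeSemigroupProperties
import Algebra.Properties.CommutativeSemiring.Binomial as Binomial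
import Algebra.Properties.CommutativeSemiring.Exp as SemiringExp
import Algebra.Properties.Group as GroupProperties
import Algebra.Properties.Ring as RingProperties
import Algebra.Properties.Semiring.Mult as SemiringMult
import Algebra.Properties.Semiring.Sum as SemiringSum
open import Algebra.Structures using (IsCommutativeRing)
open import Data.Bool.Base using (if_then_else_; Bool; true; false)
open import Data.Bool.Properties using (T?; T-≡; ¬-not)
open import Data.Empty using (⊥-elim)
open import Data.Fin.Base using (zero; suc; Fin; toℕ; fromℕ; inject₁; fromℕ<)
open import Data.Fin.Permutation using (Permutation; permutation)
import Data.Fin.Properties as Fin
open import Data.Fin.Properties using (toℕ<n; toℕ-fromℕ; toℕ-inject₁; toℕ-fromℕ<; toℕ-injective; nonZeroIndex; any?)
import Data.Integer.DivMod as ℤ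
open import Data.Integer.DivMod using (n%ℕd<d)
import Data.Integer.Properties as ℤ
open import Data.Integer.Tactic.RingSolver using (solve-∀)
open import Data.List.Base using (List; []; _∷_; _++_; map; concatMap; length; upTo; applyUpTo; replicate; cartesianProduct; filter; allFin; tabulate)
open import Data.List.Membership.Propositional using () renaming (_∈_ to _∈ˡ_)
open import Data.List.Membership.Propositional.Properties using (∈-upTo⁺; ∈-upTo⁻; ∈-cartesianProduct⁺; ∈-filter⁺; ∈-filter⁻; ∈-cartesianProduct⁻; ∈-allFin)
open import Data.List.Properties using (length-applyUpTo; length-map; map-∘; map-cong; map-id)
open import Data.List.Relation.Unary.All using (All; []; _∷_)
open import Data.List.Relation.Unary.AllPairs using ([]; _∷_)
open import Data.List.Relation.Unary.Any using (here; there)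
open import Data.List.Relation.Unary.Unique.Propositional using (Unique)
open import Data.List.Relation.Unary.Unique.Propositional.Properties using (upTo⁺; filter⁺; cartesianProduct⁺; allFin⁺)
open import Data.Nat.Combinatorics using (_C_; nCk≡n!/k![n-k]!; k![n∸k]!∣n!; nCn≡1)
import Data.Nat.Coprimality as Coprime
open import Data.Nat.Coprimality using (Coprime; coprime-Bézout; coprime-divisor; gcd≡1⇒coprime)
open import Data.Nat.DivMod using (_%_; _/_; m≡m%n+[m/n]*n; m/n*n≡m; m%n<n; _mod_; m<n*o⇒m/o<n; m<n⇒m%n≡m)
import Data.Nat.Divisibility as ℕ
open import Data.Nat.GCD using (module Bézout; gcd)
open import Data.Nat.ListAction using (product)
open import Data.Nat.Primality using (Prime; prime⇒irreducible; prime⇒nonZero; prime⇒nonTrivial; ¬prime[1]; euclidsLemma; ¬prime[0])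
open import Data.Nat.Primality.Factorisation using (factorise; module PrimeFactorisation)
import Data.Nat.Properties as ℕ
open import Data.Nat.Tactic.RingSolver using () renaming (solve-∀ to solveℕ-∀)
open import Data.Product using (∃; _×_; _,_; proj₁; proj₂; ∃!)
open import Data.Sum using (inj₁; inj₂; [_,_]′)
open import Defs
open import Function.Base using (_∘_)
open import Function.Bundles using (Equivalence)
open import Level using (Level; _⊔_)
open import Relation.Binary.Bundles using (Setoid)
import Relation.Binary.Reasoning.Setoid as SetoidReasoning
open import Relation.Binary.Structures using (IsEquivalence)
open import Relation.Nullary.Decidable using (Dec; yes; no; does; map′; ⌊_⌋; toWitness; fromWitness)
open import Relation.Nullary.Negation using (¬_; contradiction)

-- Up to the final mask identities, group-ring arguments are replaced by counts in ℕ of pairs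
-- weighted by indicators of residue classes. The multiplicative input is Frobenius in ℤ[x,y],
-- paired with an arbitrary weight on exponents (`iterate-frobenius`). It serves three times: for
-- the dilations of P, for the reducedness of 𝔽_p[ℤ_n], and for the p-th power of the relation
-- between powers of ζ. The functionals live on ℤ[x,y] itself; exponents are reduced only through
-- the periodicity of the weights. The obstacle is that uniformity under dilation speaks of all of
-- P, whereas E_r is one residue class of it. For m a power of p, the slope 1 + jm changes k + l
-- modulo pm by jm times k mod p, and this tells the classes apart. The period of the count for one
-- class falls from pm to m, and the argument is repeated until the period is p. Afterwards each
-- slice may be moved by its own multiple of p, which is why all integers η are covered at once.
-- Division is avoided by multiplying counts by L, and subtraction by balancing equations or by
-- writing -1 as p - 1 modulo p.

-- Finite sums of natural numbers over lists.

module ListSum where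
  open import Data.List.Relation.Unary.All as All using (All; []; _∷_)
  open import Data.Nat.Base
  open import Data.Nat.Properties
  open import Algebra.Properties.CommutativeSemigroup +-commutativeSemigroup using (interchange)
  open import Relation.Binary.PropositionalEquality

  private
    variable
      a b : Level
      A : Set a
      B : Set b

  ∑ : List A → (A → ℕ) → ℕ
  ∑ []       f = 0
  ∑ (x ∷ xs) f = f x + ∑ xs f

  ∑-cong-∈ : (xs : List A) {f g : A → ℕ} → (∀ {x} → x ∈ˡ xs → f x ≡ g x) → ∑ xs f ≡ ∑ xs g
  ∑-cong-∈ []       eq = refl
  ∑-cong-∈ (x ∷ xs) eq = cong₂ _+_ (eq (here refl)) (∑-cong-∈ xs (λ i → eq (there i)))

  ∑-cong : (xs : List A) {f g : A → ℕ} → (∀ x → f x ≡ g x) → ∑ xs f ≡ ∑ xs g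
  ∑-cong xs eq = ∑-cong-∈ xs (λ {x} _ → eq x)

  ∑-+ : (xs : List A) (f g : A → ℕ) → ∑ xs (λ x → f x + g x) ≡ ∑ xs f + ∑ xs g
  ∑-+ []       f g = refl
  ∑-+ (x ∷ xs) f g = trans (cong (f x + g x +_) (∑-+ xs f g)) (interchange (f x) (g x) _ _)

  ∑-*ˡ : (xs : List A) (c : ℕ) (f : A → ℕ) → ∑ xs (λ x → c * f x) ≡ c * ∑ xs f
  ∑-*ˡ []       c f = sym (*-zeroʳ c)
  ∑-*ˡ (x ∷ xs) c f = trans (cong (c * f x +_) (∑-*ˡ xs c f)) (sym (*-distribˡ-+ c (f x) _))

  ∑-*ʳ : (xs : List A) (c : ℕ) (f : A → ℕ) → ∑ xs (λ x → f x * c) ≡ ∑ xs f * c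
  ∑-*ʳ []       c f = refl
  ∑-*ʳ (x ∷ xs) c f = trans (cong (f x * c +_) (∑-*ʳ xs c f)) (sym (*-distribʳ-+ c (f x) _))

  ∑-const : (xs : List A) (c : ℕ) → ∑ xs (λ _ → c) ≡ length xs * c
  ∑-const []       c = refl
  ∑-const (x ∷ xs) c = cong (c +_) (∑-const xs c)

  ∑-0 : (xs : List A) → ∑ xs (λ _ → 0) ≡ 0
  ∑-0 xs = trans (∑-const xs 0) (*-zeroʳ (length xs))

  ∑-swap : (xs : List A) (ys : List B) (f : A → B → ℕ) →
           ∑ xs (λ x → ∑ ys (f x)) ≡ ∑ ys (λ y → ∑ xs (λ x → f x y))
  ∑-swap []       ys f = sym (∑-0 ys)
  ∑-swap (x ∷ xs) ys f = trans (cong (∑ ys (f x) +_) (∑-swap xs ys f)) (sym (∑-+ ys (f x) _))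

  ∑-*-∑ : (xs : List A) (ys : List B) (f : A → ℕ) (g : B → ℕ) →
          ∑ xs f * ∑ ys g ≡ ∑ xs (λ x → ∑ ys (λ y → f x * g y))
  ∑-*-∑ xs ys f g = trans (sym (∑-*ʳ xs (∑ ys g) f)) (∑-cong xs λ x → sym (∑-*ˡ ys (f x) g))

  ∑-++ : (xs ys : List A) (f : A → ℕ) → ∑ (xs ++ ys) f ≡ ∑ xs f + ∑ ys f
  ∑-++ []       ys f = refl
  ∑-++ (x ∷ xs) ys f = trans (cong (f x +_) (∑-++ xs ys f)) (sym (+-assoc (f x) _ _))

  ∑-map : (g : A → B) (xs : List A) (f : B → ℕ) → ∑ (map g xs) f ≡ ∑ xs (λ x → f (g x))
  ∑-map g []       f = refl
  ∑-map g (x ∷ xs) f = cong (f (g x) +_) (∑-map g xs f)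

  ∑-concatMap : (g : A → List B) (xs : List A) (f : B → ℕ) →
                ∑ (concatMap g xs) f ≡ ∑ xs (λ x → ∑ (g x) f)
  ∑-concatMap g []       f = refl
  ∑-concatMap g (x ∷ xs) f =
    trans (∑-++ (g x) (concatMap g xs) f) (cong (∑ (g x) f +_) (∑-concatMap g xs f))

  ∑-replicate : ∀ n (x : A) (f : A → ℕ) → ∑ (replicate n x) f ≡ n * f x
  ∑-replicate zero    x f = refl
  ∑-replicate (suc n) x f = cong (f x +_) (∑-replicate n x f)

  ∑-cartesianProduct : (xs : List A) (ys : List B) (f : A × B → ℕ) →
                       ∑ (cartesianProduct xs ys) f ≡ ∑ xs (λ x → ∑ ys (λ y → f (x , y)))
  ∑-cartesianProduct []       ys f = refl
  ∑-cartesianProduct (x ∷ xs) ys f =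
    trans (∑-++ (map (x ,_) ys) _ f) (cong₂ _+_ (∑-map (x ,_) ys f) (∑-cartesianProduct xs ys f))

  ∑-applyUpTo : (g : ℕ → A) (n : ℕ) (f : A → ℕ) → ∑ (applyUpTo g n) f ≡ ∑ (upTo n) (λ i → f (g i))
  ∑-applyUpTo g zero    f = refl
  ∑-applyUpTo g (suc n) f = cong (f (g 0) +_)
    (trans (∑-applyUpTo (λ i → g (suc i)) n f) (sym (∑-applyUpTo suc n (λ i → f (g i)))))

  ∑-upTo-const : ∀ n c → ∑ (upTo n) (λ _ → c) ≡ n * c
  ∑-upTo-const n c = trans (∑-const (upTo n) c) (cong (_* c) (length-applyUpTo (λ i → i) n))

  -- Subtraction-free form of the fact that the two sums differ only by their terms at `s`. It
  -- isolates one residue class in the slope argument and one row in the pencil argument.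
  ∑-agree-off : {xs : List A} {s : A} {f g : A → ℕ} → Unique xs → s ∈ˡ xs →
                (∀ x → x ∈ˡ xs → x ≢ s → f x ≡ g x) → ∑ xs f + g s ≡ ∑ xs g + f s
  ∑-agree-off {xs = x ∷ xs} {f = f} {g} (x∉ ∷ _) (here refl) eq = begin
    f x + ∑ xs f + g x   ≡⟨ cong (λ z → f x + z + g x) (∑-cong-∈ xs λ i → eq _ (there i) (≢-sym (All.lookup x∉ i))) ⟩
    f x + ∑ xs g + g x   ≡⟨ +-comm _ (g x) ⟩
    g x + (f x + ∑ xs g) ≡⟨ cong (g x +_) (+-comm (f x) _) ⟩
    g x + (∑ xs g + f x) ≡⟨ sym (+-assoc (g x) _ _) ⟩
    g x + ∑ xs g + f x   ∎
    where open ≡-Reasoning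
  ∑-agree-off {xs = x ∷ xs} {s} {f} {g} (x∉ ∷ u) (there i) eq = begin
    f x + ∑ xs f + g s   ≡⟨ +-assoc (f x) _ _ ⟩
    f x + (∑ xs f + g s) ≡⟨ cong₂ _+_ (eq x (here refl) (All.lookup x∉ i)) (∑-agree-off u i λ y j → eq y (there j)) ⟩
    g x + (∑ xs g + f s) ≡⟨ sym (+-assoc (g x) _ _) ⟩
    g x + ∑ xs g + f s   ∎
    where open ≡-Reasoning

  ∑-single : {xs : List A} {s : A} {f : A → ℕ} → Unique xs → s ∈ˡ xs →
             (∀ x → x ∈ˡ xs → x ≢ s → f x ≡ 0) → ∑ xs f ≡ f s
  ∑-single {xs = xs} {s} {f} u i off =
    trans (sym (+-identityʳ _)) (trans (∑-agree-off u i off) (cong (_+ f s) (∑-0 xs)))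

  f≤∑ : {xs : List A} {x : A} (f : A → ℕ) → x ∈ˡ xs → f x ≤ ∑ xs f
  f≤∑ f (here refl) = m≤m+n _ _
  f≤∑ f (there {x = y} i) = ≤-trans (f≤∑ f i) (m≤n+m _ (f y))

  ∑≥1⇒∃ : (xs : List A) (f : A → ℕ) → 1 ≤ ∑ xs f → ∃ λ x → x ∈ˡ xs × 1 ≤ f x
  ∑≥1⇒∃ (x ∷ xs) f le with f x in eq
  ... | suc k = x , here refl , subst (1 ≤_) (sym eq) (s≤s z≤n)
  ... | zero with ∑≥1⇒∃ xs f le
  ...   | y , i , le′ = y , there i , le′

  -- Positive terms at two different positions would make the sum at least 2. This turns a count
  -- equal to 1 into a uniqueness statement.
  ∑≡1⇒unique : {xs : List A} {x y : A} (f : A → ℕ) → ∑ xs f ≡ 1 → x ∈ˡ xs → y ∈ˡ xs →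
               1 ≤ f x → 1 ≤ f y → x ≡ y
  ∑≡1⇒unique f eq (here refl) (here refl) p q = refl
  ∑≡1⇒unique f eq (here refl) (there j) p q =
    ⊥-elim (<⇒≱ (+-mono-≤ p (≤-trans q (f≤∑ f j))) (≤-reflexive eq))
  ∑≡1⇒unique f eq (there i) (here refl) p q =
    ⊥-elim (<⇒≱ (+-mono-≤ q (≤-trans p (f≤∑ f i))) (≤-reflexive eq))
  ∑≡1⇒unique {xs = z ∷ zs} f eq (there i) (there j) p q with f z
  ... | zero  = ∑≡1⇒unique f eq i j p q
  ... | suc k = ⊥-elim (<⇒≱ (≤-trans p (f≤∑ f i)) (≤-reflexive (m+n≡0⇒n≡0 k (suc-injective eq))))

  -- Pigeonhole: each term is at least 1 and the total leaves no room for more. Used for coverings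
  -- of the right size and for the values of `U`.
  ∑≡length⇒≡1 : (xs : List A) (f : A → ℕ) → (∀ {x} → x ∈ˡ xs → 1 ≤ f x) → ∑ xs f ≡ length xs →
                ∀ {x} → x ∈ˡ xs → f x ≡ 1
  ∑≡length⇒≡1 (z ∷ zs) f pos eq = go
    where
    length≤∑ : ∀ ys → (∀ {x} → x ∈ˡ ys → 1 ≤ f x) → length ys ≤ ∑ ys f
    length≤∑ []       p = z≤n
    length≤∑ (y ∷ ys) p = +-mono-≤ (p (here refl)) (length≤∑ ys (λ i → p (there i)))
    tail≥ : length zs ≤ ∑ zs f
    tail≥ = length≤∑ zs (λ i → pos (there i))
    head≡ : f z ≡ 1
    head≡ = ≤-antisym (+-cancelʳ-≤ (length zs) _ _
      (≤-trans (+-monoʳ-≤ (f z) tail≥) (≤-reflexive eq))) (pos (here refl))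
    go : ∀ {x} → x ∈ˡ (z ∷ zs) → f x ≡ 1
    go (here refl) = head≡
    go (there i)   = ∑≡length⇒≡1 zs f (λ j → pos (there j))
      (suc-injective (trans (cong (_+ ∑ zs f) (sym head≡)) eq)) i

-- Congruences, indicators and sums over residue systems.

module Congruence where
  open ListSum
  open import Data.Integer.Base as ℤ using (ℤ; +_; -_; _+_; _-_; _*_)
  open import Data.Integer.Divisibility.Signed as ℤ using (divides)
  open import Data.Nat.Base as ℕ using (ℕ; suc; NonZero; _<_)
  open import Relation.Binary.PropositionalEquality

  -- The quotient is part of the data: matching the equation with `refl` eliminates the left side,
  -- and what remains is an identity for the ring solver.
  record Cong (m : ℕ) (a b : ℤ) : Set where
    constructor cong-by
    field
      factor   : ℤ
      equation : a ≡ b + factor * + m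

  ≡⇒Cong : ∀ {m a b} → a ≡ b → Cong m a b
  ≡⇒Cong {m} {a} refl = cong-by (+ 0) (lem a (+ m))
    where
    lem : ∀ a m → a ≡ a + + 0 * m
    lem = solve-∀

  Cong-refl : ∀ {m a} → Cong m a a
  Cong-refl = ≡⇒Cong refl

  Cong-sym : ∀ {m a b} → Cong m a b → Cong m b a
  Cong-sym {m} {b = b} (cong-by q refl) = cong-by (- q) (lem b q (+ m))
    where
    lem : ∀ b q m → b ≡ b + q * m + - q * m
    lem = solve-∀

  Cong-trans : ∀ {m a b c} → Cong m a b → Cong m b c → Cong m a c
  Cong-trans {m} {c = c} (cong-by q refl) (cong-by r refl) = cong-by (r + q) (lem c q r (+ m))
    where
    lem : ∀ c q r m → c + r * m + q * m ≡ c + (r + q) * m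
    lem = solve-∀

  Cong-+ : ∀ {m a b c d} → Cong m a b → Cong m c d → Cong m (a + c) (b + d)
  Cong-+ {m} {b = b} {d = d} (cong-by q refl) (cong-by r refl) = cong-by (q + r) (lem b d q r (+ m))
    where
    lem : ∀ b d q r m → b + q * m + (d + r * m) ≡ b + d + (q + r) * m
    lem = solve-∀

  Cong-*ˡ : ∀ {m a b} c → Cong m a b → Cong m (c * a) (c * b)
  Cong-*ˡ {m} {b = b} c (cong-by q refl) = cong-by (c * q) (lem b c q (+ m))
    where
    lem : ∀ b c q m → c * (b + q * m) ≡ c * b + c * q * m
    lem = solve-∀

  Cong-*ʳ : ∀ {m a b} c → Cong m a b → Cong m (a * c) (b * c)
  Cong-*ʳ {a = a} {b} c e = subst₂ (Cong _) (ℤ.*-comm c a) (ℤ.*-comm c b) (Cong-*ˡ c e)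

  Cong-neg : ∀ {m a b} → Cong m a b → Cong m (- a) (- b)
  Cong-neg {m} {b = b} (cong-by q refl) = cong-by (- q) (lem b q (+ m))
    where
    lem : ∀ b q m → - (b + q * m) ≡ - b + - q * m
    lem = solve-∀

  Cong-- : ∀ {m a b c d} → Cong m a b → Cong m c d → Cong m (a - c) (b - d)
  Cong-- e f = Cong-+ e (Cong-neg f)

  Cong-multiple : ∀ {m} a q → Cong m (a + q * + m) a
  Cong-multiple a q = cong-by q refl

  -- A congruence depends only on the difference of its sides, so rearrangements reduce to a ring
  -- identity between differences.
  Cong-shift : ∀ {m a b c d} → a - b ≡ c - d → Cong m a b → Cong m c d
  Cong-shift {m} {a} {b} {c} {d} eq (cong-by q refl) =
    cong-by q (trans (lem₁ c d) (trans (cong (λ z → d + z) (sym eq)) (lem₂ b d q (+ m))))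
    where
    lem₁ : ∀ c d → c ≡ d + (c - d)
    lem₁ = solve-∀
    lem₂ : ∀ b d q m → d + (b + q * m - b) ≡ d + q * m
    lem₂ = solve-∀

  Cong-coarsen : ∀ {m a b} k → Cong (k ℕ.* m) a b → Cong m a b
  Cong-coarsen {m} {b = b} k (cong-by q refl) = cong-by (q * + k)
    (trans (cong (λ z → b + q * z) (ℤ.pos-* k m)) (lem b q (+ k) (+ m)))
    where
    lem : ∀ b q k m → b + q * (k * m) ≡ b + q * k * m
    lem = solve-∀

  Cong-scale : ∀ {m a b} k → Cong m a b → Cong (k ℕ.* m) (a * + k) (b * + k)
  Cong-scale {m} {b = b} k (cong-by q refl) = cong-by q
    (trans (lem b q (+ k) (+ m)) (cong (λ z → b * + k + q * z) (sym (ℤ.pos-* k m))))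
    where
    lem : ∀ b q k m → (b + q * m) * k ≡ b * k + q * (k * m)
    lem = solve-∀

  Cong-unscale : ∀ {m a b} k .{{_ : NonZero k}} → Cong (m ℕ.* k) (a * + k) (b * + k) → Cong m a b
  Cong-unscale {m} {a} {b} k (cong-by q eq) = cong-by q (ℤ.*-cancelʳ-≡ _ _ (+ k) lem)
    where
    ring : ∀ b q k m → b * k + q * (m * k) ≡ (b + q * m) * k
    ring = solve-∀
    lem : a * + k ≡ (b + q * + m) * + k
    lem = trans eq (trans (cong (λ z → b * + k + q * z) (ℤ.pos-* m k)) (ring b q (+ k) (+ m)))

  Cong⇒∣ : ∀ {m a b} → Cong m a b → + m ℤ.∣ a - b
  Cong⇒∣ {m} {b = b} (cong-by q refl) = divides q (lem b q (+ m))
    where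
    lem : ∀ b q m → b + q * m - b ≡ q * m
    lem = solve-∀

  ∣⇒Cong : ∀ {m a b} → + m ℤ.∣ a - b → Cong m a b
  ∣⇒Cong {m} {a} {b} (divides q eq) = cong-by q (trans (lem a b) (cong (λ z → b + z) eq))
    where
    lem : ∀ a b → a ≡ b + (a - b)
    lem = solve-∀

  -- Abstract, so that case distinctions on this decision are not normalised away.
  abstract
    cong? : ∀ m a b → Dec (Cong m a b)
    cong? m a b = map′ ∣⇒Cong Cong⇒∣ (+ m ℤ.∣? (a - b))

  ∣⇒Cong0 : ∀ {m n} → m ℕ.∣ n → Cong m (+ n) (+ 0)
  ∣⇒Cong0 {m} (ℕ.divides q refl) = cong-by (+ q) (trans (ℤ.pos-* q m) (sym (ℤ.+-identityˡ _)))

  Cong0⇒∣ : ∀ {m n} → Cong m (+ n) (+ 0) → m ℕ.∣ n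
  Cong0⇒∣ {m} {n} c = ℤ.∣⇒∣ᵤ (subst (+ m ℤ.∣_) (ℤ.+-identityʳ (+ n)) (Cong⇒∣ c))

  Cong⇒≡-ordered : ∀ {m i j} → i ℕ.≤ j → j < m → Cong m (+ j) (+ i) → j ≡ i
  Cong⇒≡-ordered {m} {i} {j} i≤j j<m c =
    ℕ.≤-antisym (ℕ.m∸n≡0⇒m≤n (zero-below (Cong0⇒∣ (Cong-shift diff c)))) i≤j
    where
    diff : + j - + i ≡ + (j ℕ.∸ i) - + 0
    diff = trans (ℤ.m-n≡m⊖n j i) (trans (ℤ.⊖-≥ i≤j) (sym (ℤ.+-identityʳ _)))
    zero-below : m ℕ.∣ j ℕ.∸ i → j ℕ.∸ i ≡ 0
    zero-below d with j ℕ.∸ i in eq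
    ... | ℕ.zero = refl
    ... | suc k  = ⊥-elim (ℕ.>⇒∤ (subst (_< m) eq (ℕ.≤-<-trans (ℕ.m∸n≤m j i) j<m)) d)

  Cong⇒≡ : ∀ {m i j} → i < m → j < m → Cong m (+ i) (+ j) → i ≡ j
  Cong⇒≡ {i = i} {j} i<m j<m c with ℕ.≤-total i j
  ... | inj₁ i≤j = sym (Cong⇒≡-ordered i≤j j<m (Cong-sym c))
  ... | inj₂ j≤i = Cong⇒≡-ordered j≤i i<m c

  coprime⇒inverse : ∀ {a b} → Coprime a b → ∃ λ x → Cong b (x * + a) (+ 1)
  coprime⇒inverse {a} {b} c with coprime-Bézout c
  ... | Bézout.+- x y eq = + x , cong-by (+ y) (trans (sym (ℤ.pos-* x a))
          (trans (cong +_ (sym eq)) (cong (λ z → + 1 + z) (ℤ.pos-* y b))))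
  ... | Bézout.-+ x y eq = - + x , cong-by (- + y) (trans (lem₁ (+ x) (+ a))
          (trans (cong (λ z → + 1 - z) (trans (cong (λ z → + 1 + z) (sym (ℤ.pos-* x a))) (trans (cong +_ eq) (ℤ.pos-* y b))))
                 (lem₂ (+ y) (+ b))))
    where
    lem₁ : ∀ x a → - x * a ≡ + 1 - (+ 1 + x * a)
    lem₁ = solve-∀
    lem₂ : ∀ y b → + 1 - y * b ≡ + 1 + - y * b
    lem₂ = solve-∀

  prime∤⇒coprime : ∀ {p n} → Prime p → ¬ p ℕ.∣ n → Coprime n p
  prime∤⇒coprime pp p∤n (d∣n , d∣p) with prime⇒irreducible pp d∣p
  ... | inj₁ d≡1 = d≡1
  ... | inj₂ refl = contradiction d∣n p∤n

  prime⇒inverse : ∀ {p} d → Prime p → ¬ Cong p d (+ 0) → ∃ λ x → Cong p (x * d) (+ 1)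
  prime⇒inverse (+ n) pp nz = coprime⇒inverse (prime∤⇒coprime pp (λ p∣n → nz (∣⇒Cong0 p∣n)))
  prime⇒inverse ℤ.-[1+ n ] pp nz
    with coprime⇒inverse (prime∤⇒coprime {n = suc n} pp (λ p∣n → nz (Cong-neg (∣⇒Cong0 p∣n))))
  ... | x , c = - x , Cong-trans (≡⇒Cong (lem x (+ suc n))) c
    where
    lem : ∀ x n → - x * - n ≡ x * n
    lem = solve-∀

  -- Iverson bracket with values in ℕ: products express conjunctions, and sums of products are the
  -- representation numbers that stand in for coefficients in a group ring.
  ind : ℕ → ℤ → ℤ → ℕ
  ind m a b = if does (cong? m a b) then 1 else 0

  ind-yes : ∀ {m a b} → Cong m a b → ind m a b ≡ 1
  ind-yes {m} {a} {b} c with cong? m a b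
  ... | yes _ = refl
  ... | no ¬c = contradiction c ¬c

  ind-no : ∀ {m a b} → ¬ Cong m a b → ind m a b ≡ 0
  ind-no {m} {a} {b} ¬c with cong? m a b
  ... | yes c = contradiction c ¬c
  ... | no _  = refl

  ind≥1⇒Cong : ∀ {m a b} → 1 ℕ.≤ ind m a b → Cong m a b
  ind≥1⇒Cong {m} {a} {b} le with cong? m a b
  ... | yes c = c

  ind-⇔ : ∀ {m a b m′ a′ b′} → (Cong m a b → Cong m′ a′ b′) → (Cong m′ a′ b′ → Cong m a b) →
          ind m a b ≡ ind m′ a′ b′
  ind-⇔ {m} {a} {b} f g with cong? m a b
  ... | yes c = sym (ind-yes (f c))
  ... | no ¬c = sym (ind-no (λ c → ¬c (g c)))

  ind-shift : ∀ {m a b c d} → a - b ≡ c - d → ind m a b ≡ ind m c d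
  ind-shift eq = ind-⇔ (Cong-shift eq) (Cong-shift (sym eq))

  ind-cong : ∀ {m a a′ b b′} → Cong m a a′ → Cong m b b′ → ind m a b ≡ ind m a′ b′
  ind-cong c d = ind-⇔ (λ e → Cong-trans (Cong-sym c) (Cong-trans e d))
                       (λ e → Cong-trans c (Cong-trans e (Cong-sym d)))

  -- The second factor matters only where the indicator is 1, so it may be rewritten under the
  -- congruence that the indicator asserts.
  ind-*-cong : ∀ {m a b x y} → (Cong m a b → x ≡ y) → ind m a b ℕ.* x ≡ ind m a b ℕ.* y
  ind-*-cong {m} {a} {b} f with cong? m a b
  ... | yes c = cong (ℕ._+ 0) (f c)
  ... | no _  = refl

  Cong-% : ∀ m .{{_ : NonZero m}} z → Cong m z (+ (z ℤ.%ℕ m))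
  Cong-% m z = cong-by (z ℤ./ℕ m) (ℤ.a≡a%ℕn+[a/ℕn]*n z m)

  ∑-ind : ∀ q .{{_ : NonZero q}} z → ∑ (upTo q) (λ j → ind q z (+ j)) ≡ 1
  ∑-ind q z = trans (∑-single (upTo⁺ q) (∈-upTo⁺ r<q) off) (ind-yes z≡r)
    where
    r = z ℤ.%ℕ q
    r<q : r < q
    r<q = ℤ.n%ℕd<d z q
    z≡r : Cong q z (+ r)
    z≡r = Cong-% q z
    off : ∀ x → x ∈ˡ upTo q → x ≢ r → ind q z (+ x) ≡ 0
    off x i x≢r = ind-no λ c → x≢r (Cong⇒≡ (∈-upTo⁻ i) r<q (Cong-trans (Cong-sym c) z≡r))

  ∑-ind-* : ∀ q .{{_ : NonZero q}} z c → ∑ (upTo q) (λ j → ind q z (+ j) ℕ.* c) ≡ c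
  ∑-ind-* q z c = trans (∑-*ʳ (upTo q) c _) (trans (cong (ℕ._* c) (∑-ind q z)) (ℕ.*-identityˡ c))

  -- Periodic functions on ℤ play the role of functions on ℤ_m, so that arguments such as `g - h`
  -- need no reduction.
  Respects : ℕ → (ℤ → ℕ) → Set
  Respects m f = ∀ {x y} → Cong m x y → f x ≡ f y

  ∑-ind-value : ∀ q .{{_ : NonZero q}} {f} z → Respects q f →
                ∑ (upTo q) (λ j → ind q z (+ j) ℕ.* f (+ j)) ≡ f z
  ∑-ind-value q {f} z resp =
    trans (∑-cong (upTo q) (λ j → ind-*-cong λ c → sym (resp c))) (∑-ind-* q z (f z))

  -- If `a = t + z m`, the residue of `z` modulo `q` selects exactly one of the finer classes
  -- `t + j m`.
  ind-refine : ∀ m .{{_ : NonZero m}} q .{{_ : NonZero q}} a t →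
               ind m a t ≡ ∑ (upTo q) (λ j → ind (q ℕ.* m) a (t + + j * + m))
  ind-refine m q a t with cong? m a t
  ... | yes (cong-by z refl) = sym (trans (∑-cong (upTo q) same) (∑-ind q z))
    where
    ring : ∀ t z m j → z * m - j * m ≡ t + z * m - (t + j * m)
    ring = solve-∀
    same : ∀ j → ind (q ℕ.* m) (t + z * + m) (t + + j * + m) ≡ ind q z (+ j)
    same j = ind-⇔ (λ c → Cong-unscale m (Cong-shift (sym (ring t z (+ m) (+ j))) c))
                   (λ c → Cong-shift (ring t z (+ m) (+ j))
                            (subst (λ k → Cong k (z * + m) (+ j * + m)) (ℕ.*-comm m q) (Cong-scale m c)))
  ... | no ¬c = sym (trans (∑-cong (upTo q) (λ j → ind-no λ c →
          ¬c (Cong-trans (Cong-coarsen q c) (Cong-multiple t (+ j))))) (∑-0 (upTo q)))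

  -- With `e` inverse to `d`, the map from `c` to `q₀ + c d` permutes the residues. Instead of
  -- building a permutation, `f` is expanded in indicators, the sums are exchanged, and the
  -- condition is solved for `c`.
  ∑-unit-multiples : ∀ p .{{_ : NonZero p}} {f} → Respects p f → ∀ q₀ d e → Cong p (e * d) (+ 1) →
    ∑ (upTo p) (λ c → f (q₀ + + c * d)) ≡ ∑ (upTo p) (λ c → f (+ c))
  ∑-unit-multiples p {f} resp q₀ d e ed≡1 = begin
    ∑ (upTo p) (λ c → f (q₀ + + c * d))
      ≡⟨ ∑-cong (upTo p) (λ c → sym (∑-ind-value p {f} (q₀ + + c * d) resp)) ⟩
    ∑ (upTo p) (λ c → ∑ (upTo p) (λ q → ind p (q₀ + + c * d) (+ q) ℕ.* f (+ q)))
      ≡⟨ ∑-swap (upTo p) (upTo p) _ ⟩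
    ∑ (upTo p) (λ q → ∑ (upTo p) (λ c → ind p (q₀ + + c * d) (+ q) ℕ.* f (+ q)))
      ≡⟨ ∑-cong (upTo p) (λ q → trans (∑-cong (upTo p) (λ c → cong (ℕ._* f (+ q)) (solved q c)))
                                      (∑-ind-* p (e * (+ q - q₀)) (f (+ q)))) ⟩
    ∑ (upTo p) (λ q → f (+ q)) ∎
    where
    open ≡-Reasoning
    ring₁ : ∀ e c d q₀ → e * (q₀ + c * d - q₀) ≡ c * (e * d)
    ring₁ = solve-∀
    ring₂ : ∀ e d q q₀ → q₀ + e * (q - q₀) * d ≡ q₀ + (q - q₀) * (e * d)
    ring₂ = solve-∀
    ring₃ : ∀ q q₀ → q₀ + (q - q₀) * + 1 ≡ q
    ring₃ = solve-∀
    solved : ∀ q c → ind p (q₀ + + c * d) (+ q) ≡ ind p (e * (+ q - q₀)) (+ c)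
    solved q c = ind-⇔
      (λ x → Cong-trans (Cong-*ˡ e (Cong-- (Cong-sym x) (Cong-refl {a = q₀})))
               (Cong-trans (≡⇒Cong (ring₁ e (+ c) d q₀))
                 (Cong-trans (Cong-*ˡ (+ c) ed≡1) (≡⇒Cong (ℤ.*-identityʳ (+ c))))))
      (λ x → Cong-trans (Cong-+ (Cong-refl {a = q₀}) (Cong-*ʳ d (Cong-sym x)))
               (Cong-trans (≡⇒Cong (ring₂ e d (+ q) q₀))
                 (Cong-trans (Cong-+ (Cong-refl {a = q₀}) (Cong-*ˡ (+ q - q₀) ed≡1))
                   (≡⇒Cong (ring₃ (+ q) q₀)))))

  ∑-complete-residues : ∀ {p f} → Prime p → Respects p f → ∀ q₀ d → ¬ Cong p d (+ 0) →
    ∑ (upTo p) (λ c → f (q₀ + + c * d)) ≡ ∑ (upTo p) (λ c → f (+ c))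
  ∑-complete-residues {p} pp resp q₀ d d≢0 with prime⇒inverse d pp d≢0
  ... | e , ed≡1 = ∑-unit-multiples p {{prime⇒nonZero pp}} resp q₀ d e ed≡1

  ∑-reflect : ∀ m .{{_ : NonZero m}} {f} → Respects m f → ∀ g →
    ∑ (upTo m) (λ h → f (g - + h)) ≡ ∑ (upTo m) (λ h → f (+ h))
  ∑-reflect m {f} resp g = trans (∑-cong (upTo m) λ h → cong f (ring g (+ h)))
    -- `-1` is its own inverse for every modulus, prime or not.
    (∑-unit-multiples m resp g (- + 1) (- + 1) Cong-refl)
    where
    ring : ∀ g h → g - h ≡ g + h * - + 1
    ring = solve-∀

-- Pairs of second coordinates and their classes modulo p.

module Slopes where
  open ListSum
  open Congruence
  open import Data.Integer.Base as ℤ using (ℤ; +_; _+_; _-_; _*_)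
  open import Data.Nat.Base as ℕ using (ℕ; zero; suc; NonZero; _<_; _^_; s≤s)
  open import Relation.Binary.PropositionalEquality

  -- The multiset μ collects the pairs of second coordinates of the elements of
  -- P and Q whose first coordinates have a prescribed sum.
  module PairClasses {p} (prime : Prime p) (K : ℕ) (μ : List (ℤ × ℤ))
    (uniform : ∀ c → ¬ p ℕ.∣ c → ∀ t → ∑ μ (λ (k , l) → ind (p ^ suc K) (+ c * k + l) t) ≡ 1)
    where

    private
      instance
        p≢0 = prime⇒nonZero prime

      p^≢0 : ∀ b → NonZero (p ^ b)
      p^≢0 b = ℕ.m^n≢0 p b

      fin⇒≢0 : ∀ {r s} → r < p → s < p → r ≢ s → ¬ Cong p (+ s - + r) (+ 0)
      fin⇒≢0 {r} {s} r<p s<p r≢s c = r≢s (sym (Cong⇒≡ s<p r<p (Cong-shift (ring (+ s) (+ r)) c)))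
        where
        ring : ∀ s r → s - r - + 0 ≡ s - r
        ring = solve-∀

    -- The modulus `m` stays variable because independence of `t` is proved by lowering the period
    -- one power of `p` at a time, from `p ^ suc K` to `p`.
    slopeCount : ℤ → ℕ → ℤ → ℕ
    slopeCount r m t = ∑ μ (λ (k , l) → ind p k r ℕ.* ind m (k + l) t)

    slopeCount-cong : ∀ r {m t t′} → Cong m t t′ → slopeCount r m t ≡ slopeCount r m t′
    slopeCount-cong r c = ∑-cong μ λ (k , l) → cong (ind p k r ℕ.*_) (ind-cong Cong-refl c)

    slopeCount-refine : ∀ r m .{{_ : NonZero m}} q .{{_ : NonZero q}} t →
      slopeCount r m t ≡ ∑ (upTo q) (λ j → slopeCount r (q ℕ.* m) (t + + j * + m))
    slopeCount-refine r m q t = trans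
      (∑-cong μ λ (k , l) → trans (cong (ind p k r ℕ.*_) (ind-refine m q (k + l) t))
                                  (sym (∑-*ˡ (upTo q) (ind p k r) _)))
      (∑-swap μ (upTo q) _)

    -- A class modulo `p ^ b` splits into `p ^ d` classes modulo `p ^ suc K`, and each of these is
    -- hit once.
    uniform-level : ∀ d b → d ℕ.+ b ≡ suc K → ∀ c → ¬ p ℕ.∣ c → ∀ t →
      ∑ μ (λ (k , l) → ind (p ^ b) (+ c * k + l) t) ≡ p ^ d
    uniform-level d b d+b c p∤c t = begin
      ∑ μ (λ (k , l) → ind (p ^ b) (+ c * k + l) t)
        ≡⟨ ∑-cong μ (λ (k , l) → ind-refine (p ^ b) {{p^≢0 b}} (p ^ d) {{p^≢0 d}} (+ c * k + l) t) ⟩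
      ∑ μ (λ (k , l) → ∑ (upTo (p ^ d)) (λ j → ind (p ^ d ℕ.* p ^ b) (+ c * k + l) (t + + j * + (p ^ b))))
        ≡⟨ ∑-swap μ (upTo (p ^ d)) _ ⟩
      ∑ (upTo (p ^ d)) (λ j → ∑ μ (λ (k , l) → ind (p ^ d ℕ.* p ^ b) (+ c * k + l) (t + + j * + (p ^ b))))
        ≡⟨ ∑-cong (upTo (p ^ d)) (λ j → trans (cong (λ m → ∑ μ (λ (k , l) → ind m (+ c * k + l) (t + + j * + (p ^ b)))) modulus)
                                              (uniform c p∤c _)) ⟩
      ∑ (upTo (p ^ d)) (λ j → 1)
        ≡⟨ trans (∑-upTo-const (p ^ d) 1) (ℕ.*-identityʳ _) ⟩
      p ^ d ∎
      where
      open ≡-Reasoning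
      modulus : p ^ d ℕ.* p ^ b ≡ p ^ suc K
      modulus = trans (sym (ℕ.^-distribˡ-+-* p d b)) (cong (p ^_) d+b)

    -- The slopes 1 + j m, summed over j < p, isolate the class s of k: every
    -- other class r contributes a complete residue system of multiples of m.
    module _ (d b : ℕ) (level : suc d ℕ.+ suc b ≡ suc K) where
      private
        m = p ^ suc b

        G : ℕ → ℤ → ℕ
        G r t = slopeCount (+ r) (p ℕ.* m) t

        -- On the class `k ≡ r` the slope `1 + j m` with target `t + j s m` reads
        -- `k + l ≡ t + j (s - r) m`; these contributions are collected over `j`.
        H : ℕ → ℤ → ℕ → ℕ
        H s t r = ∑ (upTo p) (λ j → G r (t + + j * (+ s - + r) * + m))

        p∤1+ : ∀ j → ¬ p ℕ.∣ 1 ℕ.+ j ℕ.* m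
        p∤1+ j p∣ = ¬prime[1] (subst Prime (ℕ.∣1⇒≡1 (ℕ.∣m+n∣m⇒∣n
          (subst (p ℕ.∣_) (ℕ.+-comm 1 (j ℕ.* m)) p∣) (ℕ.∣n⇒∣m*n j (ℕ.m∣m*n (p ^ b))))) prime)

        -- Modulo `p m` the term `j m k` depends only on `k` modulo `p`.
        slope-in-class : ∀ s t j r k l → Cong p k (+ r) →
          ind (p ℕ.* m) (+ (1 ℕ.+ j ℕ.* m) * k + l) (t + + j * + s * + m)
          ≡ ind (p ℕ.* m) (k + l) (t + + j * (+ s - + r) * + m)
        slope-in-class s t j r k l c = trans
          (cong (λ z → ind (p ℕ.* m) (z * k + l) (t + + j * + s * + m)) pos)
          (trans (ind-cong (Cong-trans (≡⇒Cong (ring₁ (+ j) (+ m) k l))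
                   (Cong-+ (Cong-refl {a = k + l}) (Cong-*ˡ (+ j) scaled))) Cong-refl)
            (ind-shift (ring₂ (+ j) (+ m) k l (+ s) (+ r) t)))
          where
          pos : + (1 ℕ.+ j ℕ.* m) ≡ + 1 + + j * + m
          pos = cong (λ z → + 1 + z) (ℤ.pos-* j m)
          scaled : Cong (p ℕ.* m) (k * + m) (+ r * + m)
          scaled = subst (λ n → Cong n (k * + m) (+ r * + m)) (ℕ.*-comm m p) (Cong-scale m c)
          ring₁ : ∀ j m k l → (+ 1 + j * m) * k + l ≡ k + l + j * (k * m)
          ring₁ = solve-∀
          ring₂ : ∀ j m k l s r t → k + l + j * (r * m) - (t + j * s * m) ≡ k + l - (t + j * (s - r) * m)
          ring₂ = solve-∀

        -- Summing over all classes `r` restores the full count for the slope `1 + j m`, which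
        -- uniformity makes `p ^ d` for all `s` and `t`.
        total : ∀ s t → ∑ (upTo p) (H s t) ≡ ∑ (upTo p) (λ _ → p ^ d)
        total s t = trans (∑-swap (upTo p) (upTo p) _) (∑-cong (upTo p) λ j → begin
          ∑ (upTo p) (λ r → G r (t + + j * (+ s - + r) * + m))
            ≡⟨ ∑-swap (upTo p) μ _ ⟩
          ∑ μ (λ (k , l) → ∑ (upTo p) (λ r → ind p k (+ r) ℕ.* ind (p ℕ.* m) (k + l) (t + + j * (+ s - + r) * + m)))
            ≡⟨ ∑-cong μ (λ (k , l) → ∑-cong (upTo p) (λ r → ind-*-cong λ c → sym (slope-in-class s t j r k l c))) ⟩
          ∑ μ (λ (k , l) → ∑ (upTo p) (λ r → ind p k (+ r) ℕ.* ind (p ℕ.* m) (+ (1 ℕ.+ j ℕ.* m) * k + l) (t + + j * + s * + m)))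
            ≡⟨ ∑-cong μ (λ (k , l) → ∑-ind-* p k _) ⟩
          ∑ μ (λ (k , l) → ind (p ℕ.* m) (+ (1 ℕ.+ j ℕ.* m) * k + l) (t + + j * + s * + m))
            ≡⟨ uniform-level d (suc (suc b)) (trans (ℕ.+-suc d (suc b)) level) (1 ℕ.+ j ℕ.* m) (p∤1+ j) _ ⟩
          p ^ d ∎)
          where open ≡-Reasoning

        H-shift : ∀ {r s} z t → r < p → s < p → r ≢ s → H s (t + z * + m) r ≡ H s t r
        H-shift {r} {s} z t r<p s<p r≢s = begin
          H s (t + z * + m) r
            ≡⟨ ∑-cong (upTo p) (λ j → cong (G r) (ring t z (+ j) (+ s - + r) (+ m))) ⟩
          ∑ (upTo p) (λ j → f (z + + j * (+ s - + r)))
            ≡⟨ ∑-complete-residues prime f-resp z (+ s - + r) (fin⇒≢0 r<p s<p r≢s) ⟩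
          ∑ (upTo p) (λ j → f (+ j))
            ≡⟨ ∑-complete-residues prime f-resp (+ 0) (+ s - + r) (fin⇒≢0 r<p s<p r≢s) ⟨
          ∑ (upTo p) (λ j → f (+ 0 + + j * (+ s - + r)))
            ≡⟨ ∑-cong (upTo p) (λ j → cong (λ x → G r (t + x * + m)) (ℤ.+-identityˡ (+ j * (+ s - + r)))) ⟩
          H s t r ∎
          where
          open ≡-Reasoning
          f : ℤ → ℕ
          f x = G r (t + x * + m)
          f-resp : Respects p f
          f-resp {x} {y} c = slopeCount-cong (+ r) (Cong-+ (Cong-refl {a = t})
            (subst (λ n → Cong n (x * + m) (y * + m)) (ℕ.*-comm m p) (Cong-scale m c)))
          ring : ∀ t z j e m → t + z * m + j * e * m ≡ t + (z + j * e) * m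
          ring = solve-∀

        H-diagonal : ∀ s t → H s t s ≡ p ℕ.* G s t
        H-diagonal s t = trans (∑-cong (upTo p) λ j → cong (G s) (ring t (+ j) (+ s) (+ m)))
                               (∑-upTo-const p (G s t))
          where
          ring : ∀ t j s m → t + j * (s - s) * m ≡ t
          ring = solve-∀

      -- The total over all classes and the part from the classes other than `s` agree at `t` and
      -- `t + z m`. Hence so does the part from `s`, which consists of `p` equal summands because
      -- `s - s = 0`.
      slopeCount-descend : ∀ {s} → s < p → Respects m (slopeCount (+ s) (p ℕ.* m))
      slopeCount-descend {s} s<p {_} {t} (cong-by z refl) = ℕ.*-cancelˡ-≡ _ _ p
        (trans (sym (H-diagonal s _)) (trans (ℕ.+-cancelˡ-≡ (∑ (upTo p) (H s t)) _ _ (begin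
          ∑ (upTo p) (H s t) ℕ.+ H s t′ s
            ≡⟨ ∑-agree-off (upTo⁺ p) (∈-upTo⁺ s<p) (λ r r∈ r≢s → sym (H-shift z t (∈-upTo⁻ r∈) s<p r≢s)) ⟩
          ∑ (upTo p) (H s t′) ℕ.+ H s t s
            ≡⟨ cong (ℕ._+ H s t s) (trans (total s t′) (sym (total s t))) ⟩
          ∑ (upTo p) (H s t) ℕ.+ H s t s ∎)) (H-diagonal s t)))
        where
        open ≡-Reasoning
        t′ = t + z * + m

    -- One level higher, the induction hypothesis makes the count modulo `p ^ suc (suc b)` equal to
    -- `p ^ d` times the count modulo `p ^ suc K`. By `slopeCount-descend` the former has period
    -- `p ^ suc b`, and `p ^ d` cancels.
    slopeCount-respects-level : ∀ d b → d ℕ.+ suc b ≡ suc K → ∀ {r} → r < p →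
      Respects (p ^ suc b) (slopeCount (+ r) (p ^ suc K))
    slopeCount-respects-level zero b refl r<p c = slopeCount-cong _ c
    slopeCount-respects-level (suc d) b level {r} r<p {t} {t′} c =
      ℕ.*-cancelˡ-≡ _ _ (p ^ d) {{p^≢0 d}}
        (trans (sym (coarse t)) (trans (slopeCount-descend d b level r<p c) (coarse t′)))
      where
      level′ : d ℕ.+ suc (suc b) ≡ suc K
      level′ = trans (ℕ.+-suc d (suc b)) level
      modulus : p ^ d ℕ.* p ^ suc (suc b) ≡ p ^ suc K
      modulus = trans (sym (ℕ.^-distribˡ-+-* p d (suc (suc b)))) (cong (p ^_) level′)
      coarse : ∀ t → slopeCount (+ r) (p ^ suc (suc b)) t ≡ p ^ d ℕ.* slopeCount (+ r) (p ^ suc K) t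
      coarse t = trans (slopeCount-refine (+ r) (p ^ suc (suc b)) {{p^≢0 (suc (suc b))}} (p ^ d) {{p^≢0 d}} t)
        (trans (∑-cong (upTo (p ^ d)) λ j → trans
          (cong (λ n → slopeCount (+ r) n (t + + j * + (p ^ suc (suc b)))) modulus)
          (slopeCount-respects-level d (suc b) level′ r<p (Cong-multiple t (+ j))))
        (∑-upTo-const (p ^ d) _))

    slopeCount-respects : ∀ {r} → r < p → Respects p (slopeCount (+ r) (p ^ suc K))
    slopeCount-respects r<p c = slopeCount-respects-level K 0 (ℕ.+-comm K 1) r<p
      (subst (λ m → Cong m _ _) (sym (ℕ.*-identityʳ p)) c)

    -- The target `+ r + q` is one representative of its class modulo `p`; for `r < p` any other
    -- gives the same number.
    classCount : ℕ → ℤ → ℕ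
    classCount r q = slopeCount (+ r) (p ^ suc K) (+ r + q)

    classCount-respects : ∀ {r} → r < p → Respects p (classCount r)
    classCount-respects {r} r<p c = slopeCount-respects r<p (Cong-+ (Cong-refl {a = + r}) c)

    rowSum : ℕ → ℕ
    rowSum r = ∑ (upTo p) (λ q → classCount r (+ q))

    columnSum : ℤ → ℕ
    columnSum q = ∑ (upTo p) (λ r → classCount r q)

    private
      L = p ^ K
      instance
        L≢0 = p^≢0 K

    -- Given `k ≡ r`, the condition `l ≡ q` says `k + l ≡ r + q` modulo `p`. This class consists of
    -- `L` classes modulo `p ^ suc K`, all with the same count.
    classCount-pairs : ∀ {r} → r < p → ∀ q →
      L ℕ.* classCount r q ≡ ∑ μ (λ (k , l) → ind p k (+ r) ℕ.* ind p l q)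
    classCount-pairs {r} r<p q = sym (begin
      ∑ μ (λ (k , l) → ind p k (+ r) ℕ.* ind p l q)
        ≡⟨ ∑-cong μ (λ (k , l) → ind-*-cong λ c → trans
             (ind-shift (ring k l q))
             (ind-cong (Cong-refl {a = k + l}) (Cong-+ c (Cong-refl {a = q})))) ⟩
      slopeCount (+ r) p (+ r + q)
        ≡⟨ slopeCount-refine (+ r) p L (+ r + q) ⟩
      ∑ (upTo L) (λ j → slopeCount (+ r) (L ℕ.* p) (+ r + q + + j * + p))
        ≡⟨ ∑-cong (upTo L) (λ j → trans (cong (λ m → slopeCount (+ r) m (+ r + q + + j * + p)) (ℕ.*-comm L p))
                                        (slopeCount-respects r<p (Cong-multiple (+ r + q) (+ j)))) ⟩
      ∑ (upTo L) (λ j → classCount r q)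
        ≡⟨ ∑-upTo-const L _ ⟩
      L ℕ.* classCount r q ∎)
      where
      open ≡-Reasoning
      ring : ∀ k l q → l - q ≡ k + l - (k + q)
      ring = solve-∀

    -- Given `k ≡ r`, the condition `l ≡ t - c r` becomes `c k + l ≡ t` modulo `p`. Uniformity
    -- modulo `p` counts `L` such pairs, and `L` cancels.
    line : ∀ c → ¬ p ℕ.∣ c → ∀ t → ∑ (upTo p) (λ r → classCount r (t - + c * + r)) ≡ 1
    line c p∤c t = ℕ.*-cancelˡ-≡ _ _ L (begin
      L ℕ.* ∑ (upTo p) (λ r → classCount r (t - + c * + r))
        ≡⟨ sym (∑-*ˡ (upTo p) L _) ⟩
      ∑ (upTo p) (λ r → L ℕ.* classCount r (t - + c * + r))
        ≡⟨ ∑-cong-∈ (upTo p) (λ i → classCount-pairs (∈-upTo⁻ i) _) ⟩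
      ∑ (upTo p) (λ r → ∑ μ (λ (k , l) → ind p k (+ r) ℕ.* ind p l (t - + c * + r)))
        ≡⟨ ∑-swap (upTo p) μ _ ⟩
      ∑ μ (λ (k , l) → ∑ (upTo p) (λ r → ind p k (+ r) ℕ.* ind p l (t - + c * + r)))
        ≡⟨ ∑-cong μ (λ (k , l) → trans (∑-cong (upTo p) λ r → ind-*-cong (on-line k l r)) (∑-ind-* p k _)) ⟩
      ∑ μ (λ (k , l) → ind p (+ c * k + l) t)
        ≡⟨ cong (λ m → ∑ μ (λ (k , l) → ind m (+ c * k + l) t)) (sym (ℕ.*-identityʳ p)) ⟩
      ∑ μ (λ (k , l) → ind (p ^ 1) (+ c * k + l) t)
        ≡⟨ uniform-level K 1 (ℕ.+-comm K 1) c p∤c t ⟩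
      L ≡⟨ sym (ℕ.*-identityʳ L) ⟩
      L ℕ.* 1 ∎)
      where
      open ≡-Reasoning
      ring : ∀ c r l t → l - (t - c * r) ≡ c * r + l - t
      ring = solve-∀
      on-line : ∀ k l r → Cong p k (+ r) → ind p l (t - + c * + r) ≡ ind p (+ c * k + l) t
      on-line k l r e = trans (ind-shift (ring (+ c) (+ r) l t))
        (ind-cong (Cong-+ (Cong-*ˡ (+ c) (Cong-sym e)) (Cong-refl {a = l})) (Cong-refl {a = t}))

    private
      1<p : 1 < p
      1<p = ℕ.nonTrivial⇒n>1 p {{prime⇒nonTrivial prime}}

      p∤1 : ¬ p ℕ.∣ 1
      p∤1 = ℕ.>⇒∤ 1<p

    -- The `p` parallel lines `q = t - r` partition the cells, and each of them has sum 1.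
    ∑-rowSum : ∑ (upTo p) rowSum ≡ p
    ∑-rowSum = begin
      ∑ (upTo p) rowSum
        ≡⟨ ∑-cong-∈ (upTo p) (λ {r} i → sym (∑-complete-residues prime (classCount-respects (∈-upTo⁻ i))
             (ℤ.- (+ 1 * + r)) (+ 1) (λ c → p∤1 (Cong0⇒∣ c)))) ⟩
      ∑ (upTo p) (λ r → ∑ (upTo p) (λ t → classCount r (ℤ.- (+ 1 * + r) + + t * + 1)))
        ≡⟨ ∑-swap (upTo p) (upTo p) _ ⟩
      ∑ (upTo p) (λ t → ∑ (upTo p) (λ r → classCount r (ℤ.- (+ 1 * + r) + + t * + 1)))
        ≡⟨ ∑-cong (upTo p) (λ t → trans (∑-cong (upTo p) λ r → cong (classCount r) (ring₁ (+ t) (+ r))) (line 1 p∤1 (+ t))) ⟩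
      ∑ (upTo p) (λ _ → 1)
        ≡⟨ trans (∑-upTo-const p 1) (ℕ.*-identityʳ p) ⟩
      p ∎
      where
      open ≡-Reasoning
      ring₁ : ∀ t r → ℤ.- (+ 1 * r) + t * + 1 ≡ t - + 1 * r
      ring₁ = solve-∀

    -- Every cell off the row and the column of (r , q) lies on exactly one of
    -- the p - 1 lines of nonzero slope through (r , q).
    rowSum+columnSum : ∀ {r} → r < p → ∀ q → rowSum r ℕ.+ columnSum q ≡ 1 ℕ.+ p ℕ.* classCount r q
    -- Adding `p` to both sides makes room for the `p - 1` lines of nonzero slope without
    -- subtraction.
    rowSum+columnSum {s} s<p q = ℕ.+-cancelˡ-≡ p _ _ (begin
      p ℕ.+ (rowSum s ℕ.+ columnSum q)
        ≡⟨ cong (λ z → z ℕ.+ (rowSum s ℕ.+ columnSum q)) p≡1+p′ ⟩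
      suc p′ ℕ.+ (rowSum s ℕ.+ columnSum q)
        ≡⟨ arith₁ p′ (rowSum s) (columnSum q) ⟩
      1 ℕ.+ (columnSum q ℕ.+ p′ ℕ.+ rowSum s)
        ≡⟨ cong (λ z → 1 ℕ.+ (z ℕ.+ rowSum s)) (sym pencil) ⟩
      1 ℕ.+ (∑ (upTo p) pencilRow ℕ.+ rowSum s)
        ≡⟨ cong (1 ℕ.+_) (∑-agree-off (upTo⁺ p) (∈-upTo⁺ s<p) (λ r r∈ r≢s → off-row (∈-upTo⁻ r∈) r≢s)) ⟩
      1 ℕ.+ (∑ (upTo p) rowSum ℕ.+ pencilRow s)
        ≡⟨ cong₂ (λ x y → 1 ℕ.+ (x ℕ.+ y)) ∑-rowSum on-row ⟩
      1 ℕ.+ (p ℕ.+ p ℕ.* classCount s q)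
        ≡⟨ arith₂ p (p ℕ.* classCount s q) ⟩
      p ℕ.+ (1 ℕ.+ p ℕ.* classCount s q) ∎)
      where
      open ≡-Reasoning
      open import Data.Nat.Tactic.RingSolver using () renaming (solve-∀ to solveℕ-∀)
      p′ = ℕ.pred p
      p≡1+p′ : p ≡ suc p′
      p≡1+p′ = sym (ℕ.suc-pred p)
      arith₁ : ∀ p′ x y → suc p′ ℕ.+ (x ℕ.+ y) ≡ 1 ℕ.+ (y ℕ.+ p′ ℕ.+ x)
      arith₁ = solveℕ-∀
      arith₂ : ∀ p x → 1 ℕ.+ (p ℕ.+ x) ≡ p ℕ.+ (1 ℕ.+ x)
      arith₂ = solveℕ-∀

      pencilRow : ℕ → ℕ
      pencilRow r = ∑ (upTo p) (λ c → classCount r (q + + c * (+ s - + r)))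

      lineThrough : ℕ → ℕ
      lineThrough c = ∑ (upTo p) (λ r → classCount r (q + + c * (+ s - + r)))

      ring : ∀ q c s r → q + c * (s - r) ≡ q + c * s - c * r
      ring = solve-∀

      -- Slope 0 through `(s , q)` contributes the column sum; each other slope contributes 1.
      pencil : ∑ (upTo p) pencilRow ≡ columnSum q ℕ.+ p′
      pencil = begin
        ∑ (upTo p) pencilRow
          ≡⟨ ∑-swap (upTo p) (upTo p) _ ⟩
        ∑ (upTo p) lineThrough
          ≡⟨ cong (λ n → ∑ (upTo n) lineThrough) p≡1+p′ ⟩
        lineThrough 0 ℕ.+ ∑ (applyUpTo suc p′) lineThrough
          ≡⟨ cong₂ ℕ._+_ (∑-cong (upTo p) λ r → cong (classCount r) (ring₀ q (+ s - + r)))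
                         (trans (∑-applyUpTo suc p′ lineThrough) (trans (∑-cong-∈ (upTo p′) slope≥1)
                           (trans (∑-upTo-const p′ 1) (ℕ.*-identityʳ p′)))) ⟩
        columnSum q ℕ.+ p′ ∎
        where
        ring₀ : ∀ q e → q + + 0 * e ≡ q
        ring₀ = solve-∀
        slope≥1 : ∀ {c} → c ∈ˡ upTo p′ → lineThrough (suc c) ≡ 1
        slope≥1 {c} i = trans
          (∑-cong (upTo p) λ r → cong (classCount r) (ring q (+ suc c) (+ s) (+ r)))
          (line (suc c) (ℕ.>⇒∤ (subst (suc c <_) (sym p≡1+p′) (s≤s (∈-upTo⁻ i)))) (q + + suc c * + s))

      -- In a row other than `s` the lines of the pencil meet each cell exactly once; in row `s` all
      -- `p` of them pass through the same cell.
      off-row : ∀ {r} → r < p → r ≢ s → pencilRow r ≡ rowSum r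
      off-row {r} r<p r≢s = ∑-complete-residues prime (classCount-respects r<p) q (+ s - + r) (fin⇒≢0 r<p s<p r≢s)

      on-row : pencilRow s ≡ p ℕ.* classCount s q
      on-row = trans (∑-cong (upTo p) λ c → cong (classCount s) (ring₀ q (+ c) (+ s))) (∑-upTo-const p _)
        where
        ring₀ : ∀ q c s → q + c * (s - s) ≡ q
        ring₀ = solve-∀

    ∑-columnSum : ∑ (upTo p) (λ q → columnSum (+ q)) ≡ p
    ∑-columnSum = trans (∑-swap (upTo p) (upTo p) _) ∑-rowSum

-- Polynomial rings and their quotients as commutative rings.

module QuotientRing where
  open import Data.Nat.Base using (ℕ; zero; suc)
  open import Data.Vec.Functional using (Vector) renaming ([] to []ᵛ; _∷_ to _∷ᵛ_)
  open import Relation.Binary.PropositionalEquality as ≡ using (_≡_; cong)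

  private
    variable
      c ℓ : Level

  module _ (𝓡 : CommutativeRing c ℓ) where
    private
      module R = CommutativeRing 𝓡
      module RP = RingProperties R.ring
      module P = RawRing (Polynomial R.rawRing)
      open CommutativeSemigroupProperties R.+-commutativeSemigroup using (interchange)

      co : List R.Carrier → ℕ → R.Carrier
      co = coeff R.rawRing

      _+ₚ_ _*ₚ_ : List R.Carrier → List R.Carrier → List R.Carrier
      _+ₚ_ = P._+_
      _*ₚ_ = P._*_

      _·ₚ_ : R.Carrier → List R.Carrier → List R.Carrier
      a ·ₚ f = map (a R.*_) f

      infixl 6 _+ₚ_
      infixl 7 _*ₚ_ _·ₚ_

      -- P._≈_ unfolds to a function type, from which the polynomials cannot be
      -- inferred; the record does not unfold.
      infix 4 _≈ₚ_
      record _≈ₚ_ (f g : List R.Carrier) : Set ℓ where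
        constructor coefficientwise
        field at : f P.≈ g
      open _≈ₚ_

      ≈ₚ-isEquivalence : IsEquivalence _≈ₚ_
      ≈ₚ-isEquivalence = record
        { refl  = coefficientwise λ i → R.refl
        ; sym   = λ p → coefficientwise λ i → R.sym (at p i)
        ; trans = λ p q → coefficientwise λ i → R.trans (at p i) (at q i)
        }

      module E = IsEquivalence ≈ₚ-isEquivalence
      ≈ₚ-setoid : Setoid c ℓ
      ≈ₚ-setoid = record { isEquivalence = ≈ₚ-isEquivalence }

      open SetoidReasoning ≈ₚ-setoid

    coeff-+ : ∀ f g i → co (f +ₚ g) i R.≈ co f i R.+ co g i
    coeff-+ []      g       i       = R.sym (R.+-identityˡ _)
    coeff-+ (a ∷ f) []      i       = R.sym (R.+-identityʳ _)
    coeff-+ (a ∷ f) (b ∷ g) zero    = R.refl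
    coeff-+ (a ∷ f) (b ∷ g) (suc i) = coeff-+ f g i

    coeff-neg : ∀ f i → co (P.- f) i R.≈ R.- co f i
    coeff-neg []      i       = R.sym RP.-0#≈0#
    coeff-neg (a ∷ f) zero    = R.refl
    coeff-neg (a ∷ f) (suc i) = coeff-neg f i

    coeff-· : ∀ a f i → co (a ·ₚ f) i R.≈ a R.* co f i
    coeff-· a []      i       = R.sym (R.zeroʳ a)
    coeff-· a (b ∷ f) zero    = R.refl
    coeff-· a (b ∷ f) (suc i) = coeff-· a f i

    private
      +ₚ-cong : ∀ {f f′ g g′} → f ≈ₚ f′ → g ≈ₚ g′ → f +ₚ g ≈ₚ f′ +ₚ g′
      +ₚ-cong {f} {f′} {g} {g′} p q = coefficientwise λ i →
        R.trans (coeff-+ f g i) (R.trans (R.+-cong (at p i) (at q i)) (R.sym (coeff-+ f′ g′ i)))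

      +ₚ-assoc : ∀ f g h → f +ₚ g +ₚ h ≈ₚ f +ₚ (g +ₚ h)
      +ₚ-assoc f g h = coefficientwise λ i →
        R.trans (coeff-+ (f +ₚ g) h i) (R.trans (R.+-congʳ (coeff-+ f g i))
          (R.trans (R.+-assoc _ _ _) (R.sym (R.trans (coeff-+ f (g +ₚ h) i) (R.+-congˡ (coeff-+ g h i))))))

      +ₚ-comm : ∀ f g → f +ₚ g ≈ₚ g +ₚ f
      +ₚ-comm f g = coefficientwise λ i → R.trans (coeff-+ f g i) (R.trans (R.+-comm _ _) (R.sym (coeff-+ g f i)))

      +ₚ-identityʳ : ∀ f → f +ₚ [] ≈ₚ f
      +ₚ-identityʳ f = coefficientwise λ i → R.trans (coeff-+ f [] i) (R.+-identityʳ _)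

      +ₚ-interchange : ∀ f g h k → (f +ₚ g) +ₚ (h +ₚ k) ≈ₚ (f +ₚ h) +ₚ (g +ₚ k)
      +ₚ-interchange f g h k = coefficientwise λ i →
        R.trans (coeff-+ (f +ₚ g) (h +ₚ k) i) (R.trans (R.+-cong (coeff-+ f g i) (coeff-+ h k i))
          (R.trans (interchange _ _ _ _)
            (R.sym (R.trans (coeff-+ (f +ₚ h) (g +ₚ k) i) (R.+-cong (coeff-+ f h i) (coeff-+ g k i))))))

      ∷-cong : ∀ {a b f g} → a R.≈ b → f ≈ₚ g → (a ∷ f) ≈ₚ (b ∷ g)
      ∷-cong p q = coefficientwise λ { zero → p ; (suc i) → at q i }

      ·ₚ-cong : ∀ {a b f g} → a R.≈ b → f ≈ₚ g → a ·ₚ f ≈ₚ b ·ₚ g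
      ·ₚ-cong {a} {b} {f} {g} p q = coefficientwise λ i →
        R.trans (coeff-· a f i) (R.trans (R.*-cong p (at q i)) (R.sym (coeff-· b g i)))

      ·ₚ-distribˡ : ∀ a f g → a ·ₚ (f +ₚ g) ≈ₚ a ·ₚ f +ₚ a ·ₚ g
      ·ₚ-distribˡ a f g = coefficientwise λ i →
        R.trans (coeff-· a (f +ₚ g) i) (R.trans (R.*-congˡ (coeff-+ f g i)) (R.trans (R.distribˡ a _ _)
          (R.sym (R.trans (coeff-+ (a ·ₚ f) (a ·ₚ g) i) (R.+-cong (coeff-· a f i) (coeff-· a g i))))))

      ·ₚ-distribʳ : ∀ a b f → (a R.+ b) ·ₚ f ≈ₚ a ·ₚ f +ₚ b ·ₚ f
      ·ₚ-distribʳ a b f = coefficientwise λ i →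
        R.trans (coeff-· (a R.+ b) f i) (R.trans (R.distribʳ _ a b)
          (R.sym (R.trans (coeff-+ (a ·ₚ f) (b ·ₚ f) i) (R.+-cong (coeff-· a f i) (coeff-· b f i)))))

      ·ₚ-assoc : ∀ a b f → (a R.* b) ·ₚ f ≈ₚ a ·ₚ (b ·ₚ f)
      ·ₚ-assoc a b f = coefficientwise λ i →
        R.trans (coeff-· (a R.* b) f i) (R.trans (R.*-assoc a b _)
          (R.sym (R.trans (coeff-· a (b ·ₚ f) i) (R.*-congˡ (coeff-· b f i)))))

      ·ₚ-zero : ∀ f → R.0# ·ₚ f ≈ₚ []
      ·ₚ-zero f = coefficientwise λ i → R.trans (coeff-· R.0# f i) (R.zeroˡ _)

      0∷[]≈[] : (R.0# ∷ []) ≈ₚ []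
      0∷[]≈[] = coefficientwise λ { zero → R.refl ; (suc i) → R.refl }

      0∷-+ : ∀ f g → (R.0# ∷ (f +ₚ g)) ≈ₚ (R.0# ∷ f) +ₚ (R.0# ∷ g)
      0∷-+ f g = coefficientwise λ { zero → R.sym (R.+-identityʳ R.0#) ; (suc i) → R.refl }

      *ₚ-congʳ : ∀ f {g g′} → g ≈ₚ g′ → f *ₚ g ≈ₚ f *ₚ g′
      *ₚ-congʳ []      p = E.refl
      *ₚ-congʳ (a ∷ f) p = +ₚ-cong (·ₚ-cong R.refl p) (∷-cong R.refl (*ₚ-congʳ f p))

      *ₚ-zeroʳ : ∀ f → f *ₚ [] ≈ₚ []
      *ₚ-zeroʳ []      = E.refl
      *ₚ-zeroʳ (a ∷ f) = E.trans (∷-cong R.refl (*ₚ-zeroʳ f)) 0∷[]≈[]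

      -- `mulPoly` recurses on its left factor. This is the matching recursion on the right factor,
      -- from which commutativity follows by induction.
      *ₚ-∷ʳ : ∀ f b g → f *ₚ (b ∷ g) ≈ₚ b ·ₚ f +ₚ (R.0# ∷ f *ₚ g)
      *ₚ-∷ʳ []      b g = E.sym 0∷[]≈[]
      *ₚ-∷ʳ (a ∷ f) b g = ∷-cong (R.+-congʳ (R.*-comm a b)) (begin
        a ·ₚ g +ₚ f *ₚ (b ∷ g)                    ≈⟨ +ₚ-cong (E.refl {a ·ₚ g}) (*ₚ-∷ʳ f b g) ⟩
        a ·ₚ g +ₚ (b ·ₚ f +ₚ (R.0# ∷ f *ₚ g))     ≈⟨ +ₚ-assoc (a ·ₚ g) (b ·ₚ f) _ ⟨
        a ·ₚ g +ₚ b ·ₚ f +ₚ (R.0# ∷ f *ₚ g)       ≈⟨ +ₚ-cong (+ₚ-comm (a ·ₚ g) (b ·ₚ f)) E.refl ⟩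
        b ·ₚ f +ₚ a ·ₚ g +ₚ (R.0# ∷ f *ₚ g)       ≈⟨ +ₚ-assoc (b ·ₚ f) (a ·ₚ g) _ ⟩
        b ·ₚ f +ₚ (a ·ₚ g +ₚ (R.0# ∷ f *ₚ g))     ∎)

      *ₚ-comm : ∀ f g → f *ₚ g ≈ₚ g *ₚ f
      *ₚ-comm []      g = E.sym (*ₚ-zeroʳ g)
      *ₚ-comm (a ∷ f) g = E.trans (+ₚ-cong (E.refl {a ·ₚ g}) (∷-cong R.refl (*ₚ-comm f g))) (E.sym (*ₚ-∷ʳ g a f))

      -- Equal polynomials may have lists of different lengths, which obstructs an induction on the
      -- left factor; commutativity moves the change to the right.
      *ₚ-cong : ∀ {f f′ g g′} → f ≈ₚ f′ → g ≈ₚ g′ → f *ₚ g ≈ₚ f′ *ₚ g′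
      *ₚ-cong {f} {f′} {g} {g′} p q =
        E.trans (*ₚ-congʳ f q) (E.trans (*ₚ-comm f g′) (E.trans (*ₚ-congʳ g′ p) (*ₚ-comm g′ f′)))

      *ₚ-distribʳ : ∀ h f g → (f +ₚ g) *ₚ h ≈ₚ f *ₚ h +ₚ g *ₚ h
      *ₚ-distribʳ h []      g       = E.refl
      *ₚ-distribʳ h (a ∷ f) []      = E.sym (+ₚ-identityʳ _)
      *ₚ-distribʳ h (a ∷ f) (b ∷ g) = begin
        (a R.+ b) ·ₚ h +ₚ (R.0# ∷ (f +ₚ g) *ₚ h)
          ≈⟨ +ₚ-cong (·ₚ-distribʳ a b h) (∷-cong R.refl (*ₚ-distribʳ h f g)) ⟩
        (a ·ₚ h +ₚ b ·ₚ h) +ₚ (R.0# ∷ (f *ₚ h +ₚ g *ₚ h))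
          ≈⟨ +ₚ-cong (E.refl {a ·ₚ h +ₚ b ·ₚ h}) (0∷-+ (f *ₚ h) (g *ₚ h)) ⟩
        (a ·ₚ h +ₚ b ·ₚ h) +ₚ ((R.0# ∷ f *ₚ h) +ₚ (R.0# ∷ g *ₚ h))
          ≈⟨ +ₚ-interchange (a ·ₚ h) (b ·ₚ h) _ _ ⟩
        (a ·ₚ h +ₚ (R.0# ∷ f *ₚ h)) +ₚ (b ·ₚ h +ₚ (R.0# ∷ g *ₚ h)) ∎

      ·ₚ-*ₚ : ∀ a f g → (a ·ₚ f) *ₚ g ≈ₚ a ·ₚ (f *ₚ g)
      ·ₚ-*ₚ a []      g = E.refl
      ·ₚ-*ₚ a (b ∷ f) g = begin
        (a R.* b) ·ₚ g +ₚ (R.0# ∷ (a ·ₚ f) *ₚ g)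
          ≈⟨ +ₚ-cong (·ₚ-assoc a b g) (∷-cong (R.sym (R.zeroʳ a)) (·ₚ-*ₚ a f g)) ⟩
        a ·ₚ (b ·ₚ g) +ₚ a ·ₚ (R.0# ∷ f *ₚ g)
          ≈⟨ ·ₚ-distribˡ a (b ·ₚ g) (R.0# ∷ f *ₚ g) ⟨
        a ·ₚ (b ·ₚ g +ₚ (R.0# ∷ f *ₚ g)) ∎

      0∷-*ₚ : ∀ f g → (R.0# ∷ f) *ₚ g ≈ₚ (R.0# ∷ f *ₚ g)
      0∷-*ₚ f g = +ₚ-cong (·ₚ-zero g) (E.refl {R.0# ∷ f *ₚ g})

      *ₚ-assoc : ∀ f g h → f *ₚ g *ₚ h ≈ₚ f *ₚ (g *ₚ h)
      *ₚ-assoc []      g h = E.refl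
      *ₚ-assoc (a ∷ f) g h = begin
        (a ·ₚ g +ₚ (R.0# ∷ f *ₚ g)) *ₚ h
          ≈⟨ *ₚ-distribʳ h (a ·ₚ g) (R.0# ∷ f *ₚ g) ⟩
        (a ·ₚ g) *ₚ h +ₚ (R.0# ∷ f *ₚ g) *ₚ h
          ≈⟨ +ₚ-cong (·ₚ-*ₚ a g h) (E.trans (0∷-*ₚ (f *ₚ g) h) (∷-cong R.refl (*ₚ-assoc f g h))) ⟩
        a ·ₚ (g *ₚ h) +ₚ (R.0# ∷ f *ₚ (g *ₚ h)) ∎

      *ₚ-identityˡ : ∀ f → (R.1# ∷ []) *ₚ f ≈ₚ f
      *ₚ-identityˡ f = coefficientwise λ i → R.trans (coeff-+ (R.1# ·ₚ f) (R.0# ∷ []) i)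
        (R.trans (R.+-cong (R.trans (coeff-· R.1# f i) (R.*-identityˡ _)) (at 0∷[]≈[] i)) (R.+-identityʳ _))

      -ₚ-inverseˡ : ∀ f → (P.- f) +ₚ f ≈ₚ []
      -ₚ-inverseˡ f = coefficientwise λ i → R.trans (coeff-+ (P.- f) f i)
        (R.trans (R.+-congʳ (coeff-neg f i)) (R.-‿inverseˡ _))

      -ₚ-cong : ∀ {f g} → f ≈ₚ g → P.- f ≈ₚ P.- g
      -ₚ-cong {f} {g} p = coefficientwise λ i → R.trans (coeff-neg f i) (R.trans (R.-‿cong (at p i)) (R.sym (coeff-neg g i)))

    polynomial-isCommutativeRing : IsCommutativeRing P._≈_ P._+_ P._*_ P.-_ P.0# P.1#
    polynomial-isCommutativeRing = record
      { isRing = record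
        { +-isAbelianGroup = record
          { isGroup = record
            { isMonoid = record
              { isSemigroup = record
                { isMagma = record
                  { isEquivalence = record
                    { refl  = λ i → R.refl
                    ; sym   = λ p i → R.sym (p i)
                    ; trans = λ p q i → R.trans (p i) (q i)
                    }
                  ; ∙-cong = λ {f} {f′} {g} {g′} p q →
                      at (+ₚ-cong {f} {f′} {g} {g′} (coefficientwise p) (coefficientwise q))
                  }
                ; assoc = λ f g h → at (+ₚ-assoc f g h)
                }
              ; identity = (λ f i → R.refl) , λ f → at (+ₚ-identityʳ f)
              }
            ; inverse = (λ f → at (-ₚ-inverseˡ f))
                      , λ f → at (E.trans (+ₚ-comm f (P.- f)) (-ₚ-inverseˡ f))
            ; ⁻¹-cong = λ {f} {g} p → at (-ₚ-cong {f} {g} (coefficientwise p))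
            }
          ; comm = λ f g → at (+ₚ-comm f g)
          }
        ; *-cong = λ {f} {f′} {g} {g′} p q →
            at (*ₚ-cong {f} {f′} {g} {g′} (coefficientwise p) (coefficientwise q))
        ; *-assoc = λ f g h → at (*ₚ-assoc f g h)
        ; *-identity = (λ f → at (*ₚ-identityˡ f))
                     , λ f → at (E.trans (*ₚ-comm f P.1#) (*ₚ-identityˡ f))
        ; distrib = (λ f g h → at (E.trans (*ₚ-comm f (g +ₚ h)) (E.trans (*ₚ-distribʳ f g h)
                      (+ₚ-cong (*ₚ-comm g f) (*ₚ-comm h f)))))
                  , λ f g h → at (*ₚ-distribʳ f g h)
        }
      ; *-comm = λ f g → at (*ₚ-comm f g)
      }

    polynomialRing : CommutativeRing c ℓ
    polynomialRing = record { isCommutativeRing = polynomial-isCommutativeRing }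

  module _ (𝓡 : CommutativeRing c ℓ) {k} (g : Vector (CommutativeRing.Carrier 𝓡) k) where
    private
      open CommutativeRing 𝓡
      module Q = RawRing (Quotient rawRing g)
      open SemiringSum semiring using (sum; sum-cong-≋; sum-replicate-zero; *-distribˡ-sum)
      open MonoidSum +-commutativeMonoid using (∑-distrib-+)
      open RingProperties ring using (-‿+-comm; -0#≈0#; -1*x≈-x)
      open CommutativeSemigroupProperties +-commutativeSemigroup using (interchange)
      open SetoidReasoning setoid

      span : Vector Carrier k → Carrier
      span t = sum (λ i → t i * g i)

      span-+ : ∀ s t → span (λ i → s i + t i) ≈ span s + span t
      span-+ s t = trans (sum-cong-≋ {k} (λ i → distribʳ (g i) (s i) (t i))) (∑-distrib-+ (λ i → s i * g i) (λ i → t i * g i))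

      span-* : ∀ a t → span (λ i → a * t i) ≈ a * span t
      span-* a t = trans (sum-cong-≋ {k} (λ i → *-assoc a (t i) (g i))) (sym (*-distribˡ-sum a (λ i → t i * g i)))

      span-neg : ∀ t → span (λ i → - 1# * t i) ≈ - span t
      span-neg t = trans (span-* (- 1#) t) (-1*x≈-x _)

      lift : ∀ {a b} → a ≈ b → a Q.≈ b
      lift {a} {b} p = (λ _ → 0#) , (begin
        a                    ≈⟨ p ⟩
        b                    ≈⟨ +-identityʳ b ⟨
        b + 0#               ≈⟨ +-congˡ (sum-replicate-zero k) ⟨
        b + sum (λ (i : Fin k) → 0#) ≈⟨ +-congˡ (sum-cong-≋ (λ i → zeroˡ (g i))) ⟨
        b + span (λ _ → 0#)  ∎)
        where open import Data.Fin.Base using (Fin)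

      ≈-sym : ∀ {a b} → a Q.≈ b → b Q.≈ a
      ≈-sym {a} {b} (t , p) = (λ i → - 1# * t i) , (begin
        b                        ≈⟨ +-identityʳ b ⟨
        b + 0#                   ≈⟨ +-congˡ (-‿inverseʳ (span t)) ⟨
        b + (span t - span t)    ≈⟨ +-assoc b _ _ ⟨
        (b + span t) - span t    ≈⟨ +-cong (sym p) (sym (span-neg t)) ⟩
        a + span (λ i → - 1# * t i) ∎)

      ≈-trans : ∀ {a b d} → a Q.≈ b → b Q.≈ d → a Q.≈ d
      ≈-trans {a} {b} {d} (s , p) (t , q) = (λ i → t i + s i) , (begin
        a                          ≈⟨ p ⟩
        b + span s                 ≈⟨ +-congʳ q ⟩
        (d + span t) + span s      ≈⟨ +-assoc d _ _ ⟩
        d + (span t + span s)      ≈⟨ +-congˡ (span-+ t s) ⟨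
        d + span (λ i → t i + s i) ∎)

      Q-isEquivalence : IsEquivalence Q._≈_
      Q-isEquivalence = record { refl = lift refl ; sym = ≈-sym ; trans = ≈-trans }

      Q-+-cong : ∀ {a a′ b b′} → a Q.≈ a′ → b Q.≈ b′ → a + b Q.≈ a′ + b′
      Q-+-cong {a} {a′} {b} {b′} (s , p) (t , q) = (λ i → s i + t i) , (begin
        a + b                            ≈⟨ +-cong p q ⟩
        (a′ + span s) + (b′ + span t)    ≈⟨ interchange _ _ _ _ ⟩
        (a′ + b′) + (span s + span t)    ≈⟨ +-congˡ (span-+ s t) ⟨
        (a′ + b′) + span (λ i → s i + t i) ∎)

      Q-*-congˡ : ∀ a {b b′} → b Q.≈ b′ → a * b Q.≈ a * b′
      Q-*-congˡ a {b} {b′} (t , q) = (λ i → a * t i) , (begin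
        a * b                         ≈⟨ *-congˡ q ⟩
        a * (b′ + span t)             ≈⟨ distribˡ a b′ _ ⟩
        a * b′ + a * span t           ≈⟨ +-congˡ (span-* a t) ⟨
        a * b′ + span (λ i → a * t i) ∎)

      Q-*-cong : ∀ {a a′ b b′} → a Q.≈ a′ → b Q.≈ b′ → a * b Q.≈ a′ * b′
      Q-*-cong {a} {a′} {b} {b′} p q = ≈-trans (Q-*-congˡ a q)
        (≈-trans (lift (*-comm a b′)) (≈-trans (Q-*-congˡ b′ p) (lift (*-comm b′ a′))))

      Q-neg-cong : ∀ {a b} → a Q.≈ b → - a Q.≈ - b
      Q-neg-cong {a} {b} (t , p) = (λ i → - 1# * t i) , (begin
        - a                           ≈⟨ -‿cong p ⟩
        - (b + span t)                ≈⟨ -‿+-comm b _ ⟨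
        - b - span t                  ≈⟨ +-congˡ (span-neg t) ⟨
        - b + span (λ i → - 1# * t i) ∎)

    quotient-isCommutativeRing : IsCommutativeRing Q._≈_ _+_ _*_ -_ 0# 1#
    quotient-isCommutativeRing = record
      { isRing = record
        { +-isAbelianGroup = record
          { isGroup = record
            { isMonoid = record
              { isSemigroup = record
                { isMagma = record { isEquivalence = Q-isEquivalence ; ∙-cong = Q-+-cong }
                ; assoc = λ a b d → lift (+-assoc a b d)
                }
              ; identity = (λ a → lift (+-identityˡ a)) , λ a → lift (+-identityʳ a)
              }
            ; inverse = (λ a → lift (-‿inverseˡ a)) , λ a → lift (-‿inverseʳ a)
            ; ⁻¹-cong = Q-neg-cong
            }
          ; comm = λ a b → lift (+-comm a b)
          }
        ; *-cong = Q-*-cong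
        ; *-assoc = λ a b d → lift (*-assoc a b d)
        ; *-identity = (λ a → lift (*-identityˡ a)) , λ a → lift (*-identityʳ a)
        ; distrib = (λ a b d → lift (distribˡ a b d)) , λ a b d → lift (distribʳ a b d)
        }
      ; *-comm = λ a b → lift (*-comm a b)
      }

    quotientRing : CommutativeRing _ _
    quotientRing = record { isCommutativeRing = quotient-isCommutativeRing }

  -- Powers in a quotient are the powers in the original ring, although the two
  -- terms carry different equality relations and hence are not convertible.
  quotient-^ : (R : RawRing c ℓ) → ∀ {k} (g : Vector (RawRing.Carrier R) k) u m →
    RawSemiringDefs._^_ (RawRing.rawSemiring (Quotient R g)) u m
    ≡ RawSemiringDefs._^_ (RawRing.rawSemiring R) u m
  quotient-^ R g u zero    = ≡.refl
  quotient-^ R g u (suc m) = cong (RawRing._*_ R u) (quotient-^ R g u m)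

  -- Stated over an abstract ring because ≈ in ℤ[x,y] unfolds too far for implicit
  -- arguments to be inferred.
  module _ (𝓡 : CommutativeRing c ℓ) where
    open CommutativeRing 𝓡
    open RawSemiringDefs (RawRing.rawSemiring rawRing) using (_^_)
    open SetoidReasoning setoid

    power≈1 : ∀ a v L →
      let g = a ∷ᵛ powerMinusOne rawRing v L ∷ᵛ []ᵛ
      in RawRing._≈_ (Quotient rawRing g)
           (RawSemiringDefs._^_ (RawRing.rawSemiring (Quotient rawRing g)) v L) 1#
    -- The coefficients are 0 and 1 because `v ^ L` is 1 plus the second generator.
    power≈1 a v L = (0# ∷ᵛ 1# ∷ᵛ []ᵛ) , (begin
      RawSemiringDefs._^_ (RawRing.rawSemiring (Quotient rawRing (a ∷ᵛ b ∷ᵛ []ᵛ))) v L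
                                    ≡⟨ quotient-^ rawRing (a ∷ᵛ b ∷ᵛ []ᵛ) v L ⟩
      v ^ L                         ≈⟨ +-identityʳ _ ⟨
      v ^ L + 0#                    ≈⟨ +-congˡ (-‿inverseˡ 1#) ⟨
      v ^ L + (- 1# + 1#)           ≈⟨ +-assoc _ _ _ ⟨
      b + 1#                        ≈⟨ +-comm b 1# ⟩
      1# + b                        ≈⟨ +-congˡ (+-identityʳ b) ⟨
      1# + (b + 0#)                 ≈⟨ +-congˡ (+-congʳ (*-identityˡ b)) ⟨
      1# + (1# * b + 0#)            ≈⟨ +-congˡ (+-identityˡ _) ⟨
      1# + (0# + (1# * b + 0#))     ≈⟨ +-congˡ (+-congʳ (zeroˡ a)) ⟨
      1# + (0# * a + (1# * b + 0#)) ∎)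
      where b = powerMinusOne rawRing v L

  ℤ[x]-ring : CommutativeRing _ _
  ℤ[x]-ring = polynomialRing ℤ.+-*-commutativeRing

  ℤ[x,y]-ring : CommutativeRing _ _
  ℤ[x,y]-ring = polynomialRing ℤ[x]-ring

  ℤ[x]/⟨_⟩-ring : ℕ → CommutativeRing _ _
  ℤ[x]/⟨ n ⟩-ring = quotientRing ℤ[x]-ring (powerMinusOne ℤ[x] x₁ n ∷ᵛ []ᵛ)

  ℤ[x,y]/⟨_,_⟩-ring : ℕ → ℕ → CommutativeRing _ _
  ℤ[x,y]/⟨ n , L ⟩-ring =
    quotientRing ℤ[x,y]-ring (powerMinusOne ℤ[x,y] x₂ n ∷ᵛ powerMinusOne ℤ[x,y] y₂ L ∷ᵛ []ᵛ)

  y₂^L≈1 : ∀ n L → let open CommutativeRing ℤ[x,y]/⟨ n , L ⟩-ring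
                       open RawSemiringDefs (RawRing.rawSemiring rawRing) using (_^_)
                   in y₂ ^ L ≈ 1#
  y₂^L≈1 n L = power≈1 ℤ[x,y]-ring (powerMinusOne ℤ[x,y] x₂ n) y₂ L

-- Powers and sums in commutative rings.

module RingPowers where
  open import Data.Nat.Base as ℕ using (ℕ; zero; suc; NonZero)
  open import Relation.Binary.PropositionalEquality using (_≢_; cong)

  module _ {c ℓ} (𝓢 : CommutativeRing c ℓ) where
    open CommutativeRing 𝓢 hiding (zero)
    open SemiringExp commutativeSemiring using (_^_; ^-homo-*; ^-assocʳ; ^-congˡ)
    open SemiringMult semiring using () renaming (_×_ to infixr 8 _·_)
    open SemiringSum semiring using (sum; sum-cong-≋; sum-replicate-zero)
    open SetoidReasoning setoid

    m·0≈0 : ∀ m → m · 0# ≈ 0#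
    m·0≈0 zero    = refl
    m·0≈0 (suc m) = trans (+-identityˡ _) (m·0≈0 m)

    1^≈1 : ∀ m → 1# ^ m ≈ 1#
    1^≈1 zero    = refl
    1^≈1 (suc m) = trans (*-identityˡ _) (1^≈1 m)

    ^-% : ∀ L .{{_ : NonZero L}} {v} → v ^ L ≈ 1# → ∀ e → v ^ e ≈ v ^ (e % L)
    ^-% L {v} v^L≈1 e = begin
      v ^ e                             ≡⟨ cong (v ^_) (m≡m%n+[m/n]*n e L) ⟩
      v ^ (e % L ℕ.+ e / L ℕ.* L)       ≈⟨ ^-homo-* v (e % L) (e / L ℕ.* L) ⟩
      v ^ (e % L) * v ^ (e / L ℕ.* L)   ≡⟨ cong (λ m → v ^ (e % L) * v ^ m) (ℕ.*-comm (e / L) L) ⟩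
      v ^ (e % L) * v ^ (L ℕ.* (e / L)) ≈⟨ *-congˡ (^-assocʳ v L (e / L)) ⟨
      v ^ (e % L) * (v ^ L) ^ (e / L)   ≈⟨ *-congˡ (trans (^-congˡ (e / L) v^L≈1) (1^≈1 (e / L))) ⟩
      v ^ (e % L) * 1#                  ≈⟨ *-identityʳ _ ⟩
      v ^ (e % L)                       ∎

    sum-single : ∀ {k} (f : Fin k → Carrier) r → (∀ j → j ≢ r → f j ≈ 0#) → sum f ≈ f r
    sum-single {suc k} f zero    off = trans
      (+-congˡ (trans (sum-cong-≋ (λ j → off (suc j) λ ())) (sum-replicate-zero k))) (+-identityʳ _)
    sum-single {suc k} f (suc r) off = trans
      (+-cong (off zero λ ()) (sum-single (f ∘ suc) r (λ j j≢r → off (suc j) (j≢r ∘ Fin.suc-injective)))) (+-identityˡ _)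

-- The Frobenius congruence paired with weights on exponents.

module Frobenius where
  open ListSum
  open Congruence
  open RingPowers
  open import Data.Integer.Base as ℤ using (ℤ; +_)
  open import Data.Nat.Base as ℕ using (ℕ; zero; suc; _!; _<_; _≤_; _∸_)
  open import Relation.Binary.PropositionalEquality as ≡ using (_≡_; cong; cong₂)

  open GroupProperties (CommutativeRing.+-group ℤ.+-*-commutativeRing) using () renaming (∙-cancelˡ to +-cancelˡ)

  private
    variable
      c ℓ : Level

  prime∤! : ∀ {p} → Prime p → ∀ k → k < p → ¬ p ℕ.∣ k !
  prime∤! {p} pp zero    _   p∣ = contradiction (ℕ.∣⇒≤ p∣) (ℕ.<⇒≱ (ℕ.nonTrivial⇒n>1 p {{prime⇒nonTrivial pp}}))
  prime∤! pp (suc k) k<p p∣ with euclidsLemma (suc k) (k !) pp p∣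
  ... | inj₁ p∣suc = ℕ.>⇒∤ k<p p∣suc
  ... | inj₂ p∣k!  = prime∤! pp k (ℕ.<-trans (ℕ.n<1+n k) k<p) p∣k!

  C*k!*[n∸k]!≡n! : ∀ {n k} → k ≤ n → (n C k) ℕ.* (k ! ℕ.* (n ∸ k) !) ≡ n !
  C*k!*[n∸k]!≡n! {n} {k} k≤n = ≡.trans
    (cong (ℕ._* (k ! ℕ.* (n ∸ k) !)) (nCk≡n!/k![n-k]! k≤n)) (m/n*n≡m (k![n∸k]!∣n! k≤n))
    where instance _ = ℕ._!*_!≢0 k (n ∸ k)

  prime∣! : ∀ {p} → Prime p → p ℕ.∣ p !
  prime∣! {zero}  pp = contradiction pp ¬prime[0]
  prime∣! {suc p} pp = ℕ.m∣m*n (p !)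

  -- `p` divides `p !`, which is the binomial coefficient times `k !` and `(p ∸ k) !`, but it
  -- divides neither of these factorials.
  prime∣C : ∀ {p k} → Prime p → 0 < k → k < p → p ℕ.∣ p C k
  prime∣C {p} {k} pp 0<k k<p = [ (λ p∣C → p∣C) , (λ p∣k!k! → contradiction p∣k!k! p∤k!k!) ]′
    (euclidsLemma (p C k) (k ! ℕ.* (p ∸ k) !) pp
      (≡.subst (p ℕ.∣_) (≡.sym (C*k!*[n∸k]!≡n! (ℕ.<⇒≤ k<p))) (prime∣! pp)))
    where
    p∤k!k! : ¬ p ℕ.∣ k ! ℕ.* (p ∸ k) !
    p∤k!k! p∣ = [ prime∤! pp k k<p , prime∤! pp (p ∸ k) (ℕ.∸-monoʳ-< 0<k (ℕ.<⇒≤ k<p)) ]′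
      (euclidsLemma (k !) ((p ∸ k) !) pp p∣)

  -- Exponents are added without reduction; cyclic behaviour comes only from the periodicity of the
  -- weights `F`.
  _⊹_ : ℕ × ℕ → ℕ × ℕ → ℕ × ℕ
  (h , k) ⊹ (h′ , k′) = h ℕ.+ h′ , k ℕ.+ k′

  scale : ℕ → ℕ × ℕ → ℕ × ℕ
  scale m (h , k) = m ℕ.* h , m ℕ.* k

  -- Transpose of multiplication by the polynomial of `P`: weighting its product with a polynomial f
  -- by `F` amounts to weighting f by `translates P F`.
  translates : List (ℕ × ℕ) → (ℕ × ℕ → ℕ) → ℕ × ℕ → ℕ
  translates P F g = ∑ P (λ a → F (a ⊹ g))

  -- At `(0 , 0)` this sums `F` over the sums of all `m`-tuples from `P`; it is the `F`-weighted
  -- coefficient sum of the `m`-th power.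
  iterate : ℕ → List (ℕ × ℕ) → (ℕ × ℕ → ℕ) → ℕ × ℕ → ℕ
  iterate zero    P F = F
  iterate (suc m) P F = iterate m P (translates P F)

  module _ (𝓢 : CommutativeRing c ℓ) where
    open CommutativeRing 𝓢 hiding (zero)
    open SemiringExp commutativeSemiring using (_^_; ^-cong; ^-distrib-*; ^-assocʳ)
    open SemiringMult semiring using () renaming (_×_ to infixr 8 _·_)
    open MonoidMult +-commutativeMonoid using (×-distrib-+; ×-assocˡ; ×-homo-1; ×-congˡ)
    open SemiringSum semiring using (sum; sum-init-last)
    open SetoidReasoning setoid

    private
      multiple-sum : ∀ m {k} (f : Fin k → Carrier) → (∀ i → ∃ λ t → f i ≈ m · t) → ∃ λ t → sum f ≈ m · t
      multiple-sum m {zero}  f p = 0# , sym (m·0≈0 𝓢 m)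
      multiple-sum m {suc k} f p with p zero | multiple-sum m (λ i → f (suc i)) (λ i → p (suc i))
      ... | t , eq | t′ , eq′ = t + t′ , trans (+-cong eq eq′) (sym (×-distrib-+ t t′ m))

    -- The error is exhibited as an element `p · t`, so that a functional applied to the identity
    -- yields an explicit integer multiple of `p`.
    frobenius-+ : ∀ {p} → Prime p → ∀ x y → ∃ λ t → (x + y) ^ p ≈ x ^ p + y ^ p + p · t
    frobenius-+ {zero}  pp x y = contradiction pp ¬prime[0]
    frobenius-+ {suc p} pp x y = proj₁ middle , (begin
      (x + y) ^ suc p
        ≈⟨ Binomial.theorem commutativeSemiring (suc p) x y ⟩
      term zero + sum (λ i → term (suc i))
        ≈⟨ +-congˡ (sum-init-last (λ i → term (suc i))) ⟩
      term zero + (sum (λ i → term (suc (inject₁ i))) + term (suc (fromℕ p)))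
        ≈⟨ +-cong first (+-cong (proj₂ middle) last) ⟩
      y ^ suc p + (suc p · proj₁ middle + x ^ suc p)
        ≈⟨ +-comm _ _ ⟩
      (suc p · proj₁ middle + x ^ suc p) + y ^ suc p
        ≈⟨ +-assoc _ _ _ ⟩
      suc p · proj₁ middle + (x ^ suc p + y ^ suc p)
        ≈⟨ +-comm _ _ ⟩
      x ^ suc p + y ^ suc p + suc p · proj₁ middle ∎)
      where
      open Binomial commutativeSemiring using (binomialTerm; binomial)
      term = binomialTerm x y (suc p)
      divisible : ∀ (i : Fin p) → ∃ λ t → term (suc (inject₁ i)) ≈ suc p · t
      divisible i = ℕ.quotient p∣C · b ,
        trans (×-congˡ (≡.trans (ℕ._∣_.equality p∣C) (ℕ.*-comm (ℕ.quotient p∣C) (suc p))))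
              (sym (×-assocˡ b (suc p) (ℕ.quotient p∣C)))
        where
        b = binomial x y (suc p) (suc (inject₁ i))
        p∣C : suc p ℕ.∣ suc p C suc (toℕ (inject₁ i))
        p∣C = prime∣C pp (ℕ.s≤s ℕ.z≤n) (ℕ.s≤s (≡.subst (_< p) (≡.sym (toℕ-inject₁ i)) (toℕ<n i)))
      middle : ∃ λ t → sum (λ i → term (suc (inject₁ i))) ≈ suc p · t
      middle = multiple-sum (suc p) (λ i → term (suc (inject₁ i))) divisible
      first : term zero ≈ y ^ suc p
      first = trans (×-homo-1 _) (*-identityˡ _)
      last : term (suc (fromℕ p)) ≈ x ^ suc p
      last = begin
        (suc p C suc (toℕ (fromℕ p))) · (x ^ suc (toℕ (fromℕ p)) * y ^ (p ∸ toℕ (fromℕ p)))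
          ≡⟨ cong (λ k → (suc p C suc k) · (x ^ suc k * y ^ (p ∸ k))) (toℕ-fromℕ p) ⟩
        (suc p C suc p) · (x ^ suc p * y ^ (p ∸ p))
          ≡⟨ cong₂ (λ a b → a · (x ^ suc p * y ^ b)) (nCn≡1 (suc p)) (ℕ.n∸n≡0 p) ⟩
        1 · (x ^ suc p * 1#)
          ≈⟨ trans (×-homo-1 _) (*-identityʳ _) ⟩
        x ^ suc p ∎

    module _ (u v : Carrier) where
      monomial : ℕ × ℕ → Carrier
      monomial (h , k) = u ^ h * v ^ k

      total : List (ℕ × ℕ) → Carrier
      total []      = 0#
      total (a ∷ P) = monomial a + total P

      frobenius-total : ∀ {p} → Prime p → ∀ P → ∃ λ t → total P ^ p ≈ total (map (scale p) P) + p · t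
      frobenius-total {zero}  pp = contradiction pp ¬prime[0]
      frobenius-total {suc p} pp []      = 0# , trans (zeroˡ _) (sym (trans (+-identityˡ _) (m·0≈0 𝓢 (suc p))))
      frobenius-total {p@(suc _)} pp (a@(h , k) ∷ P) = combine (frobenius-total pp P) (frobenius-+ pp (monomial a) (total P))
        where
        T = total (map (scale p) P)
        power : monomial a ^ p ≈ monomial (scale p a)
        power = trans (^-distrib-* (u ^ h) (v ^ k) p) (*-cong
          (trans (^-assocʳ u h p) (^-cong (refl {u}) (ℕ.*-comm h p)))
          (trans (^-assocʳ v k p) (^-cong (refl {v}) (ℕ.*-comm k p))))
        combine : (∃ λ t → total P ^ p ≈ T + p · t) →
                  (∃ λ t → (monomial a + total P) ^ p ≈ monomial a ^ p + total P ^ p + p · t) →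
                  ∃ λ t → (monomial a + total P) ^ p ≈ monomial (scale p a) + T + p · t
        combine (t , eq) (t′ , eq′) = t + t′ , (begin
          (monomial a + total P) ^ p
            ≈⟨ eq′ ⟩
          monomial a ^ p + total P ^ p + p · t′
            ≈⟨ +-congʳ (+-cong power eq) ⟩
          monomial (scale p a) + (T + p · t) + p · t′
            ≈⟨ +-congʳ (+-assoc _ _ _) ⟨
          monomial (scale p a) + T + p · t + p · t′
            ≈⟨ +-assoc _ _ _ ⟩
          monomial (scale p a) + T + (p · t + p · t′)
            ≈⟨ +-congˡ (×-distrib-+ t t′ p) ⟨
          monomial (scale p a) + T + p · (t + t′) ∎)

      -- A linear functional φ F with φ F (uʰ vᵏ) = F (h , k), for every F.
      record Evaluations : Set (c ⊔ ℓ) where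
        field
          φ        : (ℕ × ℕ → ℕ) → Carrier → ℤ
          φ-cong   : ∀ F {x y} → x ≈ y → φ F x ≡ φ F y
          φ-+      : ∀ F x y → φ F (x + y) ≡ φ F x ℤ.+ φ F y
          φ-1#     : ∀ F → φ F 1# ≡ + F (0 , 0)
          φ-u      : ∀ F x → φ F (u * x) ≡ φ (λ g → F ((1 , 0) ⊹ g)) x
          φ-v      : ∀ F x → φ F (v * x) ≡ φ (λ g → F ((0 , 1) ⊹ g)) x
          φ-weight : ∀ F G x → φ (λ g → F g ℕ.+ G g) x ≡ φ F x ℤ.+ φ G x
          φ-zero   : ∀ x → φ (λ _ → 0) x ≡ + 0

        φ-0# : ∀ F → φ F 0# ≡ + 0
        φ-0# F = +-cancelˡ (φ F 0#) _ _
          (≡.trans (≡.sym (φ-+ F 0# 0#)) (≡.trans (φ-cong F (+-identityˡ 0#)) (≡.sym (ℤ.+-identityʳ _))))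

        φ-u^ : ∀ h F x → φ F (u ^ h * x) ≡ φ (λ g → F ((h , 0) ⊹ g)) x
        φ-u^ zero    F x = φ-cong F (*-identityˡ x)
        φ-u^ (suc h) F x = ≡.trans (φ-cong F (*-assoc u (u ^ h) x))
          (≡.trans (φ-u F (u ^ h * x)) (φ-u^ h (λ g → F ((1 , 0) ⊹ g)) x))

        φ-v^ : ∀ k F x → φ F (v ^ k * x) ≡ φ (λ g → F ((0 , k) ⊹ g)) x
        φ-v^ zero    F x = φ-cong F (*-identityˡ x)
        φ-v^ (suc k) F x = ≡.trans (φ-cong F (*-assoc v (v ^ k) x))
          (≡.trans (φ-v F (v ^ k * x)) (φ-v^ k (λ g → F ((0 , 1) ⊹ g)) x))

        φ-monomial : ∀ a F x → φ F (monomial a * x) ≡ φ (λ g → F (a ⊹ g)) x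
        φ-monomial (h , k) F x = ≡.trans (φ-cong F (*-assoc (u ^ h) (v ^ k) x))
          (≡.trans (φ-u^ h F (v ^ k * x)) (φ-v^ k (λ g → F ((h , 0) ⊹ g)) x))

        φ-total : ∀ P F x → φ F (total P * x) ≡ φ (translates P F) x
        φ-total []      F x = ≡.trans (φ-cong F (zeroˡ x)) (≡.trans (φ-0# F) (≡.sym (φ-zero x)))
        φ-total (a ∷ P) F x = ≡.trans (φ-cong F (distribʳ x (monomial a) (total P)))
          (≡.trans (φ-+ F _ _) (≡.trans (cong₂ ℤ._+_ (φ-monomial a F x) (φ-total P F x))
            (≡.sym (φ-weight (λ g → F (a ⊹ g)) (translates P F) x))))

        φ-total^ : ∀ m P F → φ F (total P ^ m) ≡ + iterate m P F (0 , 0)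
        φ-total^ zero    P F = φ-1# F
        φ-total^ (suc m) P F = ≡.trans (φ-total P F (total P ^ m)) (φ-total^ m P (translates P F))

        φ-× : ∀ m F x → φ F (m · x) ≡ φ F x ℤ.* + m
        φ-× zero    F x = ≡.trans (φ-0# F) (≡.sym (ℤ.*-zeroʳ (φ F x)))
        φ-× (suc m) F x = ≡.trans (φ-+ F x (m · x)) (≡.trans (cong (λ z → φ F x ℤ.+ z) (φ-× m F x))
          (≡.sym (ℤ.*-suc (φ F x) (+ m))))

        -- Apply `φ F` to the expansion of the `p`-th power; the integer `φ F t` is the quotient in
        -- the congruence. With `F` an indicator of residue classes this compares coefficients in a
        -- cyclic group ring.
        iterate-frobenius : ∀ {p} → Prime p → ∀ P F →
          Cong p (+ iterate p P F (0 , 0)) (+ ∑ P (λ a → F (scale p a)))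
        iterate-frobenius {p} pp P F with frobenius-total pp P
        ... | t , eq = cong-by (φ F t) (≡.trans (≡.sym (φ-total^ p P F))
                (≡.trans (φ-cong F eq) (≡.trans (φ-+ F _ _) (cong₂ ℤ._+_ scaled (φ-× p F t)))))
          where
          scaled : φ F (total (map (scale p) P)) ≡ + ∑ P (λ a → F (scale p a))
          scaled = ≡.trans (φ-cong F (sym (*-identityʳ _))) (≡.trans (φ-total (map (scale p) P) F 1#)
            (≡.trans (φ-1# (translates (map (scale p) P) F)) (cong +_ (≡.trans (∑-map (scale p) P _)
              (∑-cong P λ a → cong₂ (λ h k → F (h , k)) (ℕ.+-identityʳ _) (ℕ.+-identityʳ _))))))

-- Coefficient functionals on ℤ[x,y].

module Evaluation where
  open ListSum
  open Congruence
  open QuotientRing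
  open Frobenius
  open import Data.Integer.Base as ℤ using (ℤ; +_)
  open import Data.Nat.Base as ℕ using (ℕ; suc)
  open import Relation.Binary.PropositionalEquality as ≡ using (_≡_; refl; cong; cong₂)

  open CommutativeSemigroupProperties ℤ.+-commutativeSemigroup using (interchange)
  open GroupProperties (CommutativeRing.+-group ℤ.+-*-commutativeRing) using () renaming (∙-cancelˡ to +-cancelˡ)

  private
    variable
      c ℓ : Level

  -- Only additivity is retained, because the same construction is applied twice, over ℤ and then
  -- over ℤ[x].
  record AdditiveMap (𝓡 : CommutativeRing c ℓ) : Set (c ⊔ ℓ) where
    open CommutativeRing 𝓡
    field
      ⟦_⟧    : Carrier → ℤ
      ⟦⟧-cong : ∀ {a b} → a ≈ b → ⟦ a ⟧ ≡ ⟦ b ⟧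
      ⟦⟧-+    : ∀ a b → ⟦ a + b ⟧ ≡ ⟦ a ⟧ ℤ.+ ⟦ b ⟧

    ⟦0#⟧ : ⟦ 0# ⟧ ≡ + 0
    ⟦0#⟧ = +-cancelˡ ⟦ 0# ⟧ _ _
      (≡.trans (≡.sym (⟦⟧-+ 0# 0#)) (≡.trans (⟦⟧-cong (+-identityˡ 0#)) (≡.sym (ℤ.+-identityʳ _))))

  open AdditiveMap

  module _ {𝓡 : CommutativeRing c ℓ} where
    private
      module R = CommutativeRing 𝓡
      module P = RawRing (Polynomial R.rawRing)

    precompose : R.Carrier → AdditiveMap 𝓡 → AdditiveMap 𝓡
    precompose a ψ = record
      { ⟦_⟧     = λ b → ⟦ ψ ⟧ (a R.* b)
      ; ⟦⟧-cong = λ p → ⟦⟧-cong ψ (R.*-congˡ p)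
      ; ⟦⟧-+    = λ b d → ≡.trans (⟦⟧-cong ψ (R.distribˡ a b d)) (⟦⟧-+ ψ (a R.* b) (a R.* d))
      }

    -- The functional varies with the degree, so that multiplication by the variable becomes a shift
    -- of the family `Ψ`.
    coefficientSum : (ℕ → AdditiveMap 𝓡) → List R.Carrier → ℤ
    coefficientSum Ψ []      = + 0
    coefficientSum Ψ (a ∷ f) = ⟦ Ψ 0 ⟧ a ℤ.+ coefficientSum (λ i → Ψ (suc i)) f

    coefficientSum-≈[] : ∀ Ψ f → f P.≈ [] → coefficientSum Ψ f ≡ + 0
    coefficientSum-≈[] Ψ []      p = refl
    coefficientSum-≈[] Ψ (a ∷ f) p = cong₂ ℤ._+_ (≡.trans (⟦⟧-cong (Ψ 0) (p 0)) (⟦0#⟧ (Ψ 0)))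
      (coefficientSum-≈[] (λ i → Ψ (suc i)) f (λ i → p (suc i)))

    -- Representatives may differ by trailing zeros; additive maps send the surplus entries to 0.
    coefficientSum-cong : ∀ Ψ f g → f P.≈ g → coefficientSum Ψ f ≡ coefficientSum Ψ g
    coefficientSum-cong Ψ []      g       p = ≡.sym (coefficientSum-≈[] Ψ g (λ i → R.sym (p i)))
    coefficientSum-cong Ψ (a ∷ f) []      p = coefficientSum-≈[] Ψ (a ∷ f) p
    coefficientSum-cong Ψ (a ∷ f) (b ∷ g) p =
      cong₂ ℤ._+_ (⟦⟧-cong (Ψ 0) (p 0)) (coefficientSum-cong (λ i → Ψ (suc i)) f g (λ i → p (suc i)))

    coefficientSum-+ : ∀ Ψ f g → coefficientSum Ψ (f P.+ g) ≡ coefficientSum Ψ f ℤ.+ coefficientSum Ψ g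
    coefficientSum-+ Ψ []      g       = ≡.sym (ℤ.+-identityˡ _)
    coefficientSum-+ Ψ (a ∷ f) []      = ≡.sym (ℤ.+-identityʳ _)
    coefficientSum-+ Ψ (a ∷ f) (b ∷ g) = ≡.trans
      (cong₂ ℤ._+_ (⟦⟧-+ (Ψ 0) a b) (coefficientSum-+ (λ i → Ψ (suc i)) f g))
      (interchange (⟦ Ψ 0 ⟧ a) (⟦ Ψ 0 ⟧ b) _ _)

    coefficientSum-ext : ∀ Ψ Ψ′ → (∀ i a → ⟦ Ψ i ⟧ a ≡ ⟦ Ψ′ i ⟧ a) → ∀ f →
                         coefficientSum Ψ f ≡ coefficientSum Ψ′ f
    coefficientSum-ext Ψ Ψ′ eq []      = refl
    coefficientSum-ext Ψ Ψ′ eq (a ∷ f) =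
      cong₂ ℤ._+_ (eq 0 a) (coefficientSum-ext (λ i → Ψ (suc i)) (λ i → Ψ′ (suc i)) (λ i → eq (suc i)) f)

    coefficientSum-zero : ∀ Ψ → (∀ i a → ⟦ Ψ i ⟧ a ≡ + 0) → ∀ f → coefficientSum Ψ f ≡ + 0
    coefficientSum-zero Ψ eq []      = refl
    coefficientSum-zero Ψ eq (a ∷ f) = cong₂ ℤ._+_ (eq 0 a) (coefficientSum-zero (λ i → Ψ (suc i)) (λ i → eq (suc i)) f)

    coefficientSum-weight : ∀ Ψ Ψ₁ Ψ₂ → (∀ i a → ⟦ Ψ i ⟧ a ≡ ⟦ Ψ₁ i ⟧ a ℤ.+ ⟦ Ψ₂ i ⟧ a) → ∀ f →
      coefficientSum Ψ f ≡ coefficientSum Ψ₁ f ℤ.+ coefficientSum Ψ₂ f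
    coefficientSum-weight Ψ Ψ₁ Ψ₂ eq []      = refl
    coefficientSum-weight Ψ Ψ₁ Ψ₂ eq (a ∷ f) = ≡.trans
      (cong₂ ℤ._+_ (eq 0 a) (coefficientSum-weight (λ i → Ψ (suc i)) (λ i → Ψ₁ (suc i)) (λ i → Ψ₂ (suc i)) (λ i → eq (suc i)) f))
      (interchange (⟦ Ψ₁ 0 ⟧ a) (⟦ Ψ₂ 0 ⟧ a) _ _)

    coefficientSum-· : ∀ Ψ a f → coefficientSum Ψ (map (a R.*_) f) ≡ coefficientSum (λ i → precompose a (Ψ i)) f
    coefficientSum-· Ψ a []      = refl
    coefficientSum-· Ψ a (b ∷ f) = cong (λ z → ⟦ Ψ 0 ⟧ (a R.* b) ℤ.+ z) (coefficientSum-· (λ i → Ψ (suc i)) a f)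

    private
      0∷[] : ∀ Ψ → coefficientSum Ψ (R.0# ∷ []) ≡ + 0
      0∷[] Ψ = ≡.trans (ℤ.+-identityʳ _) (⟦0#⟧ (Ψ 0))

    coefficientSum-constant : ∀ Ψ a f → coefficientSum Ψ (constant R.rawRing a P.* f)
                                        ≡ coefficientSum (λ i → precompose a (Ψ i)) f
    coefficientSum-constant Ψ a f = ≡.trans (coefficientSum-+ Ψ (map (a R.*_) f) (R.0# ∷ []))
      (≡.trans (cong₂ ℤ._+_ (coefficientSum-· Ψ a f) (0∷[] Ψ)) (ℤ.+-identityʳ _))

    coefficientSum-X : ∀ Ψ f → coefficientSum Ψ (variable-X R.rawRing P.* f) ≡ coefficientSum (λ i → Ψ (suc i)) f
    coefficientSum-X Ψ f = ≡.trans (coefficientSum-+ Ψ (map (R.0# R.*_) f) (R.0# ∷ (P.1# P.* f)))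
      (≡.trans (cong₂ ℤ._+_
        (≡.trans (coefficientSum-· Ψ R.0# f) (coefficientSum-zero _
          (λ i a → ≡.trans (⟦⟧-cong (Ψ i) (R.zeroˡ a)) (⟦0#⟧ (Ψ i))) f))
        (cong₂ ℤ._+_ (⟦0#⟧ (Ψ 0)) (≡.trans (coefficientSum-constant Ψ′ R.1# f)
          (coefficientSum-ext _ Ψ′ (λ i a → ⟦⟧-cong (Ψ′ i) (R.*-identityˡ a)) f))))
      (≡.trans (ℤ.+-identityˡ _) (ℤ.+-identityˡ _)))
      where
      Ψ′ = λ i → Ψ (suc i)

    coefficientSumMap : (ℕ → AdditiveMap 𝓡) → AdditiveMap (polynomialRing 𝓡)
    coefficientSumMap Ψ = record
      { ⟦_⟧     = coefficientSum Ψ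
      ; ⟦⟧-cong = λ {f} {g} → coefficientSum-cong Ψ f g
      ; ⟦⟧-+    = coefficientSum-+ Ψ
      }

  weight : ℕ → AdditiveMap ℤ.+-*-commutativeRing
  weight w = record
    { ⟦_⟧     = λ a → a ℤ.* + w
    ; ⟦⟧-cong = cong (ℤ._* + w)
    ; ⟦⟧-+    = ℤ.*-distribʳ-+ (+ w)
    }

  inner : (ℕ → ℕ) → AdditiveMap ℤ[x]-ring
  inner F = coefficientSumMap (λ h → weight (F h))

  -- The outer variable is y: the coefficient of its `k`-th power lies in ℤ[x] and is paired with
  -- the column of `F` at `k`. Multiplication by x and y then shifts `F` in its two arguments.
  ℤ[x,y]-evaluations : Evaluations ℤ[x,y]-ring x₂ y₂
  ℤ[x,y]-evaluations = record
    { φ        = φ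
    ; φ-cong   = λ F {x} {y} → coefficientSum-cong (columns F) x y
    ; φ-+      = λ F → coefficientSum-+ (columns F)
    ; φ-1#     = λ F → ≡.trans (ℤ.+-identityʳ _) (≡.trans (ℤ.+-identityʳ _) (ℤ.*-identityˡ (+ F (0 , 0))))
    ; φ-u      = λ F f → ≡.trans (coefficientSum-constant (columns F) x₁ f)
                   (coefficientSum-ext _ (columns (λ g → F ((1 , 0) ⊹ g)))
                     (λ k a → coefficientSum-X (λ h → weight (F (h , k))) a) f)
    ; φ-v      = λ F f → coefficientSum-X (columns F) f
    ; φ-weight = λ F G → coefficientSum-weight _ (columns F) (columns G) λ k →
                   coefficientSum-weight _ (λ h → weight (F (h , k))) (λ h → weight (G (h , k))) λ h a →
                     ≡.trans (cong (a ℤ.*_) (ℤ.pos-+ (F (h , k)) (G (h , k)))) (ℤ.*-distribˡ-+ a _ _)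
    ; φ-zero   = coefficientSum-zero _ λ k → coefficientSum-zero _ λ h a → ℤ.*-zeroʳ a
    }
    where
    columns : (ℕ × ℕ → ℕ) → ℕ → AdditiveMap ℤ[x]-ring
    columns F k = inner (λ h → F (h , k))
    φ : (ℕ × ℕ → ℕ) → CommutativeRing.Carrier ℤ[x,y]-ring → ℤ
    φ F = coefficientSum (columns F)

  iterate-frobenius : ∀ {p} → Prime p → ∀ P F →
    Cong p (+ iterate p P F (0 , 0)) (+ ∑ P (λ a → F (scale p a)))
  iterate-frobenius = Evaluations.iterate-frobenius ℤ[x,y]-evaluations

-- Tilings as representation counts and Tijdeman's dilation theorem.

module Tiling where
  open ListSum
  open Congruence
  open Frobenius using (_⊹_; scale; translates; iterate)
  open Evaluation using (iterate-frobenius)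
  open import Data.Integer.Base as ℤ using (ℤ; +_)
  open import Data.Nat.Base as ℕ using (ℕ; zero; suc; NonZero; _≤_; _^_; z≤n; s≤s)
  open import Relation.Binary.PropositionalEquality

  prime∣^⇒∣ : ∀ {ℓ} → Prime ℓ → ∀ a k → ℓ ℕ.∣ a ^ k → ℓ ℕ.∣ a
  prime∣^⇒∣ pℓ a zero    ℓ∣ = ⊥-elim (¬prime[1] (subst Prime (ℕ.∣1⇒≡1 ℓ∣) pℓ))
  prime∣^⇒∣ pℓ a (suc k) ℓ∣ = [ (λ d → d) , prime∣^⇒∣ pℓ a k ]′ (euclidsLemma a (a ^ k) pℓ ℓ∣)

  coprime-^ : ∀ {n p} → Coprime n p → ∀ k → Coprime n (p ^ k)
  coprime-^ c zero    (_ , d∣1) = ℕ.∣1⇒≡1 d∣1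
  coprime-^ c (suc k) (d∣n , d∣p^) =
    coprime-^ c k (d∣n , coprime-divisor (λ (e∣d , e∣p) → c (ℕ.∣-trans e∣d d∣n , e∣p)) d∣p^)

  iterate-cong : ∀ m P {F G} → (∀ g → F g ≡ G g) → ∀ g → iterate m P F g ≡ iterate m P G g
  iterate-cong zero    P eq g = eq g
  iterate-cong (suc m) P eq g = iterate-cong m P (λ g → ∑-cong P λ a → eq (a ⊹ g)) g

  iterate-const : ∀ m P c g → iterate m P (λ _ → c) g ≡ length P ^ m ℕ.* c
  iterate-const zero    P c g = sym (ℕ.*-identityˡ c)
  iterate-const (suc m) P c g = begin
    iterate m P (λ _ → ∑ P (λ _ → c)) g  ≡⟨ iterate-const m P _ g ⟩
    length P ^ m ℕ.* ∑ P (λ _ → c)       ≡⟨ cong (length P ^ m ℕ.*_) (∑-const P c) ⟩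
    length P ^ m ℕ.* (length P ℕ.* c)    ≡⟨ ℕ.*-assoc (length P ^ m) (length P) c ⟨
    length P ^ m ℕ.* length P ℕ.* c      ≡⟨ cong (ℕ._* c) (ℕ.*-comm (length P ^ m) (length P)) ⟩
    length P ℕ.* length P ^ m ℕ.* c      ∎
    where open ≡-Reasoning

  pairCount : (ℕ × ℕ → ℕ × ℕ → ℕ) → List (ℕ × ℕ) → List (ℕ × ℕ) → ℕ
  pairCount f P Q = ∑ P (λ a → ∑ Q (f a))

  pairCount-cong : ∀ {f g} P Q → (∀ a b → f a b ≡ g a b) → pairCount f P Q ≡ pairCount g P Q
  pairCount-cong P Q eq = ∑-cong P λ a → ∑-cong Q (eq a)

  module _ (n N : ℕ) .{{_ : NonZero n}} .{{_ : NonZero N}} where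

    hits : ℤ → ℤ → ℕ × ℕ → ℕ × ℕ → ℕ
    hits h t (a , k) (b , l) = ind n (+ (a ℕ.+ b)) h ℕ.* ind N (+ (k ℕ.+ l)) t

    -- Formulated for lists, so that a dilate makes sense before its elements are known to be
    -- distinct modulo `n` and `N`.
    TilesList : List (ℕ × ℕ) → List (ℕ × ℕ) → Set
    TilesList P Q = ∀ h t → pairCount (hits h t) P Q ≡ 1

    ∑-hits : ∀ P Q → ∑ (upTo n) (λ h → ∑ (upTo N) (λ t → pairCount (hits (+ h) (+ t)) P Q))
                     ≡ length P ℕ.* length Q
    ∑-hits P Q = begin
      ∑ (upTo n) (λ h → ∑ (upTo N) (λ t → pairCount (hits (+ h) (+ t)) P Q))
        ≡⟨ ∑-cong (upTo n) (λ h → ∑-cong (upTo N) (λ t → sym (∑-cartesianProduct P Q _))) ⟩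
      ∑ (upTo n) (λ h → ∑ (upTo N) (λ t → ∑ PQ (λ (a , b) → hits (+ h) (+ t) a b)))
        ≡⟨ ∑-cong (upTo n) (λ h → ∑-swap (upTo N) PQ _) ⟩
      ∑ (upTo n) (λ h → ∑ PQ (λ (a , b) → ∑ (upTo N) (λ t → hits (+ h) (+ t) a b)))
        ≡⟨ ∑-swap (upTo n) PQ _ ⟩
      ∑ PQ (λ (a , b) → ∑ (upTo n) (λ h → ∑ (upTo N) (λ t → hits (+ h) (+ t) a b)))
        ≡⟨ ∑-cong PQ (λ ((a , k) , (b , l)) → trans
             (∑-cong (upTo n) λ h → trans (∑-*ˡ (upTo N) (ind n (+ (a ℕ.+ b)) (+ h)) _)
               (cong (ind n (+ (a ℕ.+ b)) (+ h) ℕ.*_) (∑-ind N (+ (k ℕ.+ l)))))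
             (∑-ind-* n (+ (a ℕ.+ b)) 1)) ⟩
      ∑ PQ (λ _ → 1)
        ≡⟨ ∑-cartesianProduct P Q (λ _ → 1) ⟩
      ∑ P (λ _ → ∑ Q (λ _ → 1))
        ≡⟨ ∑-const P _ ⟩
      length P ℕ.* ∑ Q (λ _ → 1)
        ≡⟨ cong (length P ℕ.*_) (trans (∑-const Q 1) (ℕ.*-identityʳ _)) ⟩
      length P ℕ.* length Q ∎
      where
      open ≡-Reasoning
      PQ = cartesianProduct P Q

    TilesList⇒size : ∀ P Q → TilesList P Q → length P ℕ.* length Q ≡ n ℕ.* N
    TilesList⇒size P Q T = trans (sym (∑-hits P Q))
      (trans (∑-cong (upTo n) λ h → trans (∑-cong (upTo N) λ t → T (+ h) (+ t))
                                          (trans (∑-upTo-const N 1) (ℕ.*-identityʳ N)))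
             (∑-upTo-const n N))

    hits-residue : ∀ P Q h t → pairCount (hits h t) P Q ≡ pairCount (hits (+ (h ℤ.%ℕ n)) (+ (t ℤ.%ℕ N))) P Q
    hits-residue P Q h t = pairCount-cong P Q λ (a , k) (b , l) → cong₂ ℕ._*_
      (ind-cong Cong-refl (Cong-% n h))
      (ind-cong Cong-refl (Cong-% N t))

    -- There are as many pairs as cells and each pair falls into one cell, so a covering has no
    -- multiplicities.
    covers⇒TilesList : ∀ P Q → length P ℕ.* length Q ≡ n ℕ.* N →
      (∀ h t → 1 ≤ pairCount (hits h t) P Q) → TilesList P Q
    covers⇒TilesList P Q size covers h t = trans (hits-residue P Q h t)
      (∑≡length⇒≡1 cells (λ (h , t) → pairCount (hits (+ h) (+ t)) P Q) (λ {(h , t)} _ → covers (+ h) (+ t)) cellSum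
        (∈-cartesianProduct⁺ (∈-upTo⁺ (ℤ.n%ℕd<d h n)) (∈-upTo⁺ (ℤ.n%ℕd<d t N))))
      where
      cells = cartesianProduct (upTo n) (upTo N)
      cellCount : ∑ cells (λ _ → 1) ≡ n ℕ.* N
      cellCount = trans (∑-cartesianProduct (upTo n) (upTo N) _)
        (trans (∑-cong (upTo n) λ _ → trans (∑-upTo-const N 1) (ℕ.*-identityʳ N)) (∑-upTo-const n N))
      cellSum : ∑ cells (λ (h , t) → pairCount (hits (+ h) (+ t)) P Q) ≡ length cells
      cellSum = trans (∑-cartesianProduct (upTo n) (upTo N) _) (trans (∑-hits P Q) (trans size
        (trans (sym cellCount) (trans (∑-const cells 1) (ℕ.*-identityʳ _)))))

    -- Tijdeman: in ℤ[G] the ℓ-th power of P is congruent mod ℓ to the dilate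
    -- ℓ P, so the number of representations by ℓ P and Q is ≡ |P|^(ℓ-1) ≢ 0.
    TilesList-scale-prime : ∀ {ℓ} P Q → Prime ℓ → ¬ ℓ ℕ.∣ length P → TilesList P Q →
                            TilesList (map (scale ℓ) P) Q
    TilesList-scale-prime {zero}  P Q pℓ = contradiction pℓ ¬prime[0]
    TilesList-scale-prime {ℓ@(suc ℓ′)} P Q pℓ ℓ∤P T =
      covers⇒TilesList (map (scale ℓ) P) Q (trans (cong (ℕ._* length Q) (length-map (scale ℓ) P)) (TilesList⇒size P Q T)) covers
      where
      F : ℤ → ℤ → ℕ × ℕ → ℕ
      F h t a = ∑ Q (hits h t a)

      -- One of the `ℓ` factors P is absorbed by Q, since a translated point again has exactly one
      -- representation. The other `ℓ - 1` factors contribute `length P` each.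
      translate-one : ∀ h t g → translates P (F h t) g ≡ 1
      translate-one h t g@(x , y) = trans
        (pairCount-cong P Q λ (a , k) (b , l) → cong₂ ℕ._*_
          (ind-shift (ring (+ a) (+ x) (+ b) h)) (ind-shift (ring (+ k) (+ y) (+ l) t)))
        (T (h ℤ.- + x) (t ℤ.- + y))
        where
        ring : ∀ a x b h → a ℤ.+ x ℤ.+ b ℤ.- h ≡ a ℤ.+ b ℤ.- (h ℤ.- x)
        ring = solve-∀

      iterated : ∀ h t → iterate ℓ P (F h t) (0 , 0) ≡ length P ^ ℓ′
      iterated h t = trans (iterate-cong ℓ′ P (translate-one h t) (0 , 0))
        (trans (iterate-const ℓ′ P 1 (0 , 0)) (ℕ.*-identityʳ _))

      covers : ∀ h t → 1 ≤ pairCount (hits h t) (map (scale ℓ) P) Q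
      covers h t with pairCount (hits h t) (map (scale ℓ) P) Q in eq
      ... | suc _ = s≤s z≤n
      ... | zero  = contradiction (prime∣^⇒∣ pℓ (length P) ℓ′ (Cong0⇒∣ (subst₂ (λ x y → Cong ℓ (+ x) (+ y))
              (iterated h t) (trans (sym (∑-map (scale ℓ) P (F h t))) eq) (iterate-frobenius pℓ P (F h t))))) ℓ∤P

    -- Dilation keeps the length, so the condition on each prime survives the other dilations.
    TilesList-scale : ∀ P Q ℓs → All Prime ℓs → All (λ ℓ → ¬ ℓ ℕ.∣ length P) ℓs → TilesList P Q →
                      TilesList (map (scale (product ℓs)) P) Q
    TilesList-scale P Q []       []         []         T = subst (λ P → TilesList P Q)
      (sym (trans (map-cong (λ (h , k) → cong₂ _,_ (ℕ.*-identityˡ h) (ℕ.*-identityˡ k)) P) (map-id P))) T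
    TilesList-scale P Q (ℓ ∷ ℓs) (pℓ ∷ pℓs) (ℓ∤ ∷ ℓs∤) T = subst (λ P → TilesList P Q)
      (trans (sym (map-∘ {g = scale ℓ} {f = scale (product ℓs)} P)) (map-cong
        (λ (h , k) → cong₂ _,_ (sym (ℕ.*-assoc ℓ (product ℓs) h)) (sym (ℕ.*-assoc ℓ (product ℓs) k))) P))
      (TilesList-scale-prime (map (scale (product ℓs)) P) Q pℓ (subst (λ s → ¬ ℓ ℕ.∣ s) (sym (length-map (scale (product ℓs)) P)) ℓ∤)
        (TilesList-scale P Q ℓs pℓs ℓs∤ T))

  module _ {p} (pp : Prime p) (n K : ℕ) .{{_ : NonZero n}} .{{_ : NonZero (p ^ suc K)}} (n⊥p : Coprime n p)
    (P Q : List (ℕ × ℕ)) (T : TilesList n (p ^ suc K) P Q)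
    where
    private
      N = p ^ suc K

    -- The dilation by c in the second coordinate alone is the dilation by an
    -- integer m with m ≡ 1 (mod n) and m ≡ c (mod N).
    TilesList-slope : ∀ c → ¬ p ℕ.∣ c → ∀ h t →
      pairCount (λ (a , k) (b , l) → ind n (+ (a ℕ.+ b)) h ℕ.* ind N (+ c ℤ.* + k ℤ.+ + l) t) P Q ≡ 1
    TilesList-slope c p∤c h t = begin
      pairCount (λ (a , k) (b , l) → ind n (+ (a ℕ.+ b)) h ℕ.* ind N (+ c ℤ.* + k ℤ.+ + l) t) P Q
        ≡⟨ pairCount-cong P Q (λ (a , k) (b , l) → cong₂ ℕ._*_
             (ind-cong (Cong-sym (dilate₁ a b)) Cong-refl) (ind-cong (Cong-sym (dilate₂ k l)) Cong-refl)) ⟩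
      pairCount (λ a b → hits n N h t (scale m a) b) P Q
        ≡⟨ ∑-map (scale m) P _ ⟨
      pairCount (hits n N h t) (map (scale m) P) Q
        ≡⟨ cong (λ m → pairCount (hits n N h t) (map (scale m) P) Q) isFactorisation ⟩
      pairCount (hits n N h t) (map (scale (product factors)) P) Q
        ≡⟨ TilesList-scale n N P Q factors factorsPrime (coprimes factors (λ _ → subst (_ ℕ.∣_) (sym isFactorisation)) factorsPrime) T h t ⟩
      1 ∎
      where
      open ≡-Reasoning
      inverse : ∃ λ x → Cong N (x ℤ.* + n) (+ 1)
      inverse = coprime⇒inverse (coprime-^ n⊥p (suc K))
      x = proj₁ inverse
      -- Since `x` inverts `n` modulo `N`, `1 + z n ≡ c`. Passing to the residue `r` keeps this and
      -- makes `m` a positive integer, which can be factorised.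
      z = (+ c ℤ.- + 1) ℤ.* x
      r = z ℤ.%ℕ N
      m = suc (r ℕ.* n)
      open PrimeFactorisation (factorise m)

      pos-m : + m ≡ + 1 ℤ.+ + r ℤ.* + n
      pos-m = cong (λ w → + 1 ℤ.+ w) (ℤ.pos-* r n)

      m≡1 : Cong n (+ m) (+ 1)
      m≡1 = cong-by (+ r) pos-m

      m≡c : Cong N (+ m) (+ c)
      m≡c = Cong-trans (≡⇒Cong pos-m) (Cong-trans
        (Cong-+ (Cong-refl {a = + 1}) (Cong-*ʳ (+ n) (Cong-sym (Cong-% N z))))
        (Cong-trans (≡⇒Cong (ring₁ (+ c) x (+ n)))
          (Cong-trans (Cong-+ (Cong-refl {a = + 1}) (Cong-*ˡ (+ c ℤ.- + 1) (proj₂ inverse))) (≡⇒Cong (ring₂ (+ c))))))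
        where
        ring₁ : ∀ c x n → + 1 ℤ.+ (c ℤ.- + 1) ℤ.* x ℤ.* n ≡ + 1 ℤ.+ (c ℤ.- + 1) ℤ.* (x ℤ.* n)
        ring₁ = solve-∀
        ring₂ : ∀ c → + 1 ℤ.+ (c ℤ.- + 1) ℤ.* + 1 ≡ c
        ring₂ = solve-∀

      dilate₁ : ∀ a b → Cong n (+ (m ℕ.* a ℕ.+ b)) (+ (a ℕ.+ b))
      dilate₁ a b = Cong-+ {c = + b} (Cong-trans (≡⇒Cong (ℤ.pos-* m a))
        (Cong-trans (Cong-*ʳ (+ a) m≡1) (≡⇒Cong (ℤ.*-identityˡ (+ a))))) Cong-refl

      dilate₂ : ∀ k l → Cong N (+ (m ℕ.* k ℕ.+ l)) (+ c ℤ.* + k ℤ.+ + l)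
      dilate₂ k l = Cong-+ {c = + l} (Cong-trans (≡⇒Cong (ℤ.pos-* m k)) (Cong-*ʳ (+ k) m≡c)) Cong-refl

      -- A common prime would divide `n N`. Dividing `n` is excluded by `m ≡ 1` modulo `n`, and
      -- being `p` is excluded by `m ≡ c` modulo `p`.
      prime∣m⇒∤P : ∀ {ℓ} → Prime ℓ → ℓ ℕ.∣ m → ¬ ℓ ℕ.∣ length P
      prime∣m⇒∤P {ℓ} pℓ ℓ∣m ℓ∣P = [ ℓ∤n , (λ ℓ∣N → ℓ∤p (prime∣^⇒∣ pℓ p (suc K) ℓ∣N)) ]′
        (euclidsLemma n N pℓ (subst (ℓ ℕ.∣_) (TilesList⇒size n N P Q T) (ℕ.∣m⇒∣m*n (length Q) ℓ∣P)))
        where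
        ℓ∤n : ¬ ℓ ℕ.∣ n
        ℓ∤n ℓ∣n = ¬prime[1] (subst Prime (ℕ.∣1⇒≡1 (ℕ.∣m+n∣m⇒∣n
          (subst (ℓ ℕ.∣_) (ℕ.+-comm 1 (r ℕ.* n)) ℓ∣m) (ℕ.∣n⇒∣m*n r ℓ∣n))) pℓ)
        ℓ∤p : ¬ ℓ ℕ.∣ p
        ℓ∤p ℓ∣p with prime⇒irreducible pp ℓ∣p
        ... | inj₁ refl = ¬prime[1] pℓ
        ... | inj₂ refl = p∤c (Cong0⇒∣ (Cong-trans (Cong-sym (Cong-coarsen (p ^ K)
                (subst (λ M → Cong M (+ m) (+ c)) (ℕ.*-comm p (p ^ K)) m≡c))) (∣⇒Cong0 ℓ∣m)))

      coprimes : ∀ ℓs → (∀ {ℓ} → Prime ℓ → ℓ ℕ.∣ product ℓs → ℓ ℕ.∣ m) → All Prime ℓs →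
                 All (λ ℓ → ¬ ℓ ℕ.∣ length P) ℓs
      coprimes []       _  []         = []
      coprimes (ℓ ∷ ℓs) ∣m (pℓ ∷ pℓs) = prime∣m⇒∤P pℓ (∣m pℓ (ℕ.m∣m*n (product ℓs)))
        ∷ coprimes ℓs (λ pℓ′ ℓ′∣ → ∣m pℓ′ (ℕ.∣n⇒∣m*n ℓ ℓ′∣)) pℓs

-- The counts U and R as functions on ℤ_n.

module Columns where
  open ListSum
  open Congruence
  open Frobenius using (_⊹_; scale; translates; iterate)
  open Evaluation using (iterate-frobenius)
  open Tiling
  open Slopes
  open import Data.Integer.Base as ℤ using (ℤ; +_)
  open import Data.Nat.Base as ℕ using (ℕ; zero; suc; NonZero; _≤_; _<_; _^_; z≤n; s≤s)
  open import Relation.Binary.PropositionalEquality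

  ∣-∑ : ∀ {a} {A : Set a} {m} (xs : List A) {f : A → ℕ} → (∀ x → m ℕ.∣ f x) → m ℕ.∣ ∑ xs f
  ∣-∑ []       d = _ ℕ.∣0
  ∣-∑ (x ∷ xs) d = ℕ.∣m∣n⇒∣m+n (d x) (∣-∑ xs d)

  ∣-iterate : ∀ {d} m P {F} → (∀ g → d ℕ.∣ F g) → ∀ g → d ℕ.∣ iterate m P F g
  ∣-iterate zero    P d∣F g = d∣F g
  ∣-iterate (suc m) P d∣F g = ∣-iterate m P (λ g → ∣-∑ P λ a → d∣F (a ⊹ g)) g

  -- `x + pred m` represents `x - 1` modulo `m`; at `x = 0` it lies strictly between 0 and `m`.
  ∣+pred⇒≥1 : ∀ {m} → 1 < m → ∀ x → m ℕ.∣ x ℕ.+ ℕ.pred m → 1 ≤ x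
  ∣+pred⇒≥1 1<m (suc x) m∣ = s≤s z≤n
  ∣+pred⇒≥1 {suc (suc m)} 1<m zero m∣ = contradiction m∣ (ℕ.>⇒∤ (ℕ.n<1+n (suc m)))
  ∣+pred⇒≥1 {suc zero} (s≤s ()) zero m∣

  -- 𝔽_p[ℤ_n] is reduced when p ∤ n: Frobenius followed by division by p is the
  -- identity, so an element of square zero vanishes.
  convolution-square-zero : ∀ {p} → Prime p → ∀ n .{{_ : NonZero n}} → Coprime n p →
    (d : ℤ → ℕ) → Respects n d →
    (∀ g → p ℕ.∣ ∑ (upTo n) (λ h → d (+ h) ℕ.* d (g ℤ.- + h))) →
    ∀ x → p ℕ.∣ d x
  convolution-square-zero {zero}        pp = contradiction pp ¬prime[0]
  convolution-square-zero {suc zero}    pp = contradiction pp ¬prime[1]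
  convolution-square-zero {p@(suc (suc p″))} pp n n⊥p d resp square x =
    Cong0⇒∣ (Cong-trans (subst (λ y → Cong p (+ y) (+ iterate p D F (0 , 0))) dilated (Cong-sym (iterate-frobenius pp D F)))
                        (∣⇒Cong0 (∣-iterate p″ D squared (0 , 0))))
    where
    -- The polynomial in x with coefficients `d`, each exponent listed with its multiplicity.
    D = concatMap (λ h → replicate (d (+ h)) (h , 0)) (upTo n)

    ∑-D : ∀ f → ∑ D f ≡ ∑ (upTo n) (λ h → d (+ h) ℕ.* f (h , 0))
    ∑-D f = trans (∑-concatMap _ (upTo n) f) (∑-cong (upTo n) λ h → ∑-replicate (d (+ h)) (h , 0) f)

    -- Selects the exponents congruent to `p x`. After dilation by `p` these come from `h ≡ x`,
    -- since `p` is invertible modulo `n`.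
    F : ℕ × ℕ → ℕ
    F (h , _) = ind n (+ h) (+ p ℤ.* x)

    -- Two of the `p` factors already give multiples of `p`; the remaining `p″ = p - 2` only form
    -- sums of translates of these.
    squared : ∀ g → p ℕ.∣ translates D (translates D F) g
    squared (g , k) = subst (p ℕ.∣_) (sym (trans (∑-D _) (∑-cong (upTo n) inner))) (square (+ p ℤ.* x ℤ.- + g))
      where
      ring : ∀ h h′ g y → h′ ℤ.+ (h ℤ.+ g) ℤ.- y ≡ h′ ℤ.- (y ℤ.- g ℤ.- h)
      ring = solve-∀
      inner : ∀ h → d (+ h) ℕ.* translates D F ((h , 0) ⊹ (g , k)) ≡ d (+ h) ℕ.* d (+ p ℤ.* x ℤ.- + g ℤ.- + h)
      inner h = cong (d (+ h) ℕ.*_) (trans (∑-D _) (trans (∑-cong (upTo n) λ h′ → trans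
        (ℕ.*-comm (d (+ h′)) _)
        (cong (ℕ._* d (+ h′)) (trans (ind-shift (ring (+ h) (+ h′) (+ g) (+ p ℤ.* x)))
           (ind-⇔ Cong-sym Cong-sym))))
        (∑-ind-value n (+ p ℤ.* x ℤ.- + g ℤ.- + h) resp)))

    dilated : ∑ D (λ a → F (scale p a)) ≡ d x
    dilated = trans (∑-D _) (trans (∑-cong (upTo n) λ h → trans (ℕ.*-comm (d (+ h)) _)
      (cong (ℕ._* d (+ h)) (ind-⇔ (from h) (to h)))) (∑-ind-value n x resp))
      where
      inverse = coprime⇒inverse {p} {n} (Coprime.sym n⊥p)
      e = proj₁ inverse
      from : ∀ h → Cong n (+ (p ℕ.* h)) (+ p ℤ.* x) → Cong n x (+ h)
      from h c = Cong-sym (Cong-trans (cancel (+ h)) (Cong-trans (Cong-*ˡ e (Cong-trans (≡⇒Cong (sym (ℤ.pos-* p h))) c)) (Cong-sym (cancel x))))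
        where
        cancel : ∀ z → Cong n z (e ℤ.* (+ p ℤ.* z))
        cancel z = Cong-sym (Cong-trans (≡⇒Cong (sym (ℤ.*-assoc e (+ p) z)))
          (Cong-trans (Cong-*ʳ z (proj₂ inverse)) (≡⇒Cong (ℤ.*-identityˡ z))))
      to : ∀ h → Cong n x (+ h) → Cong n (+ (p ℕ.* h)) (+ p ℤ.* x)
      to h c = Cong-trans (≡⇒Cong (ℤ.pos-* p h)) (Cong-*ˡ (+ p) (Cong-sym c))

  module _ {p} (pp : Prime p) (n K : ℕ) .{{_ : NonZero n}} .{{_ : NonZero (p ^ suc K)}} (n⊥p : Coprime n p)
    (P Q : List (ℕ × ℕ)) (T : TilesList n (p ^ suc K) P Q)
    where

    private
      L = p ^ K
      N = p ^ suc K
      instance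
        p≢0 = prime⇒nonZero pp
        L≢0 = ℕ.m^n≢0 p K

    -- This realises `μ` for the slope argument. The first coordinates are used up by the selection,
    -- so the tilings by all dilates become uniformity statements about this one list.
    pairsAt : ℤ → List (ℤ × ℤ)
    pairsAt h = concatMap (λ (a , k) → concatMap (λ (b , l) →
      if does (cong? n (+ (a ℕ.+ b)) h) then (+ k , + l) ∷ [] else []) Q) P

    ∑-pairsAt : ∀ h f → ∑ (pairsAt h) f
      ≡ pairCount (λ (a , k) (b , l) → ind n (+ (a ℕ.+ b)) h ℕ.* f (+ k , + l)) P Q
    ∑-pairsAt h f = trans (∑-concatMap _ P f) (∑-cong P λ (a , k) →
      trans (∑-concatMap _ Q f) (∑-cong Q λ (b , l) → single (+ (a ℕ.+ b)) (+ k , + l)))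
      where
      single : ∀ z kl → ∑ (if does (cong? n z h) then kl ∷ [] else []) f ≡ ind n z h ℕ.* f kl
      single z kl with cong? n z h
      ... | yes _ = refl
      ... | no _  = refl

    uniform : ∀ h c → ¬ p ℕ.∣ c → ∀ t → ∑ (pairsAt h) (λ (k , l) → ind N (+ c ℤ.* k ℤ.+ l) t) ≡ 1
    uniform h c p∤c t = trans (∑-pairsAt h _) (TilesList-slope pp n K n⊥p P Q T c p∤c h t)

    module Slice (h : ℤ) = PairClasses pp K (pairsAt h) (uniform h)

    -- V h r q is the number of (a , b) ∈ E_r × C_q with a + b = (h , j); it is the
    -- same for all j.  U and R are its sums over r and over q.
    V : ℤ → ℕ → ℤ → ℕ
    V h r q = Slice.classCount h r q

    U : ℤ → ℤ → ℕ
    U h q = Slice.columnSum h q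

    R : ℤ → ℕ → ℕ
    R h r = Slice.rowSum h r

    R+U : ∀ h {r} → r < p → ∀ q → R h r ℕ.+ U h q ≡ 1 ℕ.+ p ℕ.* V h r q
    R+U h = Slice.rowSum+columnSum h

    -- The factor `L` replaces the condition modulo `N` by separate conditions on `k` and `l` modulo
    -- `p`, the form that factorises after summation over `h`.
    L*V : ∀ h {r} → r < p → ∀ q → L ℕ.* V h r q ≡
      pairCount (λ (a , k) (b , l) → ind n (+ (a ℕ.+ b)) h ℕ.* (ind p (+ k) (+ r) ℕ.* ind p (+ l) q)) P Q
    L*V h r<p q = trans (Slice.classCount-pairs h r<p q) (∑-pairsAt h _)

    L*U : ∀ h q → L ℕ.* U h q ≡
      pairCount (λ (a , k) (b , l) → ind n (+ (a ℕ.+ b)) h ℕ.* ind p (+ l) q) P Q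
    L*U h q = begin
      L ℕ.* U h q
        ≡⟨ sym (∑-*ˡ (upTo p) L _) ⟩
      ∑ (upTo p) (λ r → L ℕ.* V h r q)
        ≡⟨ ∑-cong-∈ (upTo p) (λ r∈ → Slice.classCount-pairs h (∈-upTo⁻ r∈) q) ⟩
      ∑ (upTo p) (λ r → ∑ (pairsAt h) (λ (k , l) → ind p k (+ r) ℕ.* ind p l q))
        ≡⟨ ∑-swap (upTo p) (pairsAt h) _ ⟩
      ∑ (pairsAt h) (λ (k , l) → ∑ (upTo p) (λ r → ind p k (+ r) ℕ.* ind p l q))
        ≡⟨ ∑-cong (pairsAt h) (λ (k , l) → ∑-ind-* p k (ind p l q)) ⟩
      ∑ (pairsAt h) (λ (k , l) → ind p l q)
        ≡⟨ ∑-pairsAt h _ ⟩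
      pairCount (λ (a , k) (b , l) → ind n (+ (a ℕ.+ b)) h ℕ.* ind p (+ l) q) P Q ∎
      where open ≡-Reasoning

    L*R : ∀ h {r} → r < p → L ℕ.* R h r ≡
      pairCount (λ (a , k) (b , l) → ind n (+ (a ℕ.+ b)) h ℕ.* ind p (+ k) (+ r)) P Q
    L*R h {r} r<p = begin
      L ℕ.* R h r
        ≡⟨ sym (∑-*ˡ (upTo p) L _) ⟩
      ∑ (upTo p) (λ q → L ℕ.* V h r (+ q))
        ≡⟨ ∑-cong (upTo p) (λ q → Slice.classCount-pairs h r<p (+ q)) ⟩
      ∑ (upTo p) (λ q → ∑ (pairsAt h) (λ (k , l) → ind p k (+ r) ℕ.* ind p l (+ q)))
        ≡⟨ ∑-swap (upTo p) (pairsAt h) _ ⟩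
      ∑ (pairsAt h) (λ (k , l) → ∑ (upTo p) (λ q → ind p k (+ r) ℕ.* ind p l (+ q)))
        ≡⟨ ∑-cong (pairsAt h) (λ (k , l) → trans (∑-*ˡ (upTo p) (ind p k (+ r)) _)
             (trans (cong (ind p k (+ r) ℕ.*_) (∑-ind p l)) (ℕ.*-identityʳ _))) ⟩
      ∑ (pairsAt h) (λ (k , l) → ind p k (+ r))
        ≡⟨ ∑-pairsAt h _ ⟩
      pairCount (λ (a , k) (b , l) → ind n (+ (a ℕ.+ b)) h ℕ.* ind p (+ k) (+ r)) P Q ∎
      where open ≡-Reasoning

    pairCount-respects : ∀ (f : ℕ × ℕ → ℕ × ℕ → ℕ) →
      Respects n (λ h → pairCount (λ a b → ind n (+ (proj₁ a ℕ.+ proj₁ b)) h ℕ.* f a b) P Q)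
    pairCount-respects f c = pairCount-cong P Q λ a b → cong (ℕ._* f a b) (ind-cong Cong-refl c)

    U-respects : ∀ q → Respects n (λ h → U h q)
    U-respects q {x} {y} c = ℕ.*-cancelˡ-≡ _ _ L
      (trans (L*U x q) (trans (pairCount-respects (λ _ (b , l) → ind p (+ l) q) c) (sym (L*U y q))))

    R-respects : ∀ {r} → r < p → Respects n (λ h → R h r)
    R-respects {r} r<p {x} {y} c = ℕ.*-cancelˡ-≡ _ _ L
      (trans (L*R x r<p) (trans (pairCount-respects (λ (a , k) _ → ind p (+ k) (+ r)) c) (sym (L*R y r<p))))

    ∑-pairCount : ∀ (f : ℕ × ℕ → ℕ × ℕ → ℕ) →
      ∑ (upTo n) (λ h → pairCount (λ a b → ind n (+ (proj₁ a ℕ.+ proj₁ b)) (+ h) ℕ.* f a b) P Q)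
      ≡ pairCount f P Q
    ∑-pairCount f = trans (∑-swap (upTo n) P _) (∑-cong P λ a → trans (∑-swap (upTo n) Q _)
      (∑-cong Q λ b → ∑-ind-* n (+ (proj₁ a ℕ.+ proj₁ b)) (f a b)))

    Pclass Qclass : ℤ → ℕ
    Pclass r = ∑ P (λ (a , k) → ind p (+ k) r)
    Qclass q = ∑ Q (λ (b , l) → ind p (+ l) q)

    L*∑V : ∀ {r} → r < p → ∀ q → L ℕ.* ∑ (upTo n) (λ h → V (+ h) r q) ≡ Pclass (+ r) ℕ.* Qclass q
    L*∑V {r} r<p q = trans (sym (∑-*ˡ (upTo n) L _)) (trans (∑-cong (upTo n) λ h → L*V (+ h) r<p q)
      (trans (∑-pairCount _) (sym (∑-*-∑ P Q _ _))))

    L*∑U : ∀ q → L ℕ.* ∑ (upTo n) (λ h → U (+ h) q) ≡ length P ℕ.* Qclass q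
    L*∑U q = trans (sym (∑-*ˡ (upTo n) L _)) (trans (∑-cong (upTo n) λ h → L*U (+ h) q)
      (trans (∑-pairCount (λ _ (b , l) → ind p (+ l) q)) (∑-const P _)))

    L*∑R : ∀ {r} → r < p → L ℕ.* ∑ (upTo n) (λ h → R (+ h) r) ≡ Pclass (+ r) ℕ.* length Q
    L*∑R {r} r<p = trans (sym (∑-*ˡ (upTo n) L _)) (trans (∑-cong (upTo n) λ h → L*R (+ h) r<p)
      (trans (∑-pairCount (λ (a , k) _ → ind p (+ k) (+ r)))
        (trans (∑-cong P λ (a , k) → trans (∑-const Q _) (ℕ.*-comm (length Q) _)) (∑-*ʳ P (length Q) _))))

    -- By the tiling, a given first coordinate is reached by one pair for each of the `N` second
    -- coordinates. The translation `z` stands for elements that are held fixed in the application.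
    firstCount : ∀ z g → pairCount (λ (a , k) (b , l) → ind n (+ a ℤ.+ + b ℤ.+ z) g) P Q ≡ N
    firstCount z g = begin
      pairCount (λ (a , k) (b , l) → ind n (+ a ℤ.+ + b ℤ.+ z) g) P Q
        ≡⟨ pairCount-cong P Q (λ (a , k) (b , l) → trans
             (ind-shift (ring (+ a) (+ b) z g))
             (trans (sym (ℕ.*-identityʳ _)) (trans
               (cong (ind n (+ (a ℕ.+ b)) (g ℤ.- z) ℕ.*_) (sym (∑-ind N (+ (k ℕ.+ l)))))
               (sym (∑-*ˡ (upTo N) (ind n (+ (a ℕ.+ b)) (g ℤ.- z)) _))))) ⟩
      pairCount (λ a b → ∑ (upTo N) (λ t → hits n N (g ℤ.- z) (+ t) a b)) P Q
        ≡⟨ ∑-cong P (λ a → ∑-swap Q (upTo N) _) ⟩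
      ∑ P (λ a → ∑ (upTo N) (λ t → ∑ Q (hits n N (g ℤ.- z) (+ t) a)))
        ≡⟨ ∑-swap P (upTo N) _ ⟩
      ∑ (upTo N) (λ t → pairCount (hits n N (g ℤ.- z) (+ t)) P Q)
        ≡⟨ ∑-cong (upTo N) (λ t → T (g ℤ.- z) (+ t)) ⟩
      ∑ (upTo N) (λ _ → 1)
        ≡⟨ trans (∑-upTo-const N 1) (ℕ.*-identityʳ N) ⟩
      N ∎
      where
      open ≡-Reasoning
      ring : ∀ a b z g → a ℤ.+ b ℤ.+ z ℤ.- g ≡ a ℤ.+ b ℤ.- (g ℤ.- z)
      ring = solve-∀

    ind-convolution : ∀ x y g → ∑ (upTo n) (λ h → ind n x (+ h) ℕ.* ind n y (g ℤ.- + h)) ≡ ind n (x ℤ.+ y) g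
    ind-convolution x y g = trans (∑-ind-value n x (λ c → ind-cong Cong-refl (Cong-- (Cong-refl {a = g}) c)))
      (ind-shift (ring x y g))
      where
      ring : ∀ x y g → y ℤ.- (g ℤ.- x) ≡ x ℤ.+ y ℤ.- g
      ring = solve-∀

    -- P(x,1) C_q(x,1) · E_r(x,1) Q(x,1) = (P Q)(x,1) · E_r(x,1) C_q(x,1).
    L²*convolution : ∀ {r} → r < p → ∀ q g →
      L ℕ.* L ℕ.* ∑ (upTo n) (λ h → U (+ h) q ℕ.* R (g ℤ.- + h) r) ≡ Qclass q ℕ.* (Pclass (+ r) ℕ.* N)
    L²*convolution {r} r<p q g = begin
      L ℕ.* L ℕ.* ∑ (upTo n) (λ h → U (+ h) q ℕ.* R (g ℤ.- + h) r)
        ≡⟨ sym (∑-*ˡ (upTo n) (L ℕ.* L) _) ⟩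
      ∑ (upTo n) (λ h → L ℕ.* L ℕ.* (U (+ h) q ℕ.* R (g ℤ.- + h) r))
        ≡⟨ ∑-cong (upTo n) (λ h → trans (ℕ.[m*n]*[o*p]≡[m*o]*[n*p] L L (U (+ h) q) _)
             (trans (cong₂ ℕ._*_ (L*U (+ h) q) (L*R (g ℤ.- + h) r<p)) (∑-*-∑ P P _ _))) ⟩
      ∑ (upTo n) (λ h → ∑ P (λ a → ∑ P (λ a′ →
        ∑ Q (λ b → ind n (x a b) (+ h) ℕ.* β b) ℕ.* ∑ Q (λ b′ → ind n (x a′ b′) (g ℤ.- + h) ℕ.* α a′))))
        ≡⟨ ∑-cong (upTo n) (λ h → ∑-cong P λ a → ∑-cong P λ a′ → ∑-*-∑ Q Q _ _) ⟩
      ∑ (upTo n) (λ h → ∑ P (λ a → ∑ P (λ a′ → ∑ Q (λ b → ∑ Q (λ b′ →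
        ind n (x a b) (+ h) ℕ.* β b ℕ.* (ind n (x a′ b′) (g ℤ.- + h) ℕ.* α a′))))))
        ≡⟨ trans (∑-swap (upTo n) P _) (∑-cong P λ a → trans (∑-swap (upTo n) P _) (∑-cong P λ a′ →
             trans (∑-swap (upTo n) Q _) (∑-cong Q λ b → trans (∑-swap (upTo n) Q _) (∑-cong Q λ b′ →
               trans (∑-cong (upTo n) λ h → shuffle (ind n (x a b) (+ h)) (β b) (ind n (x a′ b′) (g ℤ.- + h)) (α a′))
               (trans (∑-*ˡ (upTo n) (β b ℕ.* α a′) _)
                 (cong (β b ℕ.* α a′ ℕ.*_) (trans (ind-convolution (x a b) (x a′ b′) g)
                   (ind-shift (ring (+ proj₁ a) (+ proj₁ b) (+ proj₁ a′) (+ proj₁ b′) g))))))))) ⟩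
      ∑ P (λ a → ∑ P (λ a′ → ∑ Q (λ b → ∑ Q (λ b′ →
        β b ℕ.* α a′ ℕ.* ind n (+ proj₁ a ℤ.+ + proj₁ b′ ℤ.+ (+ proj₁ a′ ℤ.+ + proj₁ b)) g))))
        -- Grouping as `(a , b′)` and `(a′ , b)` frees the first pair from class conditions, so its
        -- sum is `N`.
        ≡⟨ trans (∑-swap P P _) (∑-cong P λ a′ → trans (∑-swap P Q _) (∑-cong Q λ b →
             trans (∑-cong P λ a → ∑-*ˡ Q (β b ℕ.* α a′) _) (trans (∑-*ˡ P (β b ℕ.* α a′) _)
               (cong (β b ℕ.* α a′ ℕ.*_) (firstCount (+ proj₁ a′ ℤ.+ + proj₁ b) g))))) ⟩
      ∑ P (λ a′ → ∑ Q (λ b → β b ℕ.* α a′ ℕ.* N))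
        ≡⟨ ∑-swap P Q _ ⟩
      ∑ Q (λ b → ∑ P (λ a′ → β b ℕ.* α a′ ℕ.* N))
        ≡⟨ ∑-cong Q (λ b → ∑-cong P λ a′ → ℕ.*-assoc (β b) (α a′) N) ⟩
      ∑ Q (λ b → ∑ P (λ a′ → β b ℕ.* (α a′ ℕ.* N)))
        ≡⟨ sym (∑-*-∑ Q P β (λ a′ → α a′ ℕ.* N)) ⟩
      Qclass q ℕ.* ∑ P (λ a′ → α a′ ℕ.* N)
        ≡⟨ cong (Qclass q ℕ.*_) (∑-*ʳ P N α) ⟩
      Qclass q ℕ.* (Pclass (+ r) ℕ.* N) ∎
      where
      open ≡-Reasoning
      x : ℕ × ℕ → ℕ × ℕ → ℤ
      x a b = + (proj₁ a ℕ.+ proj₁ b)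
      α β : ℕ × ℕ → ℕ
      α (a , k) = ind p (+ k) (+ r)
      β (b , l) = ind p (+ l) q
      shuffle : ∀ i b j a → i ℕ.* b ℕ.* (j ℕ.* a) ≡ b ℕ.* a ℕ.* (i ℕ.* j)
      shuffle = solveℕ-∀
      ring : ∀ a b a′ b′ g → a ℤ.+ b ℤ.+ (a′ ℤ.+ b′) ℤ.- g ≡ a ℤ.+ b′ ℤ.+ (a′ ℤ.+ b) ℤ.- g
      ring = solve-∀

    U-total : ∀ h → ∑ (upTo p) (λ q → U h (+ q)) ≡ p
    U-total h = Slice.∑-columnSum h

    module _ (equidistributed : ∀ {q} → q < p → ∑ (upTo n) (λ h → U (+ h) (+ q)) ≡ n) where

      -- Equidistribution means |P| |Q_q| = L n, which turns the right side of `L²*convolution` into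
      -- L² times the sum of `R`. Hence U_q and the all-ones function have the same convolution with
      -- R_r.
      convolution : ∀ {r} → r < p → ∀ {q} → q < p → ∀ g →
        ∑ (upTo n) (λ h → U (+ h) (+ q) ℕ.* R (g ℤ.- + h) r) ≡ ∑ (upTo n) (λ h → R (+ h) r)
      -- The extra factor `n` allows `n N` to be replaced by |P| |Q|.
      convolution {r} r<p {q} q<p g = ℕ.*-cancelˡ-≡ _ _ (n ℕ.* (L ℕ.* L)) {{ℕ.m*n≢0 n (L ℕ.* L) {{it}} {{ℕ.m*n≢0 L L}}}} (begin
        n ℕ.* (L ℕ.* L) ℕ.* C
          ≡⟨ ℕ.*-assoc n (L ℕ.* L) C ⟩
        n ℕ.* (L ℕ.* L ℕ.* C)
          ≡⟨ cong (n ℕ.*_) (L²*convolution r<p (+ q) g) ⟩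
        n ℕ.* (Qclass (+ q) ℕ.* (Pclass (+ r) ℕ.* N))
          ≡⟨ shuffle₁ n (Qclass (+ q)) (Pclass (+ r)) N ⟩
        Qclass (+ q) ℕ.* (Pclass (+ r) ℕ.* (n ℕ.* N))
          ≡⟨ cong (λ z → Qclass (+ q) ℕ.* (Pclass (+ r) ℕ.* z)) (sym (TilesList⇒size n N P Q T)) ⟩
        Qclass (+ q) ℕ.* (Pclass (+ r) ℕ.* (length P ℕ.* length Q))
          ≡⟨ shuffle₂ (Qclass (+ q)) (Pclass (+ r)) (length P) (length Q) ⟩
        length P ℕ.* Qclass (+ q) ℕ.* (Pclass (+ r) ℕ.* length Q)
          ≡⟨ cong₂ ℕ._*_ (sym (L*∑U (+ q))) (sym (L*∑R r<p)) ⟩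
        L ℕ.* ∑ (upTo n) (λ h → U (+ h) (+ q)) ℕ.* (L ℕ.* S)
          ≡⟨ cong (λ z → L ℕ.* z ℕ.* (L ℕ.* S)) (equidistributed q<p) ⟩
        L ℕ.* n ℕ.* (L ℕ.* S)
          ≡⟨ shuffle₃ L n S ⟩
        n ℕ.* (L ℕ.* L) ℕ.* S ∎)
        where
        open ≡-Reasoning
        it : NonZero n
        it = ℕ.≢-nonZero (ℕ.≢-nonZero⁻¹ n)
        C = ∑ (upTo n) (λ h → U (+ h) (+ q) ℕ.* R (g ℤ.- + h) r)
        S = ∑ (upTo n) (λ h → R (+ h) r)
        shuffle₁ : ∀ n x y z → n ℕ.* (x ℕ.* (y ℕ.* z)) ≡ x ℕ.* (y ℕ.* (n ℕ.* z))
        shuffle₁ = solveℕ-∀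
        shuffle₂ : ∀ x y a b → x ℕ.* (y ℕ.* (a ℕ.* b)) ≡ a ℕ.* x ℕ.* (y ℕ.* b)
        shuffle₂ = solveℕ-∀
        shuffle₃ : ∀ l n s → l ℕ.* n ℕ.* (l ℕ.* s) ≡ n ℕ.* (l ℕ.* l) ℕ.* s
        shuffle₃ = solveℕ-∀

      -- d = U - 1 modulo p; as R ≡ 1 - U, the previous lemma says that d has
      -- square zero modulo p.
      private
        p′ = ℕ.pred p
        p≡1+p′ : p ≡ suc p′
        p≡1+p′ = sym (ℕ.suc-pred p)

        d : ℕ → ℤ → ℕ
        d q h = U h (+ q) ℕ.+ p′

        p∣d : ∀ {q} → q < p → ∀ x → p ℕ.∣ d q x
        p∣d {q} q<p = convolution-square-zero pp n n⊥p (d q) (λ c → cong (ℕ._+ p′) (U-respects (+ q) c)) square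
          where
          open ≡-Reasoning
          0<p : 0 < p
          0<p = ℕ.>-nonZero⁻¹ p
          distrib₁ : ∀ d u e r v p → r ℕ.+ u ≡ 1 ℕ.+ p ℕ.* v → d ℕ.* r ℕ.+ d ℕ.* (u ℕ.+ e) ≡ suc e ℕ.* d ℕ.+ d ℕ.* (p ℕ.* v)
          distrib₁ d u e r v p eq = trans (lem₁ d u e r) (trans (cong (λ z → d ℕ.* (z ℕ.+ e)) eq) (lem₂ d e (p ℕ.* v)))
            where
            lem₁ : ∀ d u e r → d ℕ.* r ℕ.+ d ℕ.* (u ℕ.+ e) ≡ d ℕ.* (r ℕ.+ u ℕ.+ e)
            lem₁ = solveℕ-∀
            lem₂ : ∀ d e w → d ℕ.* (1 ℕ.+ w ℕ.+ e) ≡ suc e ℕ.* d ℕ.+ d ℕ.* w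
            lem₂ = solveℕ-∀
          -- Since `d` is `U` plus `p - 1`, convolution with `R` gives `1 + (p - 1)` times the sum
          -- of `R`.
          cross : ∀ g → ∑ (upTo n) (λ h → d q (+ h) ℕ.* R (g ℤ.- + h) 0) ≡ p ℕ.* ∑ (upTo n) (λ h → R (+ h) 0)
          cross g = begin
            ∑ (upTo n) (λ h → d q (+ h) ℕ.* R (g ℤ.- + h) 0)
              ≡⟨ ∑-cong (upTo n) (λ h → ℕ.*-distribʳ-+ (R (g ℤ.- + h) 0) (U (+ h) (+ q)) p′) ⟩
            ∑ (upTo n) (λ h → U (+ h) (+ q) ℕ.* R (g ℤ.- + h) 0 ℕ.+ p′ ℕ.* R (g ℤ.- + h) 0)
              ≡⟨ ∑-+ (upTo n) _ _ ⟩
            ∑ (upTo n) (λ h → U (+ h) (+ q) ℕ.* R (g ℤ.- + h) 0) ℕ.+ ∑ (upTo n) (λ h → p′ ℕ.* R (g ℤ.- + h) 0)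
              ≡⟨ cong₂ ℕ._+_ (convolution 0<p q<p g) (trans (∑-*ˡ (upTo n) p′ _)
                   (cong (p′ ℕ.*_) (∑-reflect n (R-respects 0<p) g))) ⟩
            suc p′ ℕ.* ∑ (upTo n) (λ h → R (+ h) 0)
              ≡⟨ cong (ℕ._* ∑ (upTo n) (λ h → R (+ h) 0)) (sym p≡1+p′) ⟩
            p ℕ.* ∑ (upTo n) (λ h → R (+ h) 0) ∎
          -- At each point `R + d = p (1 + V)`, so the convolutions of `d` with `R` and with `d` add
          -- up to a multiple of `p`; `cross` disposes of the first.
          square : ∀ g → p ℕ.∣ ∑ (upTo n) (λ h → d q (+ h) ℕ.* d q (g ℤ.- + h))
          square g = ℕ.∣m+n∣m⇒∣n {m = ∑ (upTo n) (λ h → d q (+ h) ℕ.* R (g ℤ.- + h) 0)}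
            (subst (p ℕ.∣_) (∑-+ (upTo n) _ _) (∣-∑ (upTo n) λ h →
              subst (p ℕ.∣_) (sym (distrib₁ (d q (+ h)) (U (g ℤ.- + h) (+ q)) p′ (R (g ℤ.- + h) 0) _ p (R+U (g ℤ.- + h) 0<p (+ q))))
                (ℕ.∣m∣n⇒∣m+n (subst (λ z → p ℕ.∣ z ℕ.* d q (+ h)) p≡1+p′ (ℕ.m∣m*n (d q (+ h))))
                   (ℕ.∣n⇒∣m*n (d q (+ h)) (ℕ.m∣m*n _)))))
            (subst (p ℕ.∣_) (sym (cross g)) (ℕ.m∣m*n _))

      U≥1 : ∀ {q} → q < p → ∀ h → 1 ≤ U h (+ q)
      U≥1 {q} q<p h = ∣+pred⇒≥1 (ℕ.nonTrivial⇒n>1 p {{prime⇒nonTrivial pp}}) (U h (+ q)) (p∣d q<p h)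

      U≡1 : ∀ {q} → q < p → ∀ h → U h (+ q) ≡ 1
      U≡1 {q} q<p h = ∑≡length⇒≡1 (upTo p) (λ q → U h (+ q)) (λ q∈ → U≥1 (∈-upTo⁻ q∈) h)
        (trans (U-total h) (sym (length-applyUpTo (λ i → i) p))) (∈-upTo⁺ q<p)

      -- The count for class `r` depends on the target only modulo `p`, so each class may be given
      -- its own multiple `e r` of `p`. This freedom accommodates every η.
      twisted-count : ∀ h {q} → q < p → ∀ (e : ℕ → ℤ) →
        pairCount (λ (a , k) (b , l) → ∑ (upTo p) (λ r →
          ind n (+ (a ℕ.+ b)) h ℕ.* (ind p (+ k) (+ r) ℕ.* ind N (+ (k ℕ.+ l)) (+ r ℤ.+ + q ℤ.+ e r ℤ.* + p)))) P Q ≡ 1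
      twisted-count h {q} q<p e = begin
        pairCount (λ a b → ∑ (upTo p) (λ r → f r a b)) P Q
          ≡⟨ trans (∑-cong P λ a → ∑-swap Q (upTo p) _) (∑-swap P (upTo p) _) ⟩
        ∑ (upTo p) (λ r → pairCount (f r) P Q)
          ≡⟨ ∑-cong-∈ (upTo p) (λ {r} r∈ → trans (sym (∑-pairsAt h _))
               (Slice.slopeCount-respects h (∈-upTo⁻ r∈) (Cong-multiple (+ r ℤ.+ + q) (e r)))) ⟩
        U h (+ q)
          ≡⟨ U≡1 q<p h ⟩
        1 ∎
        where
        open ≡-Reasoning
        f : ℕ → ℕ × ℕ → ℕ × ℕ → ℕ
        f r (a , k) (b , l) = ind n (+ (a ℕ.+ b)) h ℕ.* (ind p (+ k) (+ r) ℕ.* ind N (+ (k ℕ.+ l)) (+ r ℤ.+ + q ℤ.+ e r ℤ.* + p))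

-- Vanishing sums of p-th roots of unity in characteristic zero.

module RootsOfUnity where
  open ListSum
  open Congruence
  open Frobenius using (_⊹_; translates; iterate)
  open RingPowers
  open Evaluation using (iterate-frobenius)
  open import Data.Integer.Base as ℤ using (ℤ; +_; -[1+_]; +[1+_])
  open import Data.Integer.Divisibility.Signed as ℤ using (∣⇒∣ᵤ)
  open import Data.Nat.Base as ℕ using (ℕ; zero; suc; _<_; s≤s; z≤n)
  open import Relation.Binary.PropositionalEquality as ≡ using (_≡_; _≢_; cong; cong₂; subst)

  Cong0-euclid : ∀ {p} → Prime p → ∀ a b → ¬ Cong p a (+ 0) → ¬ Cong p b (+ 0) → ¬ Cong p (a ℤ.* b) (+ 0)
  Cong0-euclid {p} pp a b a≢0 b≢0 c =
    [ a≢0 ∘ from , b≢0 ∘ from ]′ (euclidsLemma ℤ.∣ a ∣ ℤ.∣ b ∣ pp (subst (p ℕ.∣_) (ℤ.abs-* a b) (to c)))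
    where
    from : ∀ {z} → p ℕ.∣ ℤ.∣ z ∣ → Cong p z (+ 0)
    from {z} d = ∣⇒Cong (subst (+ p ℤ.∣_) (≡.sym (ℤ.+-identityʳ z)) (ℤ.∣ᵤ⇒∣ d))
    to : ∀ {z} → Cong p z (+ 0) → p ℕ.∣ ℤ.∣ z ∣
    to {z} c = ∣⇒∣ᵤ (subst (+ p ℤ.∣_) (ℤ.+-identityʳ z) (Cong⇒∣ c))

  module _ {c ℓ₁ ℓ₂} (𝔽 : HeytingField c ℓ₁ ℓ₂) (char0 : CharacteristicZero 𝔽) where
    open HeytingField 𝔽 using (#⇒invertible; tight)
    private
      𝓡 = HeytingCommutativeRing.commutativeRing (HeytingField.heytingCommutativeRing 𝔽)
    open CommutativeRing 𝓡 hiding (zero)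
    open RingProperties ring using (-‿distribˡ-*; -‿distribʳ-*; -‿+-comm; -‿involutive; -0#≈0#)
    open SemiringExp commutativeSemiring using (_^_; ^-homo-*)
    open SemiringMult semiring using (×-homo-+; ×-congʳ; ×-congˡ; ×-assoc-*; ×-assocˡ; ×-homo-1)
      renaming (_×_ to infixr 8 _·_)
    open CommutativeSemigroupProperties *-commutativeSemigroup using (x∙yz≈y∙xz)
    open MonoidMult +-commutativeMonoid using (×-distrib-+)
    open SemiringSum semiring using (sum; sum-cong-≋; sum-replicate-zero; *-distribˡ-sum)
    open MonoidSum +-commutativeMonoid using (∑-distrib-+)
    open SetoidReasoning setoid

    -- Apartness is tight: it suffices to refute that `x` is apart from 0, and an invertible `x`
    -- would make `k` times 1 vanish.
    multiple-cancel : ∀ k → 0 < k → ∀ {x} → k · x ≈ 0# → x ≈ 0#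
    multiple-cancel k 0<k {x} kx≈0 = proj₁ (tight x 0#) λ x#0 → char0 k 0<k (k·1≈0 (#⇒invertible x#0))
      where
      open import Algebra.Definitions _≈_ using (Invertible)
      k·1≈0 : Invertible 1# _*_ (x - 0#) → k · 1# ≈ 0#
      k·1≈0 (y , _ , xy≈1) = begin
        k · 1#              ≈⟨ ×-congʳ k (sym xy≈1) ⟩
        k · ((x - 0#) * y)  ≈⟨ ×-congʳ k (*-congʳ (trans (+-congˡ -0#≈0#) (+-identityʳ x))) ⟩
        k · (x * y)         ≈⟨ ×-assoc-* k x y ⟨
        k · x * y           ≈⟨ *-congʳ kx≈0 ⟩
        0# * y              ≈⟨ zeroˡ y ⟩
        0#                  ∎

    ι : ℤ → Carrier
    ι (+ n)    = n · 1#
    ι -[1+ n ] = - (suc n · 1#)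

    private
      ι-⊖ : ∀ m n → ι (m ℤ.⊖ n) ≈ m · 1# - n · 1#
      ι-⊖ zero    zero    = sym (-‿inverseʳ 0#)
      ι-⊖ zero    (suc n) = sym (+-identityˡ _)
      ι-⊖ (suc m) zero    = sym (trans (+-congˡ -0#≈0#) (+-identityʳ _))
      ι-⊖ (suc m) (suc n) = begin
        ι (suc m ℤ.⊖ suc n)                     ≡⟨ cong ι (ℤ.[1+m]⊖[1+n]≡m⊖n m n) ⟩
        ι (m ℤ.⊖ n)                             ≈⟨ ι-⊖ m n ⟩
        m · 1# - n · 1#                         ≈⟨ +-congʳ (+-identityʳ _) ⟨
        (m · 1# + 0#) - n · 1#                  ≈⟨ +-congʳ (+-congˡ (-‿inverseʳ 1#)) ⟨
        (m · 1# + (1# - 1#)) - n · 1#           ≈⟨ +-congʳ (+-assoc _ _ _) ⟨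
        ((m · 1# + 1#) - 1#) - n · 1#           ≈⟨ +-assoc _ _ _ ⟩
        (m · 1# + 1#) + (- 1# - n · 1#)         ≈⟨ +-cong (+-comm _ _) (-‿+-comm 1# (n · 1#)) ⟩
        suc m · 1# - suc n · 1#                 ∎

      ι-+ : ∀ a b → ι (a ℤ.+ b) ≈ ι a + ι b
      ι-+ (+ m)    (+ n)    = ×-homo-+ 1# m n
      ι-+ (+ m)    -[1+ n ] = ι-⊖ m (suc n)
      ι-+ -[1+ m ] (+ n)    = trans (ι-⊖ n (suc m)) (+-comm _ _)
      ι-+ -[1+ m ] -[1+ n ] = trans (-‿cong (trans (×-congˡ (cong suc (≡.sym (ℕ.+-suc m n)))) (×-homo-+ 1# (suc m) (suc n))))
                                    (sym (-‿+-comm _ _))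

      ι-neg : ∀ a → ι (ℤ.- a) ≈ - ι a
      ι-neg (+ zero)  = sym -0#≈0#
      ι-neg +[1+ n ]  = refl
      ι-neg -[1+ n ]  = sym (-‿involutive _)

      ι-*-nat : ∀ n b → ι (+ n ℤ.* b) ≈ n · 1# * ι b
      ι-*-nat zero    b = sym (zeroˡ (ι b))
      ι-*-nat (suc n) b = begin
        ι (+ suc n ℤ.* b)          ≡⟨ cong ι (ℤ.suc-* (+ n) b) ⟩
        ι (b ℤ.+ + n ℤ.* b)        ≈⟨ ι-+ b (+ n ℤ.* b) ⟩
        ι b + ι (+ n ℤ.* b)        ≈⟨ +-cong (sym (*-identityˡ _)) (ι-*-nat n b) ⟩
        1# * ι b + n · 1# * ι b    ≈⟨ distribʳ (ι b) 1# (n · 1#) ⟨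
        suc n · 1# * ι b           ∎
      ι-* : ∀ a b → ι (a ℤ.* b) ≈ ι a * ι b
      ι-* (+ n)    b = ι-*-nat n b
      ι-* -[1+ n ] b = begin
        ι (-[1+ n ] ℤ.* b)         ≡⟨ cong ι (ℤ.neg-distribˡ-* (+ suc n) b) ⟨
        ι (ℤ.- (+ suc n ℤ.* b))    ≈⟨ ι-neg (+ suc n ℤ.* b) ⟩
        - ι (+ suc n ℤ.* b)        ≈⟨ -‿cong (ι-*-nat (suc n) b) ⟩
        - (suc n · 1# * ι b)       ≈⟨ -‿distribˡ-* _ _ ⟩
        - (suc n · 1#) * ι b       ∎

      ι-nat : ∀ n x → ι (+ n) * x ≈ n · x
      ι-nat n x = trans (×-assoc-* n 1# x) (×-congʳ n (*-identityˡ x))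

      ι-cancel : ∀ z → z ≢ + 0 → ∀ {x} → ι z * x ≈ 0# → x ≈ 0#
      ι-cancel (+ zero)  z≢0 eq = contradiction ≡.refl z≢0
      ι-cancel +[1+ n ]  z≢0 eq = multiple-cancel (suc n) (s≤s z≤n) (trans (sym (ι-nat (suc n) _)) eq)
      ι-cancel -[1+ n ]  z≢0 {x} eq = multiple-cancel (suc n) (s≤s z≤n) (begin
        suc n · x                  ≈⟨ ι-nat (suc n) x ⟨
        suc n · 1# * x             ≈⟨ -‿involutive _ ⟨
        - - (suc n · 1# * x)       ≈⟨ -‿cong (-‿distribˡ-* _ _) ⟩
        - (- (suc n · 1#) * x)     ≈⟨ -‿cong eq ⟩
        - 0#                       ≈⟨ -0#≈0# ⟩
        0#                         ∎)

    -- Gaussian elimination: every pivot stays nonzero modulo p.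
    invertible-mod-p : ∀ {p} → Prime p → ∀ k (A : Fin k → Fin k → ℤ) (v : Fin k → Carrier) →
      (∀ i j → i ≢ j → Cong p (A i j) (+ 0)) → (∀ i → ¬ Cong p (A i i) (+ 0)) →
      (∀ i → sum (λ j → ι (A i j) * v j) ≈ 0#) → ∀ j → v j ≈ 0#
    invertible-mod-p {p} pp (suc k) A v off diag kernel = all
      where
      a = A zero zero

      -- Elimination without fractions: rows are multiplied by the pivot. Modulo `p` the
      -- off-diagonal entries remain 0 and the diagonal ones are multiplied by `a`.
      B : Fin k → Fin k → ℤ
      B i j = a ℤ.* A (suc i) (suc j) ℤ.- A (suc i) zero ℤ.* A zero (suc j)

      a≢0 : a ≢ + 0
      a≢0 eq = diag zero (≡⇒Cong eq)

      row : Fin (suc k) → Carrier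
      row i = sum (λ j → ι (A i (suc j)) * v (suc j))

      kernel-row : ∀ i → row i ≈ - (ι (A i zero) * v zero)
      kernel-row i = begin
        row i                              ≈⟨ +-identityˡ _ ⟨
        0# + row i                         ≈⟨ +-congʳ (-‿inverseˡ x) ⟨
        (- x + x) + row i                  ≈⟨ +-assoc _ _ _ ⟩
        - x + (x + row i)                  ≈⟨ +-congˡ (kernel i) ⟩
        - x + 0#                           ≈⟨ +-identityʳ _ ⟩
        - x                                ∎
        where x = ι (A i zero) * v zero

      B-kernel : ∀ i → sum (λ j → ι (B i j) * v (suc j)) ≈ 0#
      B-kernel i = begin
        sum (λ j → ι (B i j) * v (suc j))
          ≈⟨ sum-cong-≋ entry ⟩
        sum (λ j → ι a * (ι (A (suc i) (suc j)) * v (suc j)) + - b * (ι (A zero (suc j)) * v (suc j)))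
          ≈⟨ ∑-distrib-+ (λ j → ι a * (ι (A (suc i) (suc j)) * v (suc j))) _ ⟩
        sum (λ j → ι a * (ι (A (suc i) (suc j)) * v (suc j))) + sum (λ j → - b * (ι (A zero (suc j)) * v (suc j)))
          ≈⟨ +-cong (*-distribˡ-sum (ι a) (λ j → ι (A (suc i) (suc j)) * v (suc j)))
                    (*-distribˡ-sum (- b) (λ j → ι (A zero (suc j)) * v (suc j))) ⟨
        ι a * row (suc i) + - b * row zero
          ≈⟨ +-cong (*-congˡ (kernel-row (suc i))) (*-congˡ (kernel-row zero)) ⟩
        ι a * - (b * v zero) + - b * - (ι a * v zero)
          ≈⟨ +-cong (sym (-‿distribʳ-* (ι a) (b * v zero))) (begin
               - b * - (ι a * v zero)     ≈⟨ -‿distribʳ-* (- b) (ι a * v zero) ⟨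
               - (- b * (ι a * v zero))   ≈⟨ -‿cong (-‿distribˡ-* b (ι a * v zero)) ⟨
               - - (b * (ι a * v zero))   ≈⟨ -‿involutive _ ⟩
               b * (ι a * v zero)         ≈⟨ x∙yz≈y∙xz b (ι a) (v zero) ⟩
               ι a * (b * v zero)         ∎) ⟩
        - (ι a * (b * v zero)) + ι a * (b * v zero)
          ≈⟨ -‿inverseˡ _ ⟩
        0# ∎
        where
        b = ι (A (suc i) zero)
        entry : ∀ j → ι (B i j) * v (suc j) ≈ ι a * (ι (A (suc i) (suc j)) * v (suc j)) + - b * (ι (A zero (suc j)) * v (suc j))
        entry j = begin
          ι (a ℤ.* d ℤ.- e ℤ.* f) * w
            ≈⟨ *-congʳ (trans (ι-+ (a ℤ.* d) (ℤ.- (e ℤ.* f)))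
                 (+-cong (ι-* a d) (trans (ι-neg (e ℤ.* f)) (-‿cong (ι-* e f))))) ⟩
          (ι a * ι d - b * ι f) * w
            ≈⟨ distribʳ w (ι a * ι d) (- (b * ι f)) ⟩
          ι a * ι d * w + - (b * ι f) * w
            ≈⟨ +-cong (*-assoc _ _ _) (trans (*-congʳ (-‿distribˡ-* b (ι f))) (*-assoc _ _ _)) ⟩
          ι a * (ι d * w) + - b * (ι f * w) ∎
          where
          d = A (suc i) (suc j)
          e = A (suc i) zero
          f = A zero (suc j)
          w = v (suc j)

      B-off : ∀ i j → i ≢ j → Cong p (B i j) (+ 0)
      B-off i j i≢j = Cong-trans
        (Cong-- (Cong-*ˡ a (off (suc i) (suc j) (i≢j ∘ Fin.suc-injective)))
                (Cong-*ʳ (A zero (suc j)) (off (suc i) zero λ ())))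
        (≡⇒Cong (expand a (A zero (suc j))))
        where
        expand : ∀ a b → a ℤ.* + 0 ℤ.- + 0 ℤ.* b ≡ + 0
        expand = solve-∀

      B-diag : ∀ i → ¬ Cong p (B i i) (+ 0)
      B-diag i c = Cong0-euclid pp a (A (suc i) (suc i)) (diag zero) (diag (suc i))
        (Cong-trans (Cong-sym (Cong-trans
          (Cong-- (Cong-refl {a = a ℤ.* A (suc i) (suc i)}) (Cong-*ʳ (A zero (suc i)) (off (suc i) zero λ ())))
          (≡⇒Cong (expand (a ℤ.* A (suc i) (suc i)) (A zero (suc i)))))) c)
        where
        expand : ∀ z b → z ℤ.- + 0 ℤ.* b ≡ z
        expand = solve-∀

      rest : ∀ j → v (suc j) ≈ 0#
      rest = invertible-mod-p pp k B (v ∘ suc) B-off B-diag B-kernel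

      all : ∀ j → v j ≈ 0#
      all (suc j) = rest j
      all zero    = ι-cancel a a≢0 (begin
        ι a * v zero             ≈⟨ +-identityʳ _ ⟨
        ι a * v zero + 0#        ≈⟨ +-congˡ (trans (sum-cong-≋ (λ j → trans (*-congˡ (rest j)) (zeroʳ _))) (sum-replicate-zero k)) ⟨
        ι a * v zero + row zero  ≈⟨ kernel zero ⟩
        0#                       ∎)

    ∑ᶠ : ∀ {a} {A : Set a} → List A → (A → Carrier) → Carrier
    ∑ᶠ []       f = 0#
    ∑ᶠ (x ∷ xs) f = f x + ∑ᶠ xs f

    ∑ᶠ-cong : ∀ {a} {A : Set a} (xs : List A) {f g : A → Carrier} → (∀ x → f x ≈ g x) → ∑ᶠ xs f ≈ ∑ᶠ xs g
    ∑ᶠ-cong []       eq = refl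
    ∑ᶠ-cong (x ∷ xs) eq = +-cong (eq x) (∑ᶠ-cong xs eq)

    ∑ᶠ-0 : ∀ {a} {A : Set a} (xs : List A) {f : A → Carrier} → (∀ x → f x ≈ 0#) → ∑ᶠ xs f ≈ 0#
    ∑ᶠ-0 []       eq = refl
    ∑ᶠ-0 (x ∷ xs) eq = trans (+-cong (eq x) (∑ᶠ-0 xs eq)) (+-identityˡ 0#)

    ∑ᶠ-*ˡ : ∀ {a} {A : Set a} (xs : List A) c (f : A → Carrier) → ∑ᶠ xs (λ x → c * f x) ≈ c * ∑ᶠ xs f
    ∑ᶠ-*ˡ []       c f = sym (zeroʳ c)
    ∑ᶠ-*ˡ (x ∷ xs) c f = trans (+-congˡ (∑ᶠ-*ˡ xs c f)) (sym (distribˡ c (f x) _))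

    combination : ∀ {p} → (Fin p → ℕ) → (Fin p → Carrier) → Carrier
    combination w z = sum (λ j → w j · z j)

    combination-cong : ∀ {p} (w w′ : Fin p → ℕ) (z : Fin p → Carrier) → (∀ j → w j ≡ w′ j) →
                       combination w z ≈ combination w′ z
    combination-cong w w′ z eq = sum-cong-≋ λ j → ×-congˡ (eq j)

    combination-∑ : ∀ {a} {A : Set a} {p} (xs : List A) (w : Fin p → A → ℕ) z →
      combination (λ j → ∑ xs (w j)) z ≈ ∑ᶠ xs (λ x → combination (λ j → w j x) z)
    combination-∑ {p = p} []       w z = sum-replicate-zero p
    combination-∑ (x ∷ xs) w z = begin
      sum (λ j → (w j x ℕ.+ ∑ xs (w j)) · z j)
        ≈⟨ sum-cong-≋ (λ j → ×-homo-+ (z j) (w j x) (∑ xs (w j))) ⟩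
      sum (λ j → w j x · z j + ∑ xs (w j) · z j)
        ≈⟨ ∑-distrib-+ (λ j → w j x · z j) _ ⟩
      combination (λ j → w j x) z + combination (λ j → ∑ xs (w j)) z
        ≈⟨ +-congˡ (combination-∑ xs w z) ⟩
      combination (λ j → w j x) z + ∑ᶠ xs (λ x → combination (λ j → w j x) z) ∎

    combination-scale : ∀ {p} m (w : Fin p → ℕ) z → combination (λ j → m ℕ.* w j) z ≈ m · combination w z
    combination-scale m w z = trans (sum-cong-≋ λ j → sym (×-assocˡ (z j) m (w j))) (sum-· (λ j → w j · z j))
      where
      sum-· : ∀ {k} (f : Fin k → Carrier) → sum (λ j → m · f j) ≈ m · sum f
      sum-· {zero}  f = sym (m·0≈0 𝓡 m)
      sum-· {suc k} f = trans (+-congˡ (sum-· (f ∘ suc))) (sym (×-distrib-+ (f zero) _ m))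

    module _ {p} (pp : Prime p) {ζ : Carrier} (ζᵖ≈1 : ζ ^ p ≈ 1#) where
      private instance p≢0 = prime⇒nonZero pp

      powers : Fin p → Carrier
      powers j = ζ ^ toℕ j

      -- Reduction of the exponent modulo `p`, written as a coordinate vector. It lets relations in
      -- the field be handled through natural-number coordinates.
      combination-ind : ∀ e → combination (λ j → ind p (+ e) (+ toℕ j)) powers ≈ ζ ^ e
      combination-ind e = begin
        combination (λ j → ind p (+ e) (+ toℕ j)) powers
          ≈⟨ sum-single 𝓡 _ r (λ j j≢r → ×-congˡ (ind-no λ c → j≢r (toℕ-injective
               (Cong⇒≡ (toℕ<n j) (toℕ<n r) (Cong-trans (Cong-sym c) e≡r))))) ⟩
        ind p (+ e) (+ toℕ r) · ζ ^ toℕ r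
          ≈⟨ trans (×-congˡ (ind-yes e≡r)) (×-homo-1 _) ⟩
        ζ ^ toℕ r
          ≡⟨ cong (ζ ^_) (toℕ-fromℕ< (m%n<n e p)) ⟩
        ζ ^ (e % p)
          ≈⟨ ^-% 𝓡 p ζᵖ≈1 e ⟨
        ζ ^ e ∎
        where
        r = fromℕ< (m%n<n e p)
        e≡r : Cong p (+ e) (+ toℕ r)
        e≡r = cong-by (+ (e / p)) (≡.trans (cong +_ (m≡m%n+[m/n]*n e p))
          (cong₂ ℤ._+_ (cong +_ (≡.sym (toℕ-fromℕ< (m%n<n e p)))) (ℤ.pos-* (e / p) p)))

      module _ (w : ℕ → ℕ) (vanish : combination (λ j → w (toℕ j)) powers ≈ 0#) where
        private
          D : List (ℕ × ℕ)
          D = concatMap (λ q → replicate (w q) (q , 0)) (upTo p)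

          ∑-D : ∀ f → ∑ D f ≡ ∑ (upTo p) (λ q → w q ℕ.* f (q , 0))
          ∑-D f = ≡.trans (∑-concatMap _ (upTo p) f) (∑-cong (upTo p) λ q → ∑-replicate (w q) (q , 0) f)

          -- `translates` sums over `D` the values at shifted points, so a combination that vanishes
          -- everywhere continues to do so.
          zero-iterate : ∀ m (F : Fin p → ℕ × ℕ → ℕ) → (∀ g → combination (λ j → F j g) powers ≈ 0#) →
                         ∀ g → combination (λ j → iterate m D (F j) g) powers ≈ 0#
          zero-iterate zero    F z g = z g
          zero-iterate (suc m) F z g = zero-iterate m (λ j → translates D (F j))
            (λ g → trans (combination-∑ D (λ j a → F j (a ⊹ g)) powers) (∑ᶠ-0 D λ a → z (a ⊹ g))) g

          -- The weight `F i j` reads off the coordinate at ζ^j after multiplication by ζ^i. Row `i`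
          -- of the matrix `A` below thus expands ζ^i g(ζ)^p, where g has the coefficients `w`.
          F : ℕ → Fin p → ℕ × ℕ → ℕ
          F i j (e , _) = ind p (+ (e ℕ.+ i)) (+ toℕ j)

          vanish-D : ∑ᶠ D (λ a → ζ ^ proj₁ a) ≈ 0#
          vanish-D = begin
            ∑ᶠ D (λ a → ζ ^ proj₁ a)
              ≈⟨ ∑ᶠ-cong D (λ a → combination-ind (proj₁ a)) ⟨
            ∑ᶠ D (λ a → combination (λ j → ind p (+ proj₁ a) (+ toℕ j)) powers)
              ≈⟨ combination-∑ D (λ j a → ind p (+ proj₁ a) (+ toℕ j)) powers ⟨
            combination (λ j → ∑ D (λ a → ind p (+ proj₁ a) (+ toℕ j))) powers
              ≈⟨ sum-cong-≋ (λ j → ×-congˡ (weight-of j)) ⟩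
            combination (λ j → w (toℕ j)) powers
              ≈⟨ vanish ⟩
            0# ∎
            where
            open import Data.List.Membership.Propositional.Properties using (∈-upTo⁺; ∈-upTo⁻)
            open import Data.List.Relation.Unary.Unique.Propositional.Properties using (upTo⁺)
            weight-of : ∀ j → ∑ D (λ a → ind p (+ proj₁ a) (+ toℕ j)) ≡ w (toℕ j)
            weight-of j = ≡.trans (∑-D _) (≡.trans
              (∑-single (upTo⁺ p) (∈-upTo⁺ (toℕ<n j)) λ q q∈ q≢j → ≡.trans
                (cong (w q ℕ.*_) (ind-no λ c → q≢j (Cong⇒≡ (∈-upTo⁻ q∈) (toℕ<n j) c))) (ℕ.*-zeroʳ (w q)))
              (≡.trans (cong (w (toℕ j) ℕ.*_) (ind-yes (Cong-refl {p}))) (ℕ.*-identityʳ _)))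

          first-translate : ∀ i g → combination (λ j → translates D (F i j) g) powers ≈ 0#
          first-translate i g@(g₁ , _) = begin
            combination (λ j → translates D (F i j) g) powers
              ≈⟨ combination-∑ D (λ j a → F i j (a ⊹ g)) powers ⟩
            ∑ᶠ D (λ a → combination (λ j → F i j (a ⊹ g)) powers)
              ≈⟨ ∑ᶠ-cong D (λ a → trans (combination-ind (proj₁ a ℕ.+ g₁ ℕ.+ i)) (begin
                   ζ ^ (proj₁ a ℕ.+ g₁ ℕ.+ i)      ≡⟨ cong (ζ ^_) (ℕ.+-assoc (proj₁ a) g₁ i) ⟩
                   ζ ^ (proj₁ a ℕ.+ (g₁ ℕ.+ i))    ≈⟨ ^-homo-* ζ (proj₁ a) (g₁ ℕ.+ i) ⟩
                   ζ ^ proj₁ a * ζ ^ (g₁ ℕ.+ i)    ≈⟨ *-comm _ _ ⟩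
                   ζ ^ (g₁ ℕ.+ i) * ζ ^ proj₁ a    ∎)) ⟩
            ∑ᶠ D (λ a → ζ ^ (g₁ ℕ.+ i) * ζ ^ proj₁ a)
              ≈⟨ ∑ᶠ-*ˡ D (ζ ^ (g₁ ℕ.+ i)) (λ a → ζ ^ proj₁ a) ⟩
            ζ ^ (g₁ ℕ.+ i) * ∑ᶠ D (λ a → ζ ^ proj₁ a)
              ≈⟨ trans (*-congˡ vanish-D) (zeroʳ _) ⟩
            0# ∎

          A : Fin p → Fin p → ℕ
          A i j = iterate p D (F (toℕ i) j) (0 , 0)

          A-kernel : ∀ i → combination (A i) powers ≈ 0#
          A-kernel i = first-then-rest p ≡.refl
            where
            -- `p` is generalised to `m` so that one factor can be split off by matching.
            first-then-rest : ∀ m → m ≡ p → combination (λ j → iterate m D (F (toℕ i) j) (0 , 0)) powers ≈ 0#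
            first-then-rest zero    eq = contradiction (subst Prime (≡.sym eq) pp) ¬prime[0]
            first-then-rest (suc m) eq = zero-iterate m (λ j → translates D (F (toℕ i) j)) (first-translate (toℕ i)) (0 , 0)

          -- Frobenius replaces `q` by `p q`, which vanishes modulo `p`; only ζ^i survives, with the
          -- sum of all weights as its coefficient.
          A-mod : ∀ i j → Cong p (+ A i j) (+ (∑ (upTo p) w ℕ.* ind p (+ toℕ i) (+ toℕ j)))
          A-mod i j = subst (λ x → Cong p (+ A i j) (+ x)) (≡.trans (∑-D _) (≡.trans
            (∑-cong (upTo p) λ q → cong (w q ℕ.*_) (ind-cong (multiple q) Cong-refl)) (∑-*ʳ (upTo p) _ w)))
            (iterate-frobenius pp D (F (toℕ i) j))
            where
            multiple : ∀ q → Cong p (+ (p ℕ.* q ℕ.+ toℕ i)) (+ toℕ i)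
            multiple q = Cong-+ {c = + toℕ i} {d = + toℕ i} (∣⇒Cong0 (ℕ.m∣m*n q)) Cong-refl

        -- If g(ζ) = 0 then g(ζ)ᵖ = 0 expands, by Frobenius, into a relation of
        -- the powers of ζ with matrix ≡ g(1) I modulo p.
        vanishing⇒p∣∑ : ¬ ¬ p ℕ.∣ ∑ (upTo p) w
        -- Elimination would make every power of ζ zero, in particular the one with exponent 0,
        -- which is 1.
        vanishing⇒p∣∑ p∤s = char0 1 (s≤s z≤n) (trans (×-homo-1 1#) (subst (λ m → ζ ^ m ≈ 0#) (toℕ-fromℕ< 0<p)
          (invertible-mod-p pp p (λ i j → + A i j) powers off diag kernel (fromℕ< 0<p))))
          where
          s = ∑ (upTo p) w
          0<p : 0 < p
          0<p = ℕ.>-nonZero⁻¹ p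
          off : ∀ i j → i ≢ j → Cong p (+ A i j) (+ 0)
          off i j i≢j = Cong-trans (A-mod i j) (≡⇒Cong (cong +_ (≡.trans
            (cong (s ℕ.*_) (ind-no λ c → i≢j (toℕ-injective (Cong⇒≡ (toℕ<n i) (toℕ<n j) c)))) (ℕ.*-zeroʳ s))))
          diag : ∀ i → ¬ Cong p (+ A i i) (+ 0)
          diag i c = p∤s (Cong0⇒∣ (Cong-trans (Cong-sym (Cong-trans (A-mod i i) (≡⇒Cong (cong +_ (≡.trans
            (cong (s ℕ.*_) (ind-yes (Cong-refl {p}))) (ℕ.*-identityʳ s)))))) c))
          kernel : ∀ i → sum (λ j → ι (+ A i j) * powers j) ≈ 0#
          kernel i = trans (sum-cong-≋ λ j → ι-nat (A i j) (powers j)) (A-kernel i)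

-- Equidistribution of Q modulo p.

module Equidistribution where
  open ListSum
  open Congruence
  open Tiling
  open Columns
  open RingPowers
  open RootsOfUnity
  open import Data.Integer.Base as ℤ using (ℤ; +_)
  open import Data.Nat.Base as ℕ using (ℕ; suc; NonZero; _<_; _^_)
  open import Relation.Binary.PropositionalEquality as ≡ using (_≡_; _≢_; sym; trans; cong; cong₂; subst)

  -- (x - n) (y - n) = 0, with the subtractions expanded.
  product-relation : ∀ x y n w → x ℕ.* y ≡ n ℕ.* w → y ℕ.+ x ≡ n ℕ.+ w → x ≢ n → y ≡ n
  product-relation x y n w prod sum x≢n =
    [ (λ x-n≡0 → contradiction (equal x-n≡0) x≢n) , equal ]′ (ℤ.i*j≡0⇒i≡0∨j≡0 (+ x ℤ.- + n) factored)
    where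
    open ≡.≡-Reasoning
    equal : ∀ {z} → + z ℤ.- + n ≡ + 0 → z ≡ n
    equal {z} eq = ℤ.+-injective (ℤ.i-j≡0⇒i≡j (+ z) (+ n) eq)
    expand₁ : ∀ x y n → (x ℤ.- n) ℤ.* (y ℤ.- n) ≡ x ℤ.* y ℤ.- n ℤ.* (y ℤ.+ x) ℤ.+ n ℤ.* n
    expand₁ = solve-∀
    expand₂ : ∀ n w → n ℤ.* w ℤ.- n ℤ.* (n ℤ.+ w) ℤ.+ n ℤ.* n ≡ + 0
    expand₂ = solve-∀
    factored : (+ x ℤ.- + n) ℤ.* (+ y ℤ.- + n) ≡ + 0
    factored = begin
      (+ x ℤ.- + n) ℤ.* (+ y ℤ.- + n)
        ≡⟨ expand₁ (+ x) (+ y) (+ n) ⟩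
      + x ℤ.* + y ℤ.- + n ℤ.* (+ (y ℕ.+ x)) ℤ.+ + n ℤ.* + n
        ≡⟨ cong₂ (λ a b → a ℤ.- + n ℤ.* + b ℤ.+ + n ℤ.* + n)
             (trans (sym (ℤ.pos-* x y)) (trans (cong +_ prod) (ℤ.pos-* n w))) sum ⟩
      + n ℤ.* + w ℤ.- + n ℤ.* (+ n ℤ.+ + w) ℤ.+ + n ℤ.* + n
        ≡⟨ expand₂ (+ n) (+ w) ⟩
      + 0 ∎

  module _ {p} (pp : Prime p) (n K : ℕ) .{{_ : NonZero n}} .{{_ : NonZero (p ^ suc K)}} (n⊥p : Coprime n p)
    (P Q : List (ℕ × ℕ)) (T : TilesList n (p ^ suc K) P Q)
    {c ℓ₁ ℓ₂} (𝔽 : HeytingField c ℓ₁ ℓ₂) (char0 : CharacteristicZero 𝔽)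
    where
    private
      𝓡 = HeytingCommutativeRing.commutativeRing (HeytingField.heytingCommutativeRing 𝔽)
      module F = CommutativeRing 𝓡
      open SemiringExp F.commutativeSemiring using () renaming (_^_ to _^ᶠ_)
      open SemiringMult F.semiring using (×-congʳ) renaming (_×_ to infixr 8 _·_)

      L = p ^ K
      N = p ^ suc K
      instance
        p≢0 = prime⇒nonZero pp
        L≢0 = ℕ.m^n≢0 p K

      U̅ : ℤ → ℕ
      U̅ q = ∑ (upTo n) (λ h → U pp n K n⊥p P Q T (+ h) q)
      R̅ : ℕ → ℕ
      R̅ r = ∑ (upTo n) (λ h → R pp n K n⊥p P Q T (+ h) r)
      V̅ : ℕ → ℤ → ℕ
      V̅ r q = ∑ (upTo n) (λ h → V pp n K n⊥p P Q T (+ h) r q)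
      𝒫 𝒬 : ℤ → ℕ
      𝒫 = Pclass pp n K n⊥p P Q T
      𝒬 = Qclass pp n K n⊥p P Q T

      0<p : 0 < p
      0<p = ℕ.>-nonZero⁻¹ p

      R̅+U̅ : ∀ {r} → r < p → ∀ q → R̅ r ℕ.+ U̅ q ≡ n ℕ.+ p ℕ.* V̅ r q
      R̅+U̅ {r} r<p q = trans (sym (∑-+ (upTo n) _ _)) (trans
        (∑-cong (upTo n) λ h → R+U pp n K n⊥p P Q T (+ h) r<p q)
        (trans (∑-+ (upTo n) (λ _ → 1) _)
          (cong₂ ℕ._+_ (trans (∑-upTo-const n 1) (ℕ.*-identityʳ n)) (∑-*ˡ (upTo n) p _))))

      -- Multiplied by L², both sides equal |P| |Q_q| |P_r| |Q|, where |P| |Q| = n p L. Together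
      -- with `R̅+U̅` this feeds `product-relation`, with `p V̅` in the place of `w`.
      U̅*R̅ : ∀ {r} → r < p → ∀ q → U̅ q ℕ.* R̅ r ≡ n ℕ.* (p ℕ.* V̅ r q)
      U̅*R̅ {r} r<p q = ℕ.*-cancelˡ-≡ _ _ (L ℕ.* L) {{ℕ.m*n≢0 L L}} (begin
        L ℕ.* L ℕ.* (U̅ q ℕ.* R̅ r)
          ≡⟨ ℕ.[m*n]*[o*p]≡[m*o]*[n*p] L L (U̅ q) (R̅ r) ⟩
        L ℕ.* U̅ q ℕ.* (L ℕ.* R̅ r)
          ≡⟨ cong₂ ℕ._*_ (L*∑U pp n K n⊥p P Q T q) (L*∑R pp n K n⊥p P Q T r<p) ⟩
        length P ℕ.* 𝒬 q ℕ.* (𝒫 (+ r) ℕ.* length Q)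
          ≡⟨ shuffle₁ (length P) (𝒬 q) (𝒫 (+ r)) (length Q) ⟩
        length P ℕ.* length Q ℕ.* (𝒫 (+ r) ℕ.* 𝒬 q)
          ≡⟨ cong₂ ℕ._*_ (TilesList⇒size n N P Q T) (sym (L*∑V pp n K n⊥p P Q T r<p q)) ⟩
        n ℕ.* (p ℕ.* L) ℕ.* (L ℕ.* V̅ r q)
          ≡⟨ shuffle₂ n p L (V̅ r q) ⟩
        L ℕ.* L ℕ.* (n ℕ.* (p ℕ.* V̅ r q)) ∎)
        where
        open ≡.≡-Reasoning
        shuffle₁ : ∀ a x y b → a ℕ.* x ℕ.* (y ℕ.* b) ≡ a ℕ.* b ℕ.* (y ℕ.* x)
        shuffle₁ = solveℕ-∀
        shuffle₂ : ∀ n p l v → n ℕ.* (p ℕ.* l) ℕ.* (l ℕ.* v) ≡ l ℕ.* l ℕ.* (n ℕ.* (p ℕ.* v))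
        shuffle₂ = solveℕ-∀

      ∑U̅ : ∑ (upTo p) (λ q → U̅ (+ q)) ≡ n ℕ.* p
      ∑U̅ = trans (∑-swap (upTo p) (upTo n) _) (trans (∑-cong (upTo n) λ h → U-total pp n K n⊥p P Q T (+ h))
        (∑-upTo-const n p))

    module _ {ζ : F.Carrier} (ζᵖ≈1 : (ζ ^ᶠ p) F.≈ F.1#)
      (vanish : ∑ᶠ 𝔽 char0 Q (λ (_ , l) → ζ ^ᶠ l) F.≈ F.0#) where

      private
        zs = powers 𝔽 char0 pp ζᵖ≈1

        -- If P rather than Q were equidistributed, Q would have N v_q / |P|
        -- elements in class q, with Σ v_q = n and Σ v_q ζ^q = 0.
        unequal⇒⊥ : R̅ 0 ≡ n → ¬ ¬ p ℕ.∣ n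
        unequal⇒⊥ R̅≡n = subst (λ m → ¬ ¬ p ℕ.∣ m) ∑w≡n (vanishing⇒p∣∑ 𝔽 char0 pp ζᵖ≈1 w w-vanishes)
          where
          -- With `R̅ 0 ≡ n`, the relation for row 0 reads `U̅ q = p V̅ 0 q`, which makes these
          -- values the integers sought.
          w : ℕ → ℕ
          w q = V̅ 0 (+ q)
          U̅≡p*w : ∀ q → U̅ (+ q) ≡ p ℕ.* w q
          U̅≡p*w q = ℕ.+-cancelˡ-≡ n _ _ (trans (cong (ℕ._+ U̅ (+ q)) (sym R̅≡n)) (R̅+U̅ 0<p (+ q)))
          ∑w≡n : ∑ (upTo p) w ≡ n
          ∑w≡n = ℕ.*-cancelˡ-≡ _ _ p (trans (sym (∑-*ˡ (upTo p) p w))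
            (trans (∑-cong (upTo p) λ q → sym (U̅≡p*w q)) (trans ∑U̅ (ℕ.*-comm n p))))
          size : ∀ q → length P ℕ.* 𝒬 (+ q) ≡ N ℕ.* w q
          size q = trans (sym (L*∑U pp n K n⊥p P Q T (+ q))) (trans (cong (L ℕ.*_) (U̅≡p*w q))
            (trans (sym (ℕ.*-assoc L p (w q))) (cong (ℕ._* w q) (ℕ.*-comm L p))))
          w-vanishes : combination 𝔽 char0 (λ j → w (toℕ j)) zs F.≈ F.0#
          -- `N` times the combination is |P| times Q(1,ζ) = 0, and `N` cancels in characteristic
          -- zero.
          w-vanishes = multiple-cancel 𝔽 char0 N (ℕ.>-nonZero⁻¹ N) (begin
            N · combination 𝔽 char0 (λ j → w (toℕ j)) zs
              ≈⟨ combination-scale 𝔽 char0 N (λ j → w (toℕ j)) zs ⟨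
            combination 𝔽 char0 (λ j → N ℕ.* w (toℕ j)) zs
              ≈⟨ combination-cong 𝔽 char0 (λ j → length P ℕ.* 𝒬 (+ toℕ j)) (λ j → N ℕ.* w (toℕ j)) zs (λ j → size (toℕ j)) ⟨
            combination 𝔽 char0 (λ j → length P ℕ.* 𝒬 (+ toℕ j)) zs
              ≈⟨ combination-scale 𝔽 char0 (length P) (λ j → 𝒬 (+ toℕ j)) zs ⟩
            length P · combination 𝔽 char0 (λ j → 𝒬 (+ toℕ j)) zs
              ≈⟨ ×-congʳ (length P) (combination-∑ 𝔽 char0 Q (λ j (_ , l) → ind p (+ l) (+ toℕ j)) zs) ⟩
            length P · ∑ᶠ 𝔽 char0 Q (λ (_ , l) → combination 𝔽 char0 (λ j → ind p (+ l) (+ toℕ j)) zs)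
              ≈⟨ ×-congʳ (length P) (∑ᶠ-cong 𝔽 char0 Q (λ (_ , l) → combination-ind 𝔽 char0 pp ζᵖ≈1 l)) ⟩
            length P · ∑ᶠ 𝔽 char0 Q (λ (_ , l) → ζ ^ᶠ l)
              ≈⟨ ×-congʳ (length P) vanish ⟩
            length P · F.0#
              ≈⟨ m·0≈0 𝓡 (length P) ⟩
            F.0# ∎)
            where
            open SetoidReasoning F.setoid

      -- Equality in ℕ is decidable, so inequality only has to be refuted: it forces `R̅ 0 ≡ n`, and
      -- then `p ∤ n` is contradictory, whereas `n` and `p` are coprime.
      equidistributed : ∀ {q} → q < p → U̅ (+ q) ≡ n
      equidistributed {q} q<p with U̅ (+ q) ℕ.≟ n
      ... | yes eq = eq
      ... | no neq = contradiction p∤n (unequal⇒⊥ (product-relation (U̅ (+ q)) (R̅ 0) n (p ℕ.* V̅ 0 (+ q))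
              (U̅*R̅ 0<p (+ q)) (R̅+U̅ 0<p (+ q)) neq))
        where
        p∤n : ¬ p ℕ.∣ n
        p∤n p∣n = ¬prime[1] (subst Prime (n⊥p (p∣n , ℕ.∣-refl)) pp)

-- From subsets of ℤ_n × ℤ_m to lists of exponents.

module Subsets where
  open ListSum
  open Congruence
  open Tiling
  open import Data.Integer.Base as ℤ using (ℤ; +_)
  open import Data.Nat.Base as ℕ using (ℕ; NonZero)
  open import Relation.Binary.PropositionalEquality

  toℕ-mod : ∀ a m .{{_ : NonZero m}} → toℕ (a mod m) ≡ a % m
  toℕ-mod a m = toℕ-fromℕ< (m%n<n a m)

  mod-Cong : ∀ a m .{{_ : NonZero m}} → Cong m (+ toℕ (a mod m)) (+ a)
  mod-Cong a m = Cong-sym (cong-by (+ (a / m)) (trans (cong +_ (m≡m%n+[m/n]*n a m))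
    (cong₂ ℤ._+_ (cong +_ (sym (toℕ-mod a m))) (ℤ.pos-* (a / m) m))))

  residue-Cong : ∀ m .{{_ : NonZero m}} z → Cong m (+ toℕ (residue m z)) z
  residue-Cong m z = subst (λ r → Cong m (+ r) z) (sym (toℕ-fromℕ< (n%ℕd<d z m))) (Cong-sym (Cong-% m z))

  +ₘ-Cong : ∀ {m} (i j : Fin m) → Cong m (+ toℕ (i +ₘ j)) (+ toℕ i ℤ.+ + toℕ j)
  +ₘ-Cong {m} i j = mod-Cong (toℕ i ℕ.+ toℕ j) m {{nonZeroIndex i}}

  Cong⇒≡ᶠ : ∀ {m} {i j : Fin m} → Cong m (+ toℕ i) (+ toℕ j) → i ≡ j
  Cong⇒≡ᶠ {i = i} {j} c = toℕ-injective (Cong⇒≡ (toℕ<n i) (toℕ<n j) c)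

  +ₘ≡⇒Cong : ∀ {m} (i j : Fin m) {k : Fin m} → i +ₘ j ≡ k → Cong m (+ toℕ i ℤ.+ + toℕ j) (+ toℕ k)
  +ₘ≡⇒Cong i j refl = Cong-sym (+ₘ-Cong i j)

  Cong⇒+ₘ≡ : ∀ {m} (i j : Fin m) {k : Fin m} → Cong m (+ toℕ i ℤ.+ + toℕ j) (+ toℕ k) → i +ₘ j ≡ k
  Cong⇒+ₘ≡ i j c = Cong⇒≡ᶠ (Cong-trans (+ₘ-Cong i j) c)

  module _ {n m : ℕ} where

    points : Subset ℤ²[ n , m ] → List ℤ²[ n , m ]
    points X = filter (λ u → T? (X u)) (cartesianProduct (allFin n) (allFin m))

    points-unique : ∀ X → Unique (points X)
    points-unique X = filter⁺ (λ u → T? (X u)) (cartesianProduct⁺ (allFin⁺ n) (allFin⁺ m))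

    ∈⇒∈points : ∀ X {u} → u ∈ X → u ∈ˡ points X
    ∈⇒∈points X {h , k} u∈X = ∈-filter⁺ (λ u → T? (X u)) (∈-cartesianProduct⁺ (∈-allFin h) (∈-allFin k)) u∈X

    ∈points⇒∈ : ∀ X {u} → u ∈ˡ points X → u ∈ X
    ∈points⇒∈ X i = proj₂ (∈-filter⁻ (λ u → T? (X u)) {xs = cartesianProduct (allFin n) (allFin m)} i)

    exponent : ℤ²[ n , m ] → ℕ × ℕ
    exponent (h , k) = toℕ h , toℕ k

    exponents : Subset ℤ²[ n , m ] → List (ℕ × ℕ)
    exponents X = map exponent (points X)

    pairs : Subset ℤ²[ n , m ] → Subset ℤ²[ n , m ] → List (ℤ²[ n , m ] × ℤ²[ n , m ])
    pairs X Y = cartesianProduct (points X) (points Y)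

    ∈pairs : ∀ X Y {u v} → u ∈ X → v ∈ Y → (u , v) ∈ˡ pairs X Y
    ∈pairs X Y u∈X v∈Y = ∈-cartesianProduct⁺ (∈⇒∈points X u∈X) (∈⇒∈points Y v∈Y)

    pairs⇒∈ : ∀ X Y {u v} → (u , v) ∈ˡ pairs X Y → u ∈ X × v ∈ Y
    pairs⇒∈ X Y i with ∈-cartesianProduct⁻ (points X) (points Y) i
    ... | u∈ , v∈ = ∈points⇒∈ X u∈ , ∈points⇒∈ Y v∈

    pairCount-exponents : ∀ X Y f →
      pairCount f (exponents X) (exponents Y) ≡ ∑ (pairs X Y) (λ (u , v) → f (exponent u) (exponent v))
    pairCount-exponents X Y f = trans (∑-map exponent (points X) _)
      (trans (∑-cong (points X) λ u → ∑-map exponent (points Y) _)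
        (sym (∑-cartesianProduct (points X) (points Y) _)))

    -- Only the pair furnished by the tiling contributes: any other contributing pair would have the
    -- same sum, the residue of `(h , t)`.
    Tiles⇒TilesList : .{{_ : NonZero n}} .{{_ : NonZero m}} → ∀ X Y → Tiles X Y →
                      TilesList n m (exponents X) (exponents Y)
    Tiles⇒TilesList X Y tiles h t = unique-pair (tiles (residue n h , residue m t))
      where
      χ : ℤ²[ n , m ] × ℤ²[ n , m ] → ℕ
      χ (u , v) = hits n m h t (exponent u) (exponent v)

      unique-pair : (∃! {A = ℤ²[ n , m ] × ℤ²[ n , m ]} _≡_
                       λ (u , v) → u ∈ X × v ∈ Y × u ⊞ v ≡ (residue n h , residue m t)) →
                    pairCount (hits n m h t) (exponents X) (exponents Y) ≡ 1
      unique-pair ((u , v) , (u∈X , v∈Y , u⊞v≡g) , unique) = trans (pairCount-exponents X Y (hits n m h t))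
        (trans (∑-single {f = χ} (cartesianProduct⁺ (points-unique X) (points-unique Y)) (∈pairs X Y u∈X v∈Y) off)
          (cong₂ ℕ._*_ (ind-yes (Cong-trans (+ₘ≡⇒Cong (proj₁ u) (proj₁ v) (cong proj₁ u⊞v≡g)) (residue-Cong n h)))
                       (ind-yes (Cong-trans (+ₘ≡⇒Cong (proj₂ u) (proj₂ v) (cong proj₂ u⊞v≡g)) (residue-Cong m t)))))
        where
        off : ∀ w → w ∈ˡ pairs X Y → w ≢ (u , v) → χ w ≡ 0
        off (u′ , v′) w∈ w≢ with cong? n (+ toℕ (proj₁ u′) ℤ.+ + toℕ (proj₁ v′)) h
                               | cong? m (+ toℕ (proj₂ u′) ℤ.+ + toℕ (proj₂ v′)) t
        ... | yes c | yes d = ⊥-elim (w≢ (sym (unique (proj₁ (pairs⇒∈ X Y w∈) , proj₂ (pairs⇒∈ X Y w∈) ,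
                cong₂ _,_ (Cong⇒+ₘ≡ (proj₁ u′) (proj₁ v′) (Cong-trans c (Cong-sym (residue-Cong n h))))
                          (Cong⇒+ₘ≡ (proj₂ u′) (proj₂ v′) (Cong-trans d (Cong-sym (residue-Cong m t))))))))
        ... | yes c | no ¬d = refl
        ... | no ¬c | _     = refl

-- The union of the translated slices and its tilings.

module TwistedUnion where
  open ListSum
  open Congruence
  open Tiling
  open Subsets
  open import Data.Integer.Base as ℤ using (ℤ; +_)
  open import Data.Nat.Base as ℕ using (ℕ; suc; NonZero; _<_; _≤_; _^_)
  open import Relation.Binary.PropositionalEquality

  module _ {n L : ℕ} .{{_ : NonZero L}} where

    translate : ℤ → ℤ²[ n , L ] → ℤ²[ n , L ]
    translate z (h , j) = h , j +ₘ residue L z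

    translate-Cong : ∀ z u → Cong L (+ toℕ (proj₂ (translate z u))) (+ toℕ (proj₂ u) ℤ.+ z)
    translate-Cong z (h , j) = Cong-trans (+ₘ-Cong j (residue L z)) (Cong-+ (Cong-refl {a = + toℕ j}) (residue-Cong L z))

    translate-inverse : ∀ z z′ → z ℤ.+ z′ ≡ + 0 → ∀ u → translate z (translate z′ u) ≡ u
    translate-inverse z z′ eq u@(h , j) = cong (h ,_) (Cong⇒≡ᶠ (Cong-trans (translate-Cong z (translate z′ u))
      (Cong-trans (Cong-+ (translate-Cong z′ u) (Cong-refl {a = z})) (≡⇒Cong (trans (ring (+ toℕ j) z z′)
        (trans (cong (λ w → + toℕ j ℤ.+ w) eq) (ℤ.+-identityʳ _)))))))
      where
      ring : ∀ j z z′ → j ℤ.+ z′ ℤ.+ z ≡ j ℤ.+ (z ℤ.+ z′)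
      ring = solve-∀

    module _ {p : ℕ} (η : ℤ) (E : Fin p → Subset ℤ²[ n , L ]) where

      -- Points are translated back and tested against each slice. This is a search over finitely
      -- many `r`, hence decidable, as a Boolean-valued subset requires.
      twistedUnion : Subset ℤ²[ n , L ]
      twistedUnion w = ⌊ any? (λ r → T? (E r (translate (ℤ.- (η ℤ.* + toℕ r)) w))) ⌋

      ∈twistedUnion : ∀ r {u} → u ∈ E r → translate (η ℤ.* + toℕ r) u ∈ twistedUnion
      ∈twistedUnion r {u} u∈E = fromWitness (r , subst (_∈ E r)
        (sym (translate-inverse (ℤ.- (η ℤ.* + toℕ r)) (η ℤ.* + toℕ r) (ℤ.+-inverseˡ (η ℤ.* + toℕ r)) u)) u∈E)

      twistedUnion∋ : ∀ {w} → w ∈ twistedUnion → ∃ λ r → ∃ λ u → u ∈ E r × translate (η ℤ.* + toℕ r) u ≡ w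
      twistedUnion∋ {w} w∈D with toWitness w∈D
      ... | r , u∈E = r , translate (ℤ.- (η ℤ.* + toℕ r)) w , u∈E ,
            translate-inverse (η ℤ.* + toℕ r) (ℤ.- (η ℤ.* + toℕ r)) (ℤ.+-inverseʳ (η ℤ.* + toℕ r)) w

  module _ {p K n : ℕ} .{{_ : NonZero p}} .{{_ : NonZero (p ^ K)}} .{{_ : NonZero (p ^ suc K)}} .{{_ : NonZero n}} where
    private
      L = p ^ K
      N = p ^ suc K

    -- A slice is a pullback along `unslice r`. Together these maps are a bijection from `p` copies
    -- of G onto the large group.
    unslice : Fin p → ℤ²[ n , L ] → ℤ²[ n , N ]
    unslice r (h , j) = h , (toℕ r ℕ.+ p ℕ.* toℕ j) mod N

    -- No wrap-around occurs, because `r + p j < p (j + 1)` and `j + 1` is at most `L`.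
    toℕ-unslice : ∀ r u → toℕ (proj₂ (unslice r u)) ≡ toℕ r ℕ.+ p ℕ.* toℕ (proj₂ u)
    toℕ-unslice r (h , j) = trans (toℕ-mod _ N) (m<n⇒m%n≡m (ℕ.<-≤-trans (ℕ.+-monoˡ-< (p ℕ.* toℕ j) (toℕ<n r))
      (ℕ.≤-trans (ℕ.≤-reflexive (sym (ℕ.*-suc p (toℕ j)))) (ℕ.*-monoʳ-≤ p (toℕ<n j)))))

    unslice-surjective : ∀ a → ∃ λ r → ∃ λ u → unslice r u ≡ a
    unslice-surjective (h , k) = r , (h , j) , cong (h ,_) (toℕ-injective (trans (toℕ-unslice r (h , j))
      (trans (cong₂ (λ x y → x ℕ.+ p ℕ.* y) (toℕ-fromℕ< (m%n<n (toℕ k) p)) (toℕ-fromℕ< k/p<L))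
        (sym (trans (m≡m%n+[m/n]*n (toℕ k) p) (cong (toℕ k % p ℕ.+_) (ℕ.*-comm (toℕ k / p) p)))))))
      where
      k/p<L : toℕ k / p < L
      k/p<L = m<n*o⇒m/o<n (subst (toℕ k <_) (ℕ.*-comm p L) (toℕ<n k))
      r = fromℕ< (m%n<n (toℕ k) p)
      j = fromℕ< k/p<L

    unslice-Cong : ∀ r u → Cong p (+ toℕ (proj₂ (unslice r u))) (+ toℕ r)
    unslice-Cong r u = subst (λ x → Cong p (+ x) (+ toℕ r)) (sym (toℕ-unslice r u))
      (cong-by (+ toℕ (proj₂ u)) (cong (λ x → + toℕ r ℤ.+ x) (trans (ℤ.pos-* p _) (ℤ.*-comm (+ p) _))))

    unslice-injective : ∀ r s u v → unslice r u ≡ unslice s v → r ≡ s × u ≡ v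
    unslice-injective r s (h , j) (h′ , j′) eq = r≡s , cong₂ _,_ (cong proj₁ eq)
      (toℕ-injective (ℕ.*-cancelˡ-≡ _ _ p (ℕ.+-cancelˡ-≡ (toℕ r) _ _
        (trans values (cong (λ t → toℕ t ℕ.+ p ℕ.* toℕ j′) (sym r≡s))))))
      where
      values : toℕ r ℕ.+ p ℕ.* toℕ j ≡ toℕ s ℕ.+ p ℕ.* toℕ j′
      values = trans (sym (toℕ-unslice r (h , j))) (trans (cong (λ a → toℕ (proj₂ a)) eq) (toℕ-unslice s (h′ , j′)))
      r≡s : r ≡ s
      r≡s = Cong⇒≡ᶠ (Cong-trans (Cong-sym (unslice-Cong r (h , j)))
        (Cong-trans (≡⇒Cong (cong (λ a → + toℕ (proj₂ a)) eq)) (unslice-Cong s (h′ , j′))))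

    module _ (P Q : Subset ℤ²[ n , N ]) (η : ℤ)
      (count : ∀ (h : ℤ) {q} → q < p → ∀ (e : ℕ → ℤ) →
        pairCount (λ (a , k) (b , l) → ∑ (upTo p) (λ r →
          ind n (+ (a ℕ.+ b)) h ℕ.* (ind p (+ k) (+ r) ℕ.* ind N (+ (k ℕ.+ l)) (+ r ℤ.+ + q ℤ.+ e r ℤ.* + p))))
          (exponents P) (exponents Q) ≡ 1)
      where
      private
        E C : Fin p → Subset ℤ²[ n , L ]
        E r u = P (unslice r u)
        C q v = Q (unslice q v)

        -- For the translate of `u` by `η r` and `v` to add up to the given point, the second
        -- coordinates of `u` and `v` must add up to `j - η r`; this is the multiple `e r` put into
        -- `count`.
        offset : ℤ²[ n , L ] → ℕ → ℤ
        offset (_ , j) r = + toℕ j ℤ.- η ℤ.* + r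

        term : Fin p → ℤ²[ n , L ] → ℤ²[ n , N ] → ℤ²[ n , N ] → ℕ → ℕ
        term q g (a , k) (b , l) r =
          ind n (+ (toℕ a ℕ.+ toℕ b)) (+ toℕ (proj₁ g)) ℕ.*
            (ind p (+ toℕ k) (+ r) ℕ.* ind N (+ (toℕ k ℕ.+ toℕ l)) (+ r ℤ.+ + toℕ q ℤ.+ offset g r ℤ.* + p))

        χ : Fin p → ℤ²[ n , L ] → ℤ²[ n , N ] × ℤ²[ n , N ] → ℕ
        χ q g (a , b) = ∑ (upTo p) (term q g a b)

        χ-total : ∀ q g → ∑ (pairs P Q) (χ q g) ≡ 1
        χ-total q g = trans (sym (pairCount-exponents P Q _)) (count (+ toℕ (proj₁ g)) (toℕ<n q) (offset g))

        Solution : Fin p → ℤ²[ n , L ] → Fin p → ℤ²[ n , L ] → ℤ²[ n , L ] → Set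
        Solution q g r u v = u ∈ E r × v ∈ C q × translate (η ℤ.* + toℕ r) u ⊞ v ≡ g

        factors≥1 : ∀ x y → 1 ≤ x ℕ.* y → 1 ≤ x × 1 ≤ y
        factors≥1 (suc x) (suc y) _ = ℕ.s≤s ℕ.z≤n , ℕ.s≤s ℕ.z≤n
        factors≥1 (suc x) 0 le with subst (1 ≤_) (ℕ.*-zeroʳ x) le
        ... | ()

        term≥1 : ∀ q g a b t → 1 ≤ term q g a b t →
          Cong n (+ (toℕ (proj₁ a) ℕ.+ toℕ (proj₁ b))) (+ toℕ (proj₁ g)) ×
          Cong p (+ toℕ (proj₂ a)) (+ t) ×
          Cong N (+ (toℕ (proj₂ a) ℕ.+ toℕ (proj₂ b))) (+ t ℤ.+ + toℕ q ℤ.+ offset g t ℤ.* + p)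
        term≥1 q g (a , k) (b , l) t le = ind≥1⇒Cong (proj₁ outer) , ind≥1⇒Cong (proj₁ inner) , ind≥1⇒Cong (proj₂ inner)
          where
          i₁ = ind n (+ (toℕ a ℕ.+ toℕ b)) (+ toℕ (proj₁ g))
          i₂ = ind p (+ toℕ k) (+ t)
          i₃ = ind N (+ (toℕ k ℕ.+ toℕ l)) (+ t ℤ.+ + toℕ q ℤ.+ offset g t ℤ.* + p)
          outer = factors≥1 i₁ (i₂ ℕ.* i₃) le
          inner = factors≥1 i₂ i₃ (proj₂ outer)

        unslice-sum : ∀ r q u v → + (toℕ (proj₂ (unslice r u)) ℕ.+ toℕ (proj₂ (unslice q v)))
          ≡ + toℕ r ℤ.+ + toℕ q ℤ.+ (+ toℕ (proj₂ u) ℤ.+ + toℕ (proj₂ v)) ℤ.* + p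
        unslice-sum r q u v = trans (cong₂ (λ x y → + x ℤ.+ + y) (toℕ-unslice r u) (toℕ-unslice q v))
          (trans (cong₂ (λ x y → + toℕ r ℤ.+ x ℤ.+ (+ toℕ q ℤ.+ y)) (ℤ.pos-* p _) (ℤ.pos-* p _))
            (ring (+ toℕ r) (+ toℕ q) (+ p) (+ toℕ (proj₂ u)) (+ toℕ (proj₂ v))))
          where
          ring : ∀ r q p x y → r ℤ.+ p ℤ.* x ℤ.+ (q ℤ.+ p ℤ.* y) ≡ r ℤ.+ q ℤ.+ (x ℤ.+ y) ℤ.* p
          ring = solve-∀

        Solves : ∀ r (u v g : ℤ²[ n , L ]) → Set
        Solves r u v g = Cong L (+ toℕ (proj₂ u) ℤ.+ η ℤ.* + toℕ {p} r ℤ.+ + toℕ (proj₂ v)) (+ toℕ (proj₂ g))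

        LiftSolves : ∀ r (q : Fin p) (u v g : ℤ²[ n , L ]) → Set
        LiftSolves r q u v g = Cong N (+ (toℕ (proj₂ (unslice r u)) ℕ.+ toℕ (proj₂ (unslice q v))))
                                      (+ toℕ r ℤ.+ + toℕ q ℤ.+ offset g (toℕ r) ℤ.* + p)

        offset-ring : ∀ x y z g → x ℤ.+ y ℤ.+ z ℤ.- g ≡ x ℤ.+ z ℤ.- (g ℤ.- y)
        offset-ring = solve-∀

        -- Multiplication by `p` carries congruences modulo `L` to congruences modulo `N = p L`;
        -- adding `r + q` gives the sum of the lifted points.
        lift-solves : ∀ r q u v g → Solves r u v g → LiftSolves r q u v g
        lift-solves r q u@(_ , i) v@(_ , j) g@(_ , k) c = Cong-trans (≡⇒Cong (unslice-sum r q u v))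
          (Cong-+ (Cong-refl {a = + toℕ r ℤ.+ + toℕ q})
            (Cong-scale {a = + toℕ i ℤ.+ + toℕ j} {b = offset g (toℕ r)} p (Cong-shift (offset-ring (+ toℕ i) (η ℤ.* + toℕ r) (+ toℕ j) (+ toℕ k)) c)))

        solves-lift : ∀ r q u v g → LiftSolves r q u v g → Solves r u v g
        solves-lift r q u@(_ , i) v@(_ , j) g@(_ , k) c =
          Cong-shift (sym (offset-ring (+ toℕ i) (η ℤ.* + toℕ r) (+ toℕ j) (+ toℕ k)))
            (Cong-unscale {a = x} {b = offset g (toℕ r)} p (subst (λ m → Cong m (x ℤ.* + p) (offset g (toℕ r) ℤ.* + p)) (ℕ.*-comm p L)
              (Cong-shift (ring (+ toℕ r ℤ.+ + toℕ q) (x ℤ.* + p) (offset g (toℕ r) ℤ.* + p))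
                (Cong-trans (≡⇒Cong (sym (unslice-sum r q u v))) c))))
          where
          x = + toℕ i ℤ.+ + toℕ j
          ring : ∀ c x y → c ℤ.+ x ℤ.- (c ℤ.+ y) ≡ x ℤ.- y
          ring = solve-∀

        second-coordinate : ∀ r (u v : ℤ²[ n , L ]) → Cong L (+ toℕ (proj₂ (translate (η ℤ.* + toℕ {p} r) u ⊞ v)))
                                             (+ toℕ (proj₂ u) ℤ.+ η ℤ.* + toℕ r ℤ.+ + toℕ (proj₂ v))
        second-coordinate r u v = Cong-trans (+ₘ-Cong (proj₂ (translate (η ℤ.* + toℕ r) u)) (proj₂ v))
          (Cong-+ (translate-Cong (η ℤ.* + toℕ r) u) (Cong-refl {a = + toℕ (proj₂ v)}))

        solution⇒χ : ∀ q g r u v → Solution q g r u v → 1 ≤ χ q g (unslice r u , unslice q v)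
        solution⇒χ q g r u v (_ , _ , refl) = ℕ.≤-trans (ℕ.≤-reflexive (sym term≡1))
          (f≤∑ (term q g (unslice r u) (unslice q v)) (∈-upTo⁺ (toℕ<n r)))
          where
          term≡1 : term q g (unslice r u) (unslice q v) (toℕ r) ≡ 1
          term≡1 = cong₂ ℕ._*_ (ind-yes (Cong-sym (+ₘ-Cong (proj₁ u) (proj₁ v))))
            (cong₂ ℕ._*_ (ind-yes (unslice-Cong r u))
              (ind-yes (lift-solves r q u v g (Cong-sym (second-coordinate r u v)))))

      -- Both solutions lift to pairs counted by `χ`, whose total is 1, and `unslice` also
      -- determines the slice index. As `r` and `s` may differ, this yields disjointness of the
      -- slices too.
      solution-unique : ∀ q g r u v s u′ v′ → Solution q g r u v → Solution q g s u′ v′ → r ≡ s × u ≡ u′ × v ≡ v′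
      solution-unique q g r u v s u′ v′ S@(u∈E , v∈C , _) S′@(u′∈E , v′∈C , _) =
        proj₁ first , proj₂ first , proj₂ (unslice-injective q q v v′ (cong proj₂ same))
        where
        same : (unslice r u , unslice q v) ≡ (unslice s u′ , unslice q v′)
        same = ∑≡1⇒unique (χ q g) (χ-total q g) (∈pairs P Q u∈E v∈C) (∈pairs P Q u′∈E v′∈C)
          (solution⇒χ q g r u v S) (solution⇒χ q g s u′ v′ S′)
        first = unslice-injective r s u u′ (cong proj₁ same)

      solution-exists : ∀ q g → ∃ λ r → ∃ λ u → ∃ λ v → Solution q g r u v
      solution-exists q g = from-pair (∑≥1⇒∃ (pairs P Q) (χ q g) (ℕ.≤-reflexive (sym (χ-total q g))))
        where
        from-pair : (∃ λ ab → ab ∈ˡ pairs P Q × 1 ≤ χ q g ab) → ∃ λ r → ∃ λ u → ∃ λ v → Solution q g r u v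
        from-pair ((a , b) , ab∈ , χ≥1) =
          from-slices (unslice-surjective a) (unslice-surjective b) (∑≥1⇒∃ (upTo p) (term q g a b) χ≥1)
          where
          from-slices : (∃ λ r → ∃ λ u → unslice r u ≡ a) → (∃ λ s → ∃ λ v → unslice s v ≡ b) →
                        (∃ λ t → t ∈ˡ upTo p × 1 ≤ term q g a b t) →
                        ∃ λ r → ∃ λ u → ∃ λ v → Solution q g r u v
          from-slices (r , u , refl) (s , v , refl) (t , t∈ , le) =
            r , u , v , proj₁ (pairs⇒∈ P Q ab∈) , subst (λ s → v ∈ C s) s≡q (proj₂ (pairs⇒∈ P Q ab∈)) ,
            cong₂ _,_ (Cong⇒+ₘ≡ (proj₁ u) (proj₁ v) (proj₁ congruences))
                      (Cong⇒≡ᶠ (Cong-trans (second-coordinate r u v) (solves-lift r q u v g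
                        (subst₂ (λ s t → Cong N (+ (toℕ (proj₂ (unslice r u)) ℕ.+ toℕ (proj₂ (unslice s v))))
                                                (+ t ℤ.+ + toℕ q ℤ.+ offset g t ℤ.* + p)) s≡q (sym r≡t) sum≡))))
            where
            congruences = term≥1 q g (unslice r u) (unslice s v) t le
            k≡t : Cong p (+ toℕ (proj₂ (unslice r u))) (+ t)
            k≡t = proj₁ (proj₂ congruences)
            sum≡ : Cong N (+ (toℕ (proj₂ (unslice r u)) ℕ.+ toℕ (proj₂ (unslice s v)))) (+ t ℤ.+ + toℕ q ℤ.+ offset g t ℤ.* + p)
            sum≡ = proj₂ (proj₂ congruences)
            r≡t : toℕ r ≡ t
            r≡t = Cong⇒≡ (toℕ<n r) (∈-upTo⁻ t∈) (Cong-trans (Cong-sym (unslice-Cong r u)) k≡t)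
            s≡q : s ≡ q
            -- Modulo `p` the sum is `t + q`; removing the first summand, which is `t`, leaves `q`.
            s≡q = Cong⇒≡ᶠ (Cong-trans (Cong-sym (unslice-Cong s v)) (Cong-shift
              (ring (+ toℕ (proj₂ (unslice r u))) (+ toℕ (proj₂ (unslice s v))) (+ t) (+ toℕ q))
              (Cong-- (Cong-trans (Cong-coarsen L (subst (λ m → Cong m (+ (toℕ (proj₂ (unslice r u)) ℕ.+ toℕ (proj₂ (unslice s v)))) (+ t ℤ.+ + toℕ q ℤ.+ offset g t ℤ.* + p)) (ℕ.*-comm p L) sum≡))
                        (Cong-multiple (+ t ℤ.+ + toℕ q) (offset g t))) k≡t)))
              where
              ring : ∀ k l t q → k ℤ.+ l ℤ.- k ℤ.- (t ℤ.+ q ℤ.- t) ≡ l ℤ.- q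
              ring = solve-∀

      twistedUnion-tiles : ∀ q → Tiles (twistedUnion η E) (C q)
      twistedUnion-tiles q g = from-solution (solution-exists q g)
        where
        from-solution : (∃ λ r → ∃ λ u → ∃ λ v → Solution q g r u v) →
          ∃! {A = ℤ²[ n , L ] × ℤ²[ n , L ]} _≡_ λ (w , v) → w ∈ twistedUnion η E × v ∈ C q × w ⊞ v ≡ g
        from-solution (r , u , v , S@(u∈E , v∈C , eq)) =
          (translate (η ℤ.* + toℕ r) u , v) , (∈twistedUnion η E r u∈E , v∈C , eq) , unique
          where
          unique : ∀ {w} → proj₁ w ∈ twistedUnion η E × proj₂ w ∈ C q × proj₁ w ⊞ proj₂ w ≡ g →
                   (translate (η ℤ.* + toℕ r) u , v) ≡ w
          unique {w , v′} (w∈D , v′∈C , eq′) = compare (twistedUnion∋ η E w∈D)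
            where
            compare : (∃ λ s → ∃ λ u′ → u′ ∈ E s × translate (η ℤ.* + toℕ s) u′ ≡ w) →
                      (translate (η ℤ.* + toℕ r) u , v) ≡ (w , v′)
            compare (s , u′ , u′∈E , refl) with solution-unique q g r u v s u′ v′ S (u′∈E , v′∈C , eq′)
            ... | refl , refl , refl = refl

      -- Adding one element `v` of `C r` to a common point of two translated slices gives two
      -- solutions for the same target.
      slices-disjoint : ∀ r s u u′ → u ∈ E r → u′ ∈ E s →
        translate (η ℤ.* + toℕ r) u ≡ translate (η ℤ.* + toℕ s) u′ → r ≡ s
      -- The target `u` is arbitrary here; the call supplies an element of `C r`.
      slices-disjoint r s u u′ u∈E u′∈E eq = with-C (solution-exists r u)
        where
        with-C : (∃ λ r′ → ∃ λ w → ∃ λ v → Solution r u r′ w v) → r ≡ s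
        with-C (_ , _ , v , _ , v∈C , _) = proj₁ (solution-unique r (translate (η ℤ.* + toℕ r) u ⊞ v) r u v s u′ v
          (u∈E , v∈C , refl) (u′∈E , v∈C , cong (_⊞ v) (sym eq)))

-- Masks of translates, unions and slices.

module Masks where
  open Congruence
  open RingPowers
  open Subsets
  open TwistedUnion
  open import Data.Integer.Base as ℤ using (ℤ; +_; -[1+_])
  open import Data.Nat.Base as ℕ using (ℕ; zero; suc; NonZero; _∸_)
  open import Relation.Binary.PropositionalEquality as ≡ using (_≡_; _≢_; cong; subst)

  private
    variable
      c ℓ : Level

  -- The natural exponent inside `y^`: for negative arguments -1 is represented by `L ∸ 1`.
  twistExponent : ℕ → ℤ → ℕ
  twistExponent L (+ k)    = k
  twistExponent L -[1+ k ] = (L ∸ 1) ℕ.* suc k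

  twistExponent-Cong : ∀ L .{{_ : NonZero L}} z → Cong L (+ twistExponent L z) z
  twistExponent-Cong (suc L) (+ k)    = Cong-refl
  twistExponent-Cong (suc L) -[1+ k ] = cong-by (+ suc k) (≡.trans (ℤ.pos-* L (suc k)) (expand (+ L) (+ suc k)))
    where
    expand : ∀ l k → l ℤ.* k ≡ ℤ.- k ℤ.+ k ℤ.* (+ 1 ℤ.+ l)
    expand = solve-∀

  module _ (𝓢 : CommutativeRing c ℓ) where
    open CommutativeRing 𝓢 hiding (zero)
    open SemiringExp commutativeSemiring using (_^_; ^-homo-*)
    open SemiringSum semiring using (sum; sum-cong-≋; sum-replicate-zero; *-distribˡ-sum)
    open MonoidSum +-commutativeMonoid using (∑-comm; sum-permute)
    open CommutativeSemigroupProperties *-commutativeSemigroup using (x∙yz≈y∙xz)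
    open SetoidReasoning setoid

    private
      sum-append : ∀ a b (G : ℕ → Carrier) →
        sum {a ℕ.+ b} (λ i → G (toℕ i)) ≈ sum {a} (λ i → G (toℕ i)) + sum {b} (λ i → G (a ℕ.+ toℕ i))
      sum-append zero    b G = sym (+-identityˡ _)
      sum-append (suc a) b G = trans (+-congˡ (sum-append a b (λ i → G (suc i)))) (sym (+-assoc _ _ _))

      sum-blocks : ∀ p L (G : ℕ → Carrier) →
        sum {L ℕ.* p} (λ i → G (toℕ i)) ≈ sum {L} (λ j → sum {p} (λ r → G (toℕ r ℕ.+ p ℕ.* toℕ j)))
      sum-blocks p zero    G = refl
      sum-blocks p (suc L) G = trans (sum-append p (L ℕ.* p) G) (+-cong
        (sum-cong-≋ {p} λ r → reflexive (cong G (≡.sym (≡.trans (cong (toℕ r ℕ.+_) (ℕ.*-zeroʳ p)) (ℕ.+-identityʳ _)))))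
        (trans (sum-blocks p L (λ i → G (p ℕ.+ i))) (sum-cong-≋ {L} λ j → sum-cong-≋ {p} λ r →
          reflexive (cong G (arith p (toℕ r) (toℕ j))))))
        where
        arith : ∀ p r j → p ℕ.+ (r ℕ.+ p ℕ.* j) ≡ r ℕ.+ p ℕ.* suc j
        arith = solveℕ-∀

    -- Division with remainder by `p`: the range splits into `L` blocks of length `p`, and the two
    -- sums are exchanged. Through `G` the summand is defined on all of ℕ, so the length can be
    -- rewritten from `p L` to `L p`.
    sum-residues : ∀ p L .{{_ : NonZero (p ℕ.* L)}} (F : Fin (p ℕ.* L) → Carrier) →
      sum F ≈ sum {p} (λ r → sum {L} (λ j → F ((toℕ r ℕ.+ p ℕ.* toℕ j) mod (p ℕ.* L))))
    sum-residues p L F = begin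
      sum F
        ≈⟨ sum-cong-≋ (λ k → reflexive (cong F (toℕ-injective (≡.sym (≡.trans (toℕ-mod (toℕ k) (p ℕ.* L)) (m<n⇒m%n≡m (toℕ<n k))))))) ⟩
      sum {p ℕ.* L} (λ k → G (toℕ k))
        ≡⟨ cong (λ m → sum {m} (λ k → G (toℕ k))) (ℕ.*-comm p L) ⟩
      sum {L ℕ.* p} (λ k → G (toℕ k))
        ≈⟨ sum-blocks p L G ⟩
      sum {L} (λ j → sum {p} (λ r → G (toℕ r ℕ.+ p ℕ.* toℕ j)))
        ≈⟨ ∑-comm {L} {p} (λ j r → G (toℕ r ℕ.+ p ℕ.* toℕ j)) ⟩
      sum {p} (λ r → sum {L} (λ j → G (toℕ r ℕ.+ p ℕ.* toℕ j))) ∎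
      where
      G : ℕ → Carrier
      G x = F (x mod (p ℕ.* L))

    private
      select : Bool → Carrier → Carrier
      select b x = if b then x else 0#

      select-cong : ∀ b {x y} → x ≈ y → select b x ≈ select b y
      select-cong true  eq = eq
      select-cong false eq = refl

      *-select : ∀ b x y → x * select b y ≈ select b (x * y)
      *-select true  x y = refl
      *-select false x y = zeroʳ x

    -- With the second variable equal to 1, the change of exponent from `r + p j` to `j` is
    -- invisible, and the partition into residue classes gives the identity.
    mask-slices : ∀ {n} p K .{{_ : NonZero p}} (X : Subset ℤ²[ n , p ℕ.^ suc K ]) u →
      mask rawRing X u 1# ≈ sum (λ r → mask rawRing (slice p (suc K) X r) u 1#)
    mask-slices {n} p K X u = begin
      sum (λ h → sum (λ k → select (X (h , k)) (u ^ toℕ h * 1# ^ toℕ k)))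
        ≈⟨ sum-cong-≋ {n} (λ h → sum-residues p (p ℕ.^ K) {{N≢0}} (λ k → select (X (h , k)) (u ^ toℕ h * 1# ^ toℕ k))) ⟩
      sum (λ h → sum {p} (λ r → sum {p ℕ.^ K} (λ j → select (slice p (suc K) X r (h , j)) (u ^ toℕ h * 1# ^ toℕ (lifted r j)))))
        ≈⟨ sum-cong-≋ {n} (λ h → sum-cong-≋ {p} λ r → sum-cong-≋ {p ℕ.^ K} λ j → select-cong (slice p (suc K) X r (h , j))
             (*-congˡ (trans (1^≈1 𝓢 (toℕ (lifted r j))) (sym (1^≈1 𝓢 (toℕ j)))))) ⟩
      sum (λ h → sum {p} (λ r → sum {p ℕ.^ K} (λ j → select (slice p (suc K) X r (h , j)) (u ^ toℕ h * 1# ^ toℕ j))))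
        ≈⟨ ∑-comm {n} {p} (λ h r → sum {p ℕ.^ K} (λ j → select (slice p (suc K) X r (h , j)) (u ^ toℕ h * 1# ^ toℕ j))) ⟩
      sum (λ r → mask rawRing (slice p (suc K) X r) u 1#) ∎
      where
      N≢0 : NonZero (p ℕ.^ suc K)
      N≢0 = ℕ.m^n≢0 p (suc K)
      lifted : Fin p → Fin (p ℕ.^ K) → Fin (p ℕ.^ suc K)
      lifted r j = ((toℕ r ℕ.+ p ℕ.* toℕ j) mod (p ℕ.^ suc K)) {{N≢0}}

    module _ {n L : ℕ} .{{_ : NonZero L}} (u v : Carrier) (v^L≈1 : v ^ L ≈ 1#) where

      private
        v^-Cong : ∀ {a b} → Cong L (+ a) (+ b) → v ^ a ≈ v ^ b
        v^-Cong {a} {b} c = trans (^-% 𝓢 L v^L≈1 a) (trans (reflexive (cong (v ^_) a%L≡b%L)) (sym (^-% 𝓢 L v^L≈1 b)))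
          where
          a%L≡b%L : a % L ≡ b % L
          a%L≡b%L = ≡.trans (≡.sym (toℕ-mod a L)) (≡.trans
            (cong toℕ (Cong⇒≡ᶠ {i = a mod L} {b mod L} (Cong-trans (mod-Cong a L) (Cong-trans c (Cong-sym (mod-Cong b L))))))
            (toℕ-mod b L))

        rotate : ℤ → Permutation L L
        rotate z = permutation (λ k → k +ₘ residue L z) (λ k → k +ₘ residue L (ℤ.- z)) (back (ℤ.- z) z (ℤ.+-inverseˡ z)) (back z (ℤ.- z) (ℤ.+-inverseʳ z))
          where
          back : ∀ z z′ → z ℤ.+ z′ ≡ + 0 → ∀ k → (k +ₘ residue L z) +ₘ residue L z′ ≡ k
          back z z′ eq k = Cong⇒≡ᶠ (Cong-trans (+ₘ-Cong (k +ₘ residue L z) (residue L z′))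
            (Cong-trans (Cong-+ (Cong-trans (+ₘ-Cong k (residue L z)) (Cong-+ (Cong-refl {a = + toℕ k}) (residue-Cong L z))) (residue-Cong L z′))
              (≡⇒Cong (≡.trans (ℤ.+-assoc (+ toℕ k) z z′) (≡.trans (cong (λ w → + toℕ k ℤ.+ w) eq) (ℤ.+-identityʳ _))))))

      -- The summation index is rotated by `-z`; the exponent of `v` returns to `k` modulo `L`,
      -- which suffices since `v ^ L` is 1.
      mask-translate : ∀ (X : Subset ℤ²[ n , L ]) z →
        v ^ twistExponent L z * mask rawRing X u v
        ≈ sum (λ h → sum (λ k → select (X (translate (ℤ.- z) (h , k))) (u ^ toℕ h * v ^ toℕ k)))
      mask-translate X z = trans (*-distribˡ-sum {n} e (λ h → sum (λ k → select (X (h , k)) (u ^ toℕ h * v ^ toℕ k)))) (sum-cong-≋ {n} λ h → begin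
        e * sum (λ k → select (X (h , k)) (u ^ toℕ h * v ^ toℕ k))
          ≈⟨ *-distribˡ-sum {L} e (λ k → select (X (h , k)) (u ^ toℕ h * v ^ toℕ k)) ⟩
        sum (λ k → e * select (X (h , k)) (u ^ toℕ h * v ^ toℕ k))
          ≈⟨ sum-permute (λ k → e * select (X (h , k)) (u ^ toℕ h * v ^ toℕ k)) (rotate (ℤ.- z)) ⟩
        sum (λ k → e * select (X (translate (ℤ.- z) (h , k))) (u ^ toℕ h * v ^ toℕ (back k)))
          ≈⟨ sum-cong-≋ {L} (λ k → trans (*-select (X (translate (ℤ.- z) (h , k))) e _)
               (select-cong (X (translate (ℤ.- z) (h , k))) (trans (x∙yz≈y∙xz e (u ^ toℕ h) (v ^ toℕ (back k)))
                 (*-congˡ (trans (sym (^-homo-* v (twistExponent L z) (toℕ (back k)))) (v^-Cong (returns k))))))) ⟩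
        sum (λ k → select (X (translate (ℤ.- z) (h , k))) (u ^ toℕ h * v ^ toℕ k)) ∎)
        where
        e = v ^ twistExponent L z
        back : Fin L → Fin L
        back k = k +ₘ residue L (ℤ.- z)
        expand : ∀ z k → z ℤ.+ (k ℤ.+ ℤ.- z) ≡ k
        expand = solve-∀
        returns : ∀ k → Cong L (+ (twistExponent L z ℕ.+ toℕ (back k))) (+ toℕ k)
        returns k = Cong-trans (Cong-+ (twistExponent-Cong L z)
          (Cong-trans (+ₘ-Cong k (residue L (ℤ.- z))) (Cong-+ (Cong-refl {a = + toℕ k}) (residue-Cong L (ℤ.- z)))))
          (≡⇒Cong (expand z (+ toℕ k)))

      -- By disjointness at most one slice contributes at each point, so the sum of the selections
      -- is the selection of the union. A general `v` with `v ^ L` equal to 1 covers both y and 1.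
      mask-twistedUnion : ∀ {p} η (E : Fin p → Subset ℤ²[ n , L ]) (y : Fin p → Carrier) →
        (∀ r → y r ≈ v ^ twistExponent L (η ℤ.* + toℕ r)) →
        (∀ r s w w′ → w ∈ E r → w′ ∈ E s → translate (η ℤ.* + toℕ r) w ≡ translate (η ℤ.* + toℕ s) w′ → r ≡ s) →
        sum (λ r → y r * mask rawRing (E r) u v) ≈ mask rawRing (twistedUnion η E) u v
      mask-twistedUnion {p} η E y y≈v^ disjoint = begin
        sum (λ r → y r * mask rawRing (E r) u v)
          ≈⟨ sum-cong-≋ {p} (λ r → trans (*-congʳ (y≈v^ r)) (mask-translate (E r) (η ℤ.* + toℕ r))) ⟩
        sum (λ r → sum (λ h → sum (λ k → select (piece (h , k) r) (u ^ toℕ h * v ^ toℕ k))))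
          ≈⟨ ∑-comm {p} {n} (λ r h → sum (λ k → select (piece (h , k) r) (u ^ toℕ h * v ^ toℕ k))) ⟩
        sum (λ h → sum (λ r → sum (λ k → select (piece (h , k) r) (u ^ toℕ h * v ^ toℕ k))))
          ≈⟨ sum-cong-≋ {n} (λ h → ∑-comm {p} {L} (λ r k → select (piece (h , k) r) (u ^ toℕ h * v ^ toℕ k))) ⟩
        sum (λ h → sum (λ k → sum (λ r → select (piece (h , k) r) (u ^ toℕ h * v ^ toℕ k))))
          ≈⟨ sum-cong-≋ {n} (λ h → sum-cong-≋ {L} λ k → select-union (h , k) (u ^ toℕ h * v ^ toℕ k)) ⟩
        mask rawRing (twistedUnion η E) u v ∎
        where
        piece : ℤ²[ n , L ] → Fin p → Bool
        piece w r = E r (translate (ℤ.- (η ℤ.* + toℕ r)) w)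

        restore : ∀ r w → translate (η ℤ.* + toℕ r) (translate (ℤ.- (η ℤ.* + toℕ r)) w) ≡ w
        restore r w = translate-inverse (η ℤ.* + toℕ r) (ℤ.- (η ℤ.* + toℕ r)) (ℤ.+-inverseʳ (η ℤ.* + toℕ r)) w

        piece⇒union : ∀ w r → piece w r ≡ true → twistedUnion η E w ≡ true
        piece⇒union w r eq = subst (λ w → twistedUnion η E w ≡ true) (restore r w)
          (Equivalence.to T-≡ (∈twistedUnion η E r (Equivalence.from T-≡ eq)))

        union⇒piece : ∀ w → twistedUnion η E w ≡ true → ∃ λ r → piece w r ≡ true
        union⇒piece w eq = from-translate (twistedUnion∋ η E (Equivalence.from T-≡ eq))
          where
          from-translate : (∃ λ r → ∃ λ x → x ∈ E r × translate (η ℤ.* + toℕ r) x ≡ w) → ∃ λ r → piece w r ≡ true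
          from-translate (r , x , x∈E , ≡.refl) = r , Equivalence.to T-≡ (subst (_∈ E r)
            (≡.sym (translate-inverse (ℤ.- (η ℤ.* + toℕ r)) (η ℤ.* + toℕ r) (ℤ.+-inverseˡ (η ℤ.* + toℕ r)) x)) x∈E)

        piece-unique : ∀ w r s → piece w r ≡ true → piece w s ≡ true → r ≡ s
        piece-unique w r s eq eq′ = disjoint r s _ _ (Equivalence.from T-≡ eq) (Equivalence.from T-≡ eq′)
          (≡.trans (restore r w) (≡.sym (restore s w)))

        select-union : ∀ w x → sum (λ r → select (piece w r) x) ≈ select (twistedUnion η E w) x
        select-union w x = by-cases (twistedUnion η E w) ≡.refl
          where
          by-cases : ∀ b → twistedUnion η E w ≡ b → sum (λ r → select (piece w r) x) ≈ select (twistedUnion η E w) x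
          by-cases false eq = begin
            sum (λ r → select (piece w r) x)
              ≈⟨ sum-cong-≋ {p} (λ r → reflexive (cong (λ b → select b x)
                   (¬-not λ eq′ → false≢true (≡.trans (≡.sym eq) (piece⇒union w r eq′))))) ⟩
            sum {p} (λ r → 0#)                 ≈⟨ sum-replicate-zero p ⟩
            0#                                 ≡⟨ cong (λ b → select b x) eq ⟨
            select (twistedUnion η E w) x      ∎
            where
            false≢true : false ≢ true
            false≢true ()
          by-cases true eq = one-piece (union⇒piece w eq)
            where
            one-piece : (∃ λ r → piece w r ≡ true) → sum (λ r → select (piece w r) x) ≈ select (twistedUnion η E w) x
            one-piece (r , eq′) = begin
              sum (λ r → select (piece w r) x)
                ≈⟨ sum-single 𝓢 _ r (λ s s≢r → reflexive (cong (λ b → select b x)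
                     (¬-not λ eq″ → s≢r (piece-unique w s r eq″ eq′)))) ⟩
              select (piece w r) x             ≡⟨ cong (λ b → select b x) (≡.trans eq′ (≡.sym eq)) ⟩
              select (twistedUnion η E w) x    ∎

    -- The case `v = 1`, where all twisting factors are 1, followed by the decomposition of the mask
    -- into slices.
    mask-twistedUnion-at-1 : ∀ {n p} K .{{_ : NonZero p}} .{{_ : NonZero (p ℕ.^ K)}} η (X : Subset ℤ²[ n , p ℕ.^ suc K ]) u →
      let E = slice p (suc K) X in
      (∀ r s w w′ → w ∈ E r → w′ ∈ E s → translate (η ℤ.* + toℕ r) w ≡ translate (η ℤ.* + toℕ s) w′ → r ≡ s) →
      mask rawRing (twistedUnion η E) u 1# ≈ mask rawRing X u 1#
    mask-twistedUnion-at-1 {n} {p} K η X u disjoint = begin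
      mask rawRing (twistedUnion η E) u 1#
        ≈⟨ mask-twistedUnion u 1# (1^≈1 𝓢 L) η E (λ _ → 1#) (λ r → sym (1^≈1 𝓢 (twistExponent L (η ℤ.* + toℕ r)))) disjoint ⟨
      sum (λ r → 1# * mask rawRing (E r) u 1#)
        ≈⟨ sum-cong-≋ {p} (λ r → *-identityˡ _) ⟩
      sum (λ r → mask rawRing (E r) u 1#)
        ≈⟨ mask-slices p K X u ⟨
      mask rawRing X u 1# ∎
      where
      L = p ℕ.^ K
      E = slice p (suc K) X

-- Vanishing of the mask at ζ, and the theorem.

open import Defs
open import Data.Integer.Base using (ℤ; +_) renaming (_*_ to _*ℤ_)
open import Data.Nat.Base using (ℕ; _≤_; _∸_; _^_)
open import Relation.Binary.PropositionalEquality using (_≡_; _≢_)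
open import Relation.Unary using (_⊥_)

open Columns
open Equidistribution
open Masks
open QuotientRing
open RingPowers
open RootsOfUnity
open Subsets
open TwistedUnion
open import Data.Integer.Base using (-[1+_])
open import Data.Nat.Base using (zero; suc; NonZero; >-nonZero)
open import Data.Nat.Properties using (m^n≢0)
open import Relation.Binary.PropositionalEquality using (refl; sym; trans; cong₂)

module _ {c ℓ₁ ℓ₂} (𝔽 : HeytingField c ℓ₁ ℓ₂) (char0 : CharacteristicZero 𝔽) where
  private
    𝓡 = HeytingCommutativeRing.commutativeRing (HeytingField.heytingCommutativeRing 𝔽)
    module F = CommutativeRing 𝓡
    open SemiringExp F.commutativeSemiring using () renaming (_^_ to _^ᶠ_)
    open SemiringSum F.semiring using (sum; sum-cong-≋)

    Σᶠ : ∀ {a} {A : Set a} → List A → (A → F.Carrier) → F.Carrier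
    Σᶠ = ∑ᶠ 𝔽 char0

    Σᶠ-++ : ∀ {a} {A : Set a} (xs ys : List A) f → Σᶠ (xs ++ ys) f F.≈ Σᶠ xs f F.+ Σᶠ ys f
    Σᶠ-++ []       ys f = F.sym (F.+-identityˡ _)
    Σᶠ-++ (x ∷ xs) ys f = F.trans (F.+-congˡ (Σᶠ-++ xs ys f)) (F.sym (F.+-assoc _ _ _))

    Σᶠ-map : ∀ {a b} {A : Set a} {B : Set b} (g : A → B) xs f → Σᶠ (map g xs) f F.≈ Σᶠ xs (λ x → f (g x))
    Σᶠ-map g []       f = F.refl
    Σᶠ-map g (x ∷ xs) f = F.+-congˡ (Σᶠ-map g xs f)

    Σᶠ-filter : ∀ {a} {A : Set a} (X : Subset A) xs f →
      Σᶠ (filter (λ u → T? (X u)) xs) f F.≈ Σᶠ xs (λ u → if X u then f u else F.0#)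
    Σᶠ-filter X []       f = F.refl
    Σᶠ-filter X (x ∷ xs) f with X x
    ... | true  = F.+-congˡ (Σᶠ-filter X xs f)
    ... | false = F.trans (Σᶠ-filter X xs f) (F.sym (F.+-identityˡ _))

    Σᶠ-cartesianProduct : ∀ {a b} {A : Set a} {B : Set b} (xs : List A) (ys : List B) f →
      Σᶠ (cartesianProduct xs ys) f F.≈ Σᶠ xs (λ x → Σᶠ ys (λ y → f (x , y)))
    Σᶠ-cartesianProduct []       ys f = F.refl
    Σᶠ-cartesianProduct (x ∷ xs) ys f = F.trans (Σᶠ-++ (map (x ,_) ys) _ f)
      (F.+-cong (Σᶠ-map (x ,_) ys f) (Σᶠ-cartesianProduct xs ys f))

    Σᶠ-tabulate : ∀ {a} {A : Set a} {m} (g : Fin m → A) f → Σᶠ (tabulate g) f F.≈ sum (λ i → f (g i))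
    Σᶠ-tabulate {m = zero}  g f = F.refl
    Σᶠ-tabulate {m = suc m} g f = F.+-congˡ (Σᶠ-tabulate (λ i → g (suc i)) f)

  mask-exponents : ∀ {n m} (X : Subset ℤ²[ n , m ]) ζ →
    ∑ᶠ 𝔽 char0 (exponents X) (λ (_ , l) → ζ ^ᶠ l) F.≈ mask (fieldRing 𝔽) X F.1# ζ
  mask-exponents {n} {m} X ζ = begin
    Σᶠ (exponents X) (λ (_ , l) → ζ ^ᶠ l)
      ≈⟨ Σᶠ-map exponent (points X) (λ (_ , l) → ζ ^ᶠ l) ⟩
    Σᶠ (points X) (λ (h , k) → ζ ^ᶠ toℕ k)
      ≈⟨ Σᶠ-filter X (cartesianProduct (allFin n) (allFin m)) (λ (h , k) → ζ ^ᶠ toℕ k) ⟩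
    Σᶠ (cartesianProduct (allFin n) (allFin m)) (λ (h , k) → if X (h , k) then ζ ^ᶠ toℕ k else F.0#)
      ≈⟨ Σᶠ-cartesianProduct (allFin n) (allFin m) _ ⟩
    Σᶠ (allFin n) (λ h → Σᶠ (allFin m) (λ k → if X (h , k) then ζ ^ᶠ toℕ k else F.0#))
      ≈⟨ Σᶠ-tabulate {m = n} (λ h → h) _ ⟩
    sum {n} (λ h → Σᶠ (allFin m) (λ k → if X (h , k) then ζ ^ᶠ toℕ k else F.0#))
      ≈⟨ sum-cong-≋ {n} (λ h → F.trans (Σᶠ-tabulate {m = m} (λ k → k) _) (sum-cong-≋ {m} λ k → term h k)) ⟩
    mask (fieldRing 𝔽) X F.1# ζ ∎
    where
    open import Relation.Binary.Reasoning.Setoid F.setoid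
    term : ∀ h k → (if X (h , k) then ζ ^ᶠ toℕ k else F.0#)
                   F.≈ (if X (h , k) then F.1# ^ᶠ toℕ h F.* ζ ^ᶠ toℕ k else F.0#)
    term h k with X (h , k)
    ... | true  = F.sym (F.trans (F.*-congʳ (1^≈1 𝓡 (toℕ h))) (F.*-identityˡ _))
    ... | false = F.refl

y^-twistExponent : ∀ n L z → let open RawRing ℤ[x,y]/⟨ n , L ⟩
                                 open RawSemiringDefs rawSemiring using () renaming (_^_ to _^ᴳ_)
                             in y^ n L z ≈ y₂ ^ᴳ twistExponent L z
y^-twistExponent n L (+ k)    = CommutativeRing.refl ℤ[x,y]/⟨ n , L ⟩-ring {y^ n L (+ k)}
y^-twistExponent n L -[1+ k ] =
  SemiringExp.^-assocʳ (CommutativeRing.commutativeSemiring ℤ[x,y]/⟨ n , L ⟩-ring) y₂ (L ∸ 1) (suc k)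

twistedSum≈mask : ∀ n L .{{_ : NonZero L}} {p} η (E : Fin p → Subset ℤ²[ n , L ]) →
  (∀ r s w w′ → w ∈ E r → w′ ∈ E s → translate (η *ℤ + toℕ r) w ≡ translate (η *ℤ + toℕ s) w′ → r ≡ s) →
  RawRing._≈_ ℤ[x,y]/⟨ n , L ⟩ (twistedSum η E) (maskᴳ (twistedUnion η E))
twistedSum≈mask n L {p} η E disjoint = mask-twistedUnion ℤ[x,y]/⟨ n , L ⟩-ring x₂ y₂ (y₂^L≈1 n L) η E
  (λ r → y^ n L (η *ℤ + toℕ r)) (λ r → y^-twistExponent n L (η *ℤ + toℕ r)) disjoint

theorem3p3 :
    ∀ {c ℓ₁ ℓ₂} (𝔽 : HeytingField c ℓ₁ ℓ₂) → CharacteristicZero 𝔽 →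
    (p n K : ℕ) → Prime p → 1 ≤ n → 1 ≤ K → gcd n p ≡ 1 →
    (ζ : HeytingField.Carrier 𝔽) → IsPrimitiveRoot 𝔽 p ζ →
    (P Q : Subset ℤ²[ n , p ^ K ]) → Tiles P Q → VanishesAt 𝔽 Q ζ →
    let L = p ^ (K ∸ 1)
        E = slice p K P
        C = slice p K Q
        open RawRing ℤ[x,y]/⟨ n , L ⟩ using () renaming (_≈_ to _≈ᴳ_)
        open RawRing ℤ[x]/⟨ n ⟩ using () renaming (_≈_ to _≈₁_)
    in
    ((η : ℤ) →
      (∃ λ (D : Subset ℤ²[ n , L ]) →
        (twistedSum η E ≈ᴳ maskᴳ D) ×
        ((q : Fin p) → Tiles D (C q)) ×
        (mask₁ D ≈₁ mask₁ P)) ×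
      ((r s : Fin p) → r ≢ s →
        shift (η *ℤ + toℕ r) (E r) ⊥ shift (η *ℤ + toℕ s) (E s))) ×
    (mask₁ Q ≈₁ sumMask₁ C)
-- The `K` bound here is one less than the exponent in the statement, so `L` is `p ^ K`; `K = 0` is
-- the case in which the second factor of G is trivial.
theorem3p3 𝔽 char0 p n (suc K) pp 1≤n 1≤K gcd≡1 ζ (ζᵖ≈1 , _) P Q tiles vanish =
  (λ η →
    (twistedUnion η E ,
     twistedSum≈mask n (p ^ K) η E (disjoint η) ,
     twistedUnion-tiles {p} {K} {n} P Q η count ,
     mask-twistedUnion-at-1 ℤ[x]/⟨ n ⟩-ring K η P x₁ (disjoint η)) ,
    λ { r s r≢s ((j , j∈E , j≡) , (j′ , j′∈E , j′≡)) →
        r≢s (disjoint η r s _ _ j∈E j′∈E (cong₂ _,_ refl (trans (sym j≡) j′≡))) }) ,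
  mask-slices ℤ[x]/⟨ n ⟩-ring p K Q x₁
  where
  instance
    n≢0 : NonZero n
    n≢0 = >-nonZero 1≤n
    p≢0 : NonZero p
    p≢0 = prime⇒nonZero pp
    L≢0 : NonZero (p ^ K)
    L≢0 = m^n≢0 p K
    N≢0 : NonZero (p ^ suc K)
    N≢0 = m^n≢0 p (suc K)
  E = slice p (suc K) P
  n⊥p = gcd≡1⇒coprime gcd≡1
  T = Tiles⇒TilesList P Q tiles
  module F = CommutativeRing (HeytingCommutativeRing.commutativeRing (HeytingField.heytingCommutativeRing 𝔽))
  -- The vanishing of Q at ζ enters here, through equidistribution.
  count = twisted-count pp n K n⊥p (exponents P) (exponents Q) T
    (equidistributed pp n K n⊥p (exponents P) (exponents Q) T 𝔽 char0 ζᵖ≈1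
      (F.trans (mask-exponents 𝔽 char0 Q ζ) vanish))
  disjoint : ∀ η r s u u′ → u ∈ E r → u′ ∈ E s →
    translate (η *ℤ + toℕ r) u ≡ translate (η *ℤ + toℕ s) u′ → r ≡ s
  disjoint η = slices-disjoint {p} {K} {n} P Q η count
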